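{- Let $k\ge 2$ be an integer and $\delta>0$ a constant. Builder has a $\left(\tau_k, (k/2 + 2^{ -k} + \delta)n\right)$-strategy that with high probability yields a graph with minimum degree at least $k$.
   Context: Let $V=[n]$, $N=\binom{n}{2}$, and let $e_1,\dots,e_N$ be a uniformly random permutation of the edges of the complete graph $K_n$ on $V$; $\mathbf{G}_{n,m}$ denotes the graph on $V$ with edge set $\{e_1,\dots,e_m\}$ (the random graph process). A player, Builder, sees the edges $e_1,e_2,\dots$ one by one and must decide irrevocably upon seeing $e_i$ whether to purchase it; her graph $B_i$ consists of the edges purchased among $e_1,\dots,e_i$. A $(t,b)$-strategy is an online algorithm (deterministic or randomised) that Builder follows in this model where she sees only the first $t$ edges of the permutation and purchases at most $b$ of them; the strategy yields the graph $B_t$. Here $\tau_k=\min\{m: \delta(\mathbf{G}_{n,m})\ge k\}$ is the hitting time for minimum degree at least $k$. "With high probability" means with probability tending to $1$ as $n\to\infty$. -}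

module Defs where

open import Data.Nat using (ℕ; zero; suc; _+_; _*_; _^_; _≤_; _≤ᵇ_)
open import Data.Bool using (Bool; true; false; if_then_else_; not; _∨_; _∧_)
open import Data.Fin using (Fin; _<?_; _≟_)
open import Data.List using (List; []; _∷_; _++_; [_]; map; concatMap; filter; filterᵇ; length; take; allFin; cartesianProduct; foldr)
open import Data.Product using (_×_; _,_)
open import Relation.Nullary.Decidable using (⌊_⌋)

-- An edge of K_n is a pair (i , j) of vertices with i < j.
Edge : ℕ → Set
Edge n = Fin n × Fin n

allEdges : (n : ℕ) → List (Edge n)
allEdges n = filter (λ { (i , j) → i <? j }) (cartesianProduct (allFin n) (allFin n))

-- All orderings (permutations) of a list; for a list of distinct elements
-- each ordering appears exactly once, so uniform choice from this list is
-- a uniformly random permutation.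
insertAll : {A : Set} → A → List A → List (List A)
insertAll x [] = [ x ∷ [] ]
insertAll x (y ∷ ys) = (x ∷ y ∷ ys) ∷ map (y ∷_) (insertAll x ys)

perms : {A : Set} → List A → List (List A)
perms [] = [ [] ]
perms (x ∷ xs) = concatMap (insertAll x) (perms xs)

degree : {n : ℕ} → List (Edge n) → Fin n → ℕ
degree es v = length (filterᵇ (λ { (i , j) → ⌊ i ≟ v ⌋ ∨ ⌊ j ≟ v ⌋ }) es)

minDegAtLeast : {n : ℕ} → ℕ → List (Edge n) → Bool
minDegAtLeast {n} k es = foldr (λ v acc → (k ≤ᵇ degree es v) ∧ acc) true (allFin n)

-- Hitting time τ_k of the edge ordering π: least m with δ(G_m) ≥ k
-- (if no such m exists, which only happens for n ≤ k, it returns length π + 1, so all edges are seen).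
tauAux : {n : ℕ} → ℕ → List (Edge n) → ℕ → ℕ → ℕ
tauAux k π zero m = m
tauAux k π (suc f) m = if minDegAtLeast k (take m π) then m else tauAux k π f (suc m)

tau : {n : ℕ} → ℕ → List (Edge n) → ℕ
tau k π = tauAux k π (suc (length π)) 0

-- A (deterministic) online strategy for Builder on n vertices: given the
-- edges seen so far (in order) and the current edge, decide whether to buy it.
Strategy : ℕ → Set
Strategy n = List (Edge n) → Edge n → Bool

runAux : {n : ℕ} → Strategy n → List (Edge n) → List (Edge n) → List (Edge n)
runAux s seen [] = []
runAux s seen (e ∷ es) =
  if s seen e then e ∷ runAux s (seen ++ [ e ]) es else runAux s (seen ++ [ e ]) es

run : {n : ℕ} → Strategy n → List (Edge n) → List (Edge n)
run s π = runAux s [] π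

builderGraph : {n : ℕ} → ℕ → Strategy n → List (Edge n) → List (Edge n)
builderGraph k s π = run s (take (tau k π) π)

failures : (n k : ℕ) → Strategy n → ℕ
failures n k s = length (filterᵇ (λ π → not (minDegAtLeast k (builderGraph k s π))) (perms (allEdges n)))

totalOrders : ℕ → ℕ
totalOrders n = length (perms (allEdges n))

-- Budget condition: b ≤ (k/2 + 2^{-k} + p/q) n, multiplied out by 2^(k+1) q.
WithinBudget : (k p q n b : ℕ) → Set
WithinBudget k p q n b =
  b * (2 ^ suc k * q) ≤ n * (k * 2 ^ k * q + 2 * q + 2 ^ suc k * p)

-- Call a vertex deficient while Builder has bought fewer than k of its edges. Builder buys an edge if both ends
-- are deficient, if it is the first edge at one of its ends, or if one end is deficient and urgent: the edge comes
-- after time T n, or that end has already seen K edges. Edges joining two deficient ends cost k n / 2 in total, and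
-- an edge with a single deficient end costs 1/2 extra.
--   * A first edge of v at a saturated w requires the first k edges at v or w to fall at w, so there are at most
--     2^(-k) n such edges in expectation; the conditional expectation is a supermartingale with bounded increments,
--     which gives concentration.
--   * An edge inside the deficient set is always bought, so after time T n few vertices are deficient.
--   * Builder fails at v only if v has d edges before time T n, where 0 < d < K + k, and at most k - 2 edges between
--     T n and τ_k. Moving one of these early edges into that window and the others beyond it makes v one of at most
--     d vertices that reach degree k last, and this can be reversed in few ways because τ_k / n tends to infinity.
--     The latter follows from the potential 1 / (1 + number of isolated vertices).
-- T and K depend on the failure probability aimed at, which is finally sent to 0 along a diagonal.
module Submission where

open import Defs
open import Data.Bool using (Bool; true; false; if_then_else_; not; _∨_; _∧_) renaming (T to IsTrue)
open import Data.Empty using (⊥; ⊥-elim)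
open import Data.Fin using (Fin) renaming (_≟_ to _≟F_; _<?_ to _<F?_)
import Data.Fin.Properties as Fin
open import Data.List using (List; []; _∷_; _++_; [_]; _∷ʳ_; map; concatMap; filter; filterᵇ; length; take; drop; allFin; cartesianProduct; foldr; upTo)
open import Data.List.Properties using (++-assoc; ++-identityʳ; length-++; take++drop≡id; length-take; length-drop; ∷-injective; ∷-injectiveˡ; ∷-injectiveʳ; map-upTo; length-tabulate; length-upTo; upTo-∷ʳ; take-all)
open import Data.List.Membership.Propositional using (_∈_; _∉_; lose; find)
open import Data.List.Membership.Propositional.Properties using (∈-++⁺ˡ; ∈-++⁺ʳ; ∈-++⁻; ∈-map⁺; ∈-map⁻; ∈-concatMap⁺; ∈-concatMap⁻; ∈-∃++; ∈-filter⁻; ∈-allFin; ∈-upTo⁺; ∈-upTo⁻)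
open import Data.List.Membership.Propositional.Properties.WithK using (unique∧set⇒bag)
open import Data.List.Relation.Binary.BagAndSetEquality using (∼bag⇒↭)
open import Data.List.Relation.Binary.Disjoint.Propositional using (Disjoint)
open import Data.List.Relation.Binary.Permutation.Propositional using (_↭_; ↭-refl; ↭-sym; ↭-trans; prep; swap; ↭-reflexive)
open import Data.List.Relation.Binary.Permutation.Propositional.Properties using (∈-resp-↭; shift; drop-mid; ↭-length)
open import Data.List.Relation.Unary.All as All using (All; []; _∷_)
open import Data.List.Relation.Unary.AllPairs using ([]; _∷_)
open import Data.List.Relation.Unary.Any using (here; there)
open import Data.List.Relation.Unary.Unique.Propositional using (Unique)
import Data.List.Relation.Unary.Unique.Propositional.Properties as Unique
open import Data.Nat
open import Data.Nat.DivMod using (_/_; m*[n/m]≡n; m≡m%n+[m/n]*n; m%n<n; _%_)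
open import Data.Nat.Divisibility using (∣-trans; m∣m*n; m≤n⇒m!∣n!)
open import Data.Nat.Properties
open import Data.Nat.Tactic.RingSolver using (solve-∀)
open import Data.Product using (Σ; ∃; _×_; _,_; proj₁; proj₂)
open import Data.Sum using (_⊎_; inj₁; inj₂; [_,_]′)
open import Data.Unit using (⊤; tt)
open import Function using (_∘_; id; mk⇔)
open import Relation.Binary.Definitions using (tri<; tri≈; tri>)
open import Relation.Binary.PropositionalEquality using (_≡_; _≢_; refl; sym; trans; cong; cong₂; subst; subst₂; module ≡-Reasoning)
open import Relation.Nullary using (Dec; yes; no; ¬_; contradiction)
open import Relation.Nullary.Decidable using (⌊_⌋; _×-dec_; _⊎-dec_; ¬?)

-- Probabilities are counts of orderings, and every inequality is multiplied out. A conditional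
-- expectation after the history `h` is a sum over the unseen edges `r`, compared with `length r`
-- times a value. The first edge at a vertex is bought at any price because this takes the late
-- edges of a failing vertex from k - 1 down to k - 2: when one early edge has been moved into the
-- window, their number is still below k, and so at the earliest time in question all the vertices
-- concerned still have degree below k and are few. Only this one move gains: about T n (k - 1) ways
-- back against order M n places forward, with M chosen after T. Each move beyond the window costs a
-- bounded factor, order T n^2 against n^2 / 8. The rule about K seen edges exists to bound the
-- number of these moves, and with it the product of their factors, independently of n.

private
  variable
    A B : Set
    n : ℕ

*-left-comm : ∀ a b c → a * (b * c) ≡ b * (a * c)
*-left-comm = solve-∀

*-turn : ∀ a b c → a * (b * c) ≡ b * a * c
*-turn = solve-∀

*-swap-assoc : ∀ a b c → a * b * c ≡ b * (a * c)
*-swap-assoc = solve-∀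

+-left-comm : ∀ a b c → a + (b + c) ≡ b + (a + c)
+-left-comm = solve-∀

-- Finite sums and indicators

∑ : List A → (A → ℕ) → ℕ
∑ [] f = 0
∑ (x ∷ xs) f = f x + ∑ xs f

∑-mono : ∀ (xs : List A) {f g : A → ℕ} → (∀ x → x ∈ xs → f x ≤ g x) → ∑ xs f ≤ ∑ xs g
∑-mono [] f≤g = z≤n
∑-mono (x ∷ xs) f≤g = +-mono-≤ (f≤g x (here refl)) (∑-mono xs (λ y y∈ → f≤g y (there y∈)))

∑-cong : ∀ (xs : List A) {f g : A → ℕ} → (∀ x → x ∈ xs → f x ≡ g x) → ∑ xs f ≡ ∑ xs g
∑-cong [] f≡g = refl
∑-cong (x ∷ xs) f≡g = cong₂ _+_ (f≡g x (here refl)) (∑-cong xs (λ y y∈ → f≡g y (there y∈)))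

∑-+ : ∀ (xs : List A) (f g : A → ℕ) → ∑ xs (λ x → f x + g x) ≡ ∑ xs f + ∑ xs g
∑-+ [] f g = refl
∑-+ (x ∷ xs) f g rewrite ∑-+ xs f g = interchange (f x) (g x) (∑ xs f) (∑ xs g)
  where
  interchange : ∀ a b c d → (a + b) + (c + d) ≡ (a + c) + (b + d)
  interchange = solve-∀

∑-*ˡ : ∀ (xs : List A) (c : ℕ) (f : A → ℕ) → ∑ xs (λ x → c * f x) ≡ c * ∑ xs f
∑-*ˡ [] c f = sym (*-zeroʳ c)
∑-*ˡ (x ∷ xs) c f rewrite ∑-*ˡ xs c f = sym (*-distribˡ-+ c (f x) (∑ xs f))

∑-*ʳ : ∀ (xs : List A) (f : A → ℕ) (c : ℕ) → ∑ xs (λ x → f x * c) ≡ ∑ xs f * c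
∑-*ʳ xs f c = trans (∑-cong xs (λ x _ → *-comm (f x) c)) (trans (∑-*ˡ xs c f) (*-comm c _))

∑-const : ∀ (xs : List A) (c : ℕ) → ∑ xs (λ _ → c) ≡ length xs * c
∑-const [] c = refl
∑-const (x ∷ xs) c = cong (c +_) (∑-const xs c)

∑-zero : ∀ (xs : List A) → ∑ xs (λ _ → 0) ≡ 0
∑-zero xs = trans (∑-const xs 0) (*-zeroʳ (length xs))

∑-≤-const : ∀ (xs : List A) {f : A → ℕ} (c : ℕ) → (∀ x → x ∈ xs → f x ≤ c) → ∑ xs f ≤ length xs * c
∑-≤-const xs c f≤c = ≤-trans (∑-mono xs f≤c) (≤-reflexive (∑-const xs c))

∑-comm : ∀ (xs : List A) (ys : List B) (f : A → B → ℕ) →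
  ∑ xs (λ x → ∑ ys (f x)) ≡ ∑ ys (λ y → ∑ xs (λ x → f x y))
∑-comm [] ys f = sym (∑-zero ys)
∑-comm (x ∷ xs) ys f rewrite ∑-comm xs ys f = sym (∑-+ ys (f x) (λ y → ∑ xs (λ z → f z y)))

∑-++ : ∀ (xs ys : List A) (f : A → ℕ) → ∑ (xs ++ ys) f ≡ ∑ xs f + ∑ ys f
∑-++ [] ys f = refl
∑-++ (x ∷ xs) ys f rewrite ∑-++ xs ys f = sym (+-assoc (f x) _ _)

∑-∷ʳ : ∀ (xs : List A) (x : A) (f : A → ℕ) → ∑ (xs ∷ʳ x) f ≡ ∑ xs f + f x
∑-∷ʳ xs x f = trans (∑-++ xs [ x ] f) (cong (∑ xs f +_) (+-identityʳ (f x)))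

∑-map : ∀ (g : A → B) (xs : List A) (f : B → ℕ) → ∑ (map g xs) f ≡ ∑ xs (f ∘ g)
∑-map g [] f = refl
∑-map g (x ∷ xs) f = cong (f (g x) +_) (∑-map g xs f)

∑-↭ : ∀ {xs ys : List A} (f : A → ℕ) → xs ↭ ys → ∑ xs f ≡ ∑ ys f
∑-↭ f _↭_.refl = refl
∑-↭ f (prep x p) = cong (f x +_) (∑-↭ f p)
∑-↭ f (swap x y p) rewrite ∑-↭ f p = +-left-comm (f x) (f y) _
∑-↭ f (_↭_.trans p q) = trans (∑-↭ f p) (∑-↭ f q)

∑-∈ : ∀ {xs : List A} {x : A} (f : A → ℕ) → x ∈ xs → f x ≤ ∑ xs f
∑-∈ f (here refl) = m≤m+n _ _
∑-∈ {xs = y ∷ ys} f (there p) = ≤-trans (∑-∈ f p) (m≤n+m _ (f y))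

∑-positive : ∀ (xs : List A) (f : A → ℕ) → 1 ≤ ∑ xs f → ∃ λ x → x ∈ xs × 1 ≤ f x
∑-positive (x ∷ xs) f p with f x in eq
... | suc _ = x , here refl , subst (1 ≤_) (sym eq) (s≤s z≤n)
... | zero with y , y∈ , q ← ∑-positive xs f p = y , there y∈ , q

by-cases : {P X : Set} → Dec P → (P → X) → (¬ P → X) → X
by-cases (yes p) f g = f p
by-cases (no ¬p) f g = g ¬p

χ : {P : Set} → Dec P → ℕ
χ (yes _) = 1
χ (no _) = 0

χ-yes : {P : Set} (d : Dec P) → P → χ d ≡ 1
χ-yes (yes _) p = refl
χ-yes (no ¬p) p = ⊥-elim (¬p p)

χ-no : {P : Set} (d : Dec P) → ¬ P → χ d ≡ 0
χ-no (yes p) ¬p = ⊥-elim (¬p p)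
χ-no (no _) ¬p = refl

χ≤1 : {P : Set} (d : Dec P) → χ d ≤ 1
χ≤1 (yes _) = s≤s z≤n
χ≤1 (no _) = z≤n

χ-mono : {P Q : Set} (d : Dec P) (e : Dec Q) → (P → Q) → χ d ≤ χ e
χ-mono (yes p) e f = ≤-reflexive (sym (χ-yes e (f p)))
χ-mono (no _) e f = z≤n

χ-≤ : {P : Set} (d : Dec P) {b : ℕ} → (P → 1 ≤ b) → χ d ≤ b
χ-≤ (yes p) f = f p
χ-≤ (no _) f = z≤n

χ-pos : {P : Set} (d : Dec P) → 1 ≤ χ d → P
χ-pos (yes p) _ = p

-- Uniform averages over orderings

insertAll⁺ : ∀ (x : A) a b → a ++ x ∷ b ∈ insertAll x (a ++ b)
insertAll⁺ x [] [] = here refl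
insertAll⁺ x [] (_ ∷ _) = here refl
insertAll⁺ x (y ∷ a) b = there (∈-map⁺ (y ∷_) (insertAll⁺ x a b))

insertAll⁻ : ∀ (x : A) zs {w} → w ∈ insertAll x zs → ∃ λ a → ∃ λ b → zs ≡ a ++ b × w ≡ a ++ x ∷ b
insertAll⁻ x [] (here refl) = [] , [] , refl , refl
insertAll⁻ x (y ∷ ys) (here refl) = [] , y ∷ ys , refl , refl
insertAll⁻ x (y ∷ ys) (there w∈) with ∈-map⁻ (y ∷_) w∈
... | w′ , w′∈ , refl with insertAll⁻ x ys w′∈
... | a , b , refl , refl = y ∷ a , b , refl , refl

perms⇒↭ : ∀ (xs : List A) {π} → π ∈ perms xs → π ↭ xs
perms⇒↭ [] (here refl) = ↭-refl
perms⇒↭ (x ∷ xs) π∈ with find (∈-concatMap⁻ (insertAll x) {xs = perms xs} π∈)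
... | ρ , ρ∈ , π∈ρ with insertAll⁻ x ρ π∈ρ
... | a , b , refl , refl = ↭-trans (shift x a b) (prep x (perms⇒↭ xs ρ∈))

↭⇒perms : ∀ (xs : List A) {π} → π ↭ xs → π ∈ perms xs
↭⇒perms [] {[]} p = here refl
↭⇒perms [] {_ ∷ _} p = contradiction (↭-length p) (λ ())
↭⇒perms (x ∷ xs) p with ∈-∃++ (∈-resp-↭ (↭-sym p) (here refl))
... | a , b , refl = ∈-concatMap⁺ (insertAll x) (lose (↭⇒perms xs (drop-mid a [] p)) (insertAll⁺ x a b))

insertAll-unique : ∀ (x : A) zs → x ∉ zs → Unique (insertAll x zs)
insertAll-unique x [] x∉ = [] ∷ []
insertAll-unique x (y ∷ ys) x∉ =
  All.tabulate (λ {w} w∈ eq → x≢head (proj₂ (proj₂ (∈-map⁻ (y ∷_) w∈))) eq)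
  ∷ Unique.map⁺ (proj₂ ∘ ∷-injective) (insertAll-unique x ys (x∉ ∘ there))
  where
  x≢head : ∀ {w w′} → w ≡ y ∷ w′ → x ∷ y ∷ ys ≡ w → ⊥
  x≢head refl eq = x∉ (here (∷-injectiveˡ eq))

insertion-point-unique : ∀ (x : A) a b a′ b′ → x ∉ a ++ b → x ∉ a′ ++ b′ →
  a ++ x ∷ b ≡ a′ ++ x ∷ b′ → a ++ b ≡ a′ ++ b′
insertion-point-unique x [] b [] b′ p q eq = ∷-injectiveʳ eq
insertion-point-unique x [] b (y ∷ a′) b′ p q eq = ⊥-elim (q (here (∷-injectiveˡ eq)))
insertion-point-unique x (y ∷ a) b [] b′ p q eq = ⊥-elim (p (here (sym (∷-injectiveˡ eq))))
insertion-point-unique x (y ∷ a) b (y′ ∷ a′) b′ p q eq with ∷-injective eq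
... | refl , eq′ = cong (y ∷_) (insertion-point-unique x a b a′ b′ (p ∘ there) (q ∘ there) eq′)

concatMap-unique : ∀ (f : A → List B) {xs} → Unique xs → (∀ {x} → x ∈ xs → Unique (f x)) →
  (∀ {x y} → x ∈ xs → y ∈ xs → x ≢ y → Disjoint (f x) (f y)) → Unique (concatMap f xs)
concatMap-unique f [] u d = []
concatMap-unique f {x ∷ xs} (x≢ ∷ !xs) u d =
  Unique.++⁺ (u (here refl)) (concatMap-unique f !xs (u ∘ there) (λ p q → d (there p) (there q))) disjoint
  where
  disjoint : Disjoint (f x) (concatMap f xs)
  disjoint (v∈x , v∈xs) with find (∈-concatMap⁻ f {xs = xs} v∈xs)
  ... | y , y∈ , v∈y = d (here refl) (there y∈) (All.lookup x≢ y∈) (v∈x , v∈y)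

perms-unique : ∀ {xs : List A} → Unique xs → Unique (perms xs)
perms-unique [] = [] ∷ []
perms-unique {xs = x ∷ xs} (x≢ ∷ !xs) =
  concatMap-unique (insertAll x) (perms-unique !xs)
    (λ {ρ} ρ∈ → insertAll-unique x ρ (x∉ ρ∈))
    (λ {ρ} {σ} ρ∈ σ∈ ρ≢σ (v∈ρ , v∈σ) → ρ≢σ (same ρ∈ σ∈ (insertAll⁻ x ρ v∈ρ) (insertAll⁻ x σ v∈σ)))
  where
  x∉ : ∀ {ρ} → ρ ∈ perms xs → x ∉ ρ
  x∉ ρ∈ x∈ρ = All.lookup x≢ (∈-resp-↭ (perms⇒↭ xs ρ∈) x∈ρ) refl
  same : ∀ {ρ σ v} → ρ ∈ perms xs → σ ∈ perms xs →
    (∃ λ a → ∃ λ b → ρ ≡ a ++ b × v ≡ a ++ x ∷ b) → (∃ λ a → ∃ λ b → σ ≡ a ++ b × v ≡ a ++ x ∷ b) → ρ ≡ σ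
  same ρ∈ σ∈ (a , b , refl , refl) (a′ , b′ , refl , eq) =
    insertion-point-unique x a b a′ b′ (x∉ ρ∈) (x∉ σ∈) eq

-- The images of the orderings under `g` are duplicate-free and have the same members as the
-- orderings; two such lists are permutations of each other.
∑-involution : ∀ {xs : List A} → Unique xs → (g : List A → List A) → (∀ π → g (g π) ≡ π) → (∀ π → g π ↭ π) →
  ∀ f → ∑ (perms xs) (f ∘ g) ≡ ∑ (perms xs) f
∑-involution {xs = xs} !xs g gg g↭ f =
  trans (sym (∑-map g (perms xs) f)) (∑-↭ f (∼bag⇒↭ (unique∧set⇒bag
    (Unique.map⁺ injective (perms-unique !xs)) (perms-unique !xs) (mk⇔ to from))))
  where
  injective : ∀ {π ρ} → g π ≡ g ρ → π ≡ ρ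
  injective {π} {ρ} eq = trans (sym (gg π)) (trans (cong g eq) (gg ρ))
  to : ∀ {π} → π ∈ map g (perms xs) → π ∈ perms xs
  to π∈ with ∈-map⁻ g π∈
  ... | ρ , ρ∈ , refl = ↭⇒perms xs (↭-trans (g↭ ρ) (perms⇒↭ xs ρ∈))
  from : ∀ {π} → π ∈ perms xs → π ∈ map g (perms xs)
  from {π} π∈ = subst (_∈ map g (perms xs)) (gg π)
    (∈-map⁺ g (↭⇒perms xs (↭-trans (g↭ π) (perms⇒↭ xs π∈))))

-- Transpositions of two positions

exchange : ℕ → A → List A → A × List A
exchange _ x [] = x , []
exchange zero x (y ∷ ys) = y , x ∷ ys
exchange (suc d) x (y ∷ ys) = proj₁ (exchange d x ys) , y ∷ proj₂ (exchange d x ys)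

-- Interchanges the entries at positions i and i + d (the identity if the latter is out of range).
transpose : ℕ → ℕ → List A → List A
transpose _ _ [] = []
transpose zero zero π = π
transpose zero (suc d) (x ∷ xs) = proj₁ (exchange d x xs) ∷ proj₂ (exchange d x xs)
transpose (suc i) d (x ∷ xs) = x ∷ transpose i d xs

exchange-↭ : ∀ d (x : A) xs → proj₁ (exchange d x xs) ∷ proj₂ (exchange d x xs) ↭ x ∷ xs
exchange-↭ zero x [] = ↭-refl
exchange-↭ (suc d) x [] = ↭-refl
exchange-↭ zero x (y ∷ ys) = swap y x ↭-refl
exchange-↭ (suc d) x (y ∷ ys) = ↭-trans (swap _ y ↭-refl) (↭-trans (prep y (exchange-↭ d x ys)) (swap y x ↭-refl))

exchange-involutive : ∀ d (x : A) xs → exchange d (proj₁ (exchange d x xs)) (proj₂ (exchange d x xs)) ≡ (x , xs)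
exchange-involutive zero x [] = refl
exchange-involutive (suc d) x [] = refl
exchange-involutive zero x (y ∷ ys) = refl
exchange-involutive (suc d) x (y ∷ ys) rewrite exchange-involutive d x ys = refl

transpose-↭ : ∀ i d (π : List A) → transpose i d π ↭ π
transpose-↭ _ _ [] = ↭-refl
transpose-↭ zero zero (x ∷ xs) = ↭-refl
transpose-↭ zero (suc d) (x ∷ xs) = exchange-↭ d x xs
transpose-↭ (suc i) d (x ∷ xs) = prep x (transpose-↭ i d xs)

transpose-involutive : ∀ i d (π : List A) → transpose i d (transpose i d π) ≡ π
transpose-involutive zero zero [] = refl
transpose-involutive zero (suc d) [] = refl
transpose-involutive (suc i) d [] = refl
transpose-involutive zero zero (x ∷ xs) = refl
transpose-involutive zero (suc d) (x ∷ xs) rewrite exchange-involutive d x xs = refl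
transpose-involutive (suc i) d (x ∷ xs) = cong (x ∷_) (transpose-involutive i d xs)

∑-transpose : ∀ {xs : List A} → Unique xs → ∀ i d f → ∑ (perms xs) (f ∘ transpose i d) ≡ ∑ (perms xs) f
∑-transpose !xs i d = ∑-involution !xs (transpose i d) (transpose-involutive i d) (transpose-↭ i d)

∑-upTo-suc : ∀ n (f : ℕ → ℕ) → ∑ (upTo (suc n)) f ≡ f 0 + ∑ (upTo n) (f ∘ suc)
∑-upTo-suc n f = cong (f 0 +_) (trans (cong (λ l → ∑ l f) (sym (map-upTo suc n))) (∑-map suc (upTo n) f))

-- Exchanging position `m` with position `m + d` brings the `d`-th unseen entry to position `m` and
-- leaves the first `m` entries alone, so `d` runs through all possible next entries.
∑-next : ∀ m (π : List A) (f : List A → ℕ) →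
  ∑ (upTo (length π ∸ m)) (λ d → f (take (suc m) (transpose m d π))) ≡ ∑ (drop m π) (λ x → f (take m π ∷ʳ x))
∑-next zero [] f = refl
∑-next (suc m) [] f = refl
∑-next zero (x ∷ xs) f = trans (∑-upTo-suc (length xs) _) (cong (f [ x ] +_) (go x xs))
  where
  go : ∀ x xs → ∑ (upTo (length xs)) (λ d → f [ proj₁ (exchange d x xs) ]) ≡ ∑ xs (λ y → f [ y ])
  go x [] = refl
  go x (y ∷ ys) = trans (∑-upTo-suc (length ys) _) (cong (f [ y ] +_) (go x ys))
∑-next (suc m) (x ∷ xs) f = ∑-next m xs (f ∘ (x ∷_))

-- Exchanging position m with each later position in turn makes the next entry uniform among the remaining ones.
one-step : ∀ {xs : List A} → Unique xs → ∀ (V : List A → ℕ) (a b c m : ℕ) → m < length xs →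
  (∀ h r → length h ≡ m → h ++ r ↭ xs → b * ∑ r (λ x → V (h ∷ʳ x)) ≤ length r * (a * V h + c)) →
  b * ∑ (perms xs) (λ π → V (take (suc m) π)) ≤ a * ∑ (perms xs) (λ π → V (take m π)) + length (perms xs) * c
one-step {xs = xs} !xs V a b c m m<N hyp = *-cancelˡ-≤ R (begin
  R * (b * S) ≡⟨ *-left-comm R b S ⟩
  b * (R * S) ≡⟨ cong (b *_) average ⟩
  b * ∑ P (λ π → ∑ (drop m π) (λ x → V (take m π ∷ʳ x))) ≡⟨ ∑-*ˡ P b _ ⟨
  ∑ P (λ π → b * ∑ (drop m π) (λ x → V (take m π ∷ʳ x))) ≤⟨ ∑-mono P step ⟩
  ∑ P (λ π → R * (a * V (take m π) + c)) ≡⟨ ∑-*ˡ P R _ ⟩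
  R * ∑ P (λ π → a * V (take m π) + c) ≡⟨ cong (R *_) (∑-+ P _ _) ⟩
  R * (∑ P (λ π → a * V (take m π)) + ∑ P (λ _ → c)) ≡⟨ cong (R *_) (cong₂ _+_ (∑-*ˡ P a _) (∑-const P c)) ⟩
  R * (a * ∑ P (λ π → V (take m π)) + length P * c) ∎)
  where
  open ≤-Reasoning
  P = perms xs
  R = length xs ∸ m
  S = ∑ P (λ π → V (take (suc m) π))
  instance
    R≢0 : NonZero R
    R≢0 = >-nonZero (m<n⇒0<n∸m m<N)
  len : ∀ {π} → π ∈ P → length π ≡ length xs
  len π∈ = ↭-length (perms⇒↭ xs π∈)
  average : R * S ≡ ∑ P (λ π → ∑ (drop m π) (λ x → V (take m π ∷ʳ x)))
  average = trans (cong (_* S) (sym (length-upTo R))) (trans (sym (∑-const (upTo R) S))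
    (trans (∑-cong (upTo R) (λ d _ → sym (∑-transpose !xs m d (λ π → V (take (suc m) π)))))
    (trans (∑-comm (upTo R) P _)
    (∑-cong P (λ π π∈ → trans (cong (λ l → ∑ (upTo (l ∸ m)) (λ d → V (take (suc m) (transpose m d π)))) (sym (len π∈)))
                              (∑-next m π V))))))
  step : ∀ π → π ∈ P → b * ∑ (drop m π) (λ x → V (take m π ∷ʳ x)) ≤ R * (a * V (take m π) + c)
  step π π∈ = subst (λ l → b * ∑ (drop m π) (λ x → V (take m π ∷ʳ x)) ≤ l * (a * V (take m π) + c))
    (trans (length-drop m π) (cong (_∸ m) (len π∈)))
    (hyp (take m π) (drop m π)
      (trans (length-take m π) (m≤n⇒m⊓n≡m (subst (m ≤_) (sym (len π∈)) (<⇒≤ m<N))))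
      (↭-trans (↭-reflexive (take++drop≡id m π)) (perms⇒↭ xs π∈)))

-- The hypothesis bounds the mean of `V` over the next entry, given the history `h`. With `c = 0`
-- this is the supermartingale inequality.
additive-drift : ∀ {xs : List A} → Unique xs → ∀ (V : List A → ℕ) (c m : ℕ) → m ≤ length xs →
  (∀ h r → length h < m → h ++ r ↭ xs → ∑ r (λ x → V (h ∷ʳ x)) ≤ length r * (V h + c)) →
  ∑ (perms xs) (λ π → V (take m π)) ≤ length (perms xs) * (V [] + m * c)
additive-drift {xs = xs} !xs V c zero _ hyp =
  ≤-reflexive (trans (∑-const (perms xs) (V [])) (cong (length (perms xs) *_) (sym (+-identityʳ (V [])))))
additive-drift {xs = xs} !xs V c (suc m) m<N hyp = begin
  ∑ P (λ π → V (take (suc m) π)) ≡⟨ *-identityˡ _ ⟨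
  1 * ∑ P (λ π → V (take (suc m) π)) ≤⟨ one-step !xs V 1 1 c m m<N hyp₁ ⟩
  1 * ∑ P (λ π → V (take m π)) + length P * c ≡⟨ cong (_+ length P * c) (*-identityˡ _) ⟩
  ∑ P (λ π → V (take m π)) + length P * c
    ≤⟨ +-monoˡ-≤ _ (additive-drift !xs V c m (<⇒≤ m<N) (λ h r h< → hyp h r (m<n⇒m<1+n h<))) ⟩
  length P * (V [] + m * c) + length P * c ≡⟨ collect (length P) (V []) m c ⟩
  length P * (V [] + (c + m * c)) ∎
  where
  open ≤-Reasoning
  P = perms xs
  collect : ∀ p v m c → p * (v + m * c) + p * c ≡ p * (v + (c + m * c))
  collect = solve-∀
  hyp₁ : ∀ h r → length h ≡ m → h ++ r ↭ xs → 1 * ∑ r (λ x → V (h ∷ʳ x)) ≤ length r * (1 * V h + c)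
  hyp₁ h r refl p = subst₂ _≤_ (sym (*-identityˡ _)) (cong (λ v → length r * (v + c)) (sym (*-identityˡ (V h))))
    (hyp h r ≤-refl p)

-- The growth factor is the fraction `a / b`. Only histories shorter than `m` are constrained,
-- because the drift of the isolated vertices is controlled only while many edges are unseen.
multiplicative-drift : ∀ {xs : List A} → Unique xs → ∀ (V : List A → ℕ) (a b m : ℕ) → m ≤ length xs →
  (∀ h r → length h < m → h ++ r ↭ xs → b * ∑ r (λ x → V (h ∷ʳ x)) ≤ length r * (a * V h)) →
  b ^ m * ∑ (perms xs) (λ π → V (take m π)) ≤ a ^ m * (length (perms xs) * V [])
multiplicative-drift {xs = xs} !xs V a b zero _ hyp =
  ≤-reflexive (cong (1 *_) (∑-const (perms xs) (V [])))
multiplicative-drift {xs = xs} !xs V a b (suc m) m<N hyp = begin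
  b * b ^ m * ∑ P (λ π → V (take (suc m) π)) ≡⟨ *-swap-assoc b (b ^ m) _ ⟩
  b ^ m * (b * ∑ P (λ π → V (take (suc m) π))) ≤⟨ *-monoʳ-≤ (b ^ m) (one-step !xs V a b 0 m m<N hyp₁) ⟩
  b ^ m * (a * ∑ P (λ π → V (take m π)) + length P * 0) ≡⟨ reorder′ (b ^ m) a _ (length P) ⟩
  a * (b ^ m * ∑ P (λ π → V (take m π)))
    ≤⟨ *-monoʳ-≤ a (multiplicative-drift !xs V a b m (<⇒≤ m<N) (λ h r h< → hyp h r (m<n⇒m<1+n h<))) ⟩
  a * (a ^ m * (length P * V [])) ≡⟨ *-assoc a (a ^ m) _ ⟨
  a * a ^ m * (length P * V []) ∎
  where
  open ≤-Reasoning
  P = perms xs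
  reorder′ : ∀ c a s l → c * (a * s + l * 0) ≡ a * (c * s)
  reorder′ = solve-∀
  hyp₁ : ∀ h r → length h ≡ m → h ++ r ↭ xs → b * ∑ r (λ x → V (h ∷ʳ x)) ≤ length r * (a * V h + 0)
  hyp₁ h r refl p = subst (λ v → b * ∑ r (λ x → V (h ∷ʳ x)) ≤ length r * v) (sym (+-identityʳ _)) (hyp h r ≤-refl p)

-- Sums over pairs and over single vertices

∑-filter : ∀ {P : A → Set} (P? : ∀ x → Dec (P x)) (xs : List A) (f : A → ℕ) →
  ∑ (filter P? xs) f ≡ ∑ xs (λ x → χ (P? x) * f x)
∑-filter P? [] f = refl
∑-filter P? (x ∷ xs) f with P? x
... | yes _ = cong₂ _+_ (sym (+-identityʳ (f x))) (∑-filter P? xs f)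
... | no _ = ∑-filter P? xs f

∑-cartesianProduct : ∀ (xs : List A) (ys : List B) (f : A × B → ℕ) →
  ∑ (cartesianProduct xs ys) f ≡ ∑ xs (λ x → ∑ ys (λ y → f (x , y)))
∑-cartesianProduct [] ys f = refl
∑-cartesianProduct (x ∷ xs) ys f = trans (∑-++ (map (x ,_) ys) _ f)
  (cong₂ _+_ (∑-map (x ,_) ys f) (∑-cartesianProduct xs ys f))

∑-product : ∀ (xs : List A) (ys : List B) (f : A → ℕ) (g : B → ℕ) →
  ∑ xs (λ x → ∑ ys (λ y → f x * g y)) ≡ ∑ xs f * ∑ ys g
∑-product xs ys f g = trans (∑-cong xs (λ x _ → ∑-*ˡ ys (f x) g)) (∑-*ʳ xs f (∑ ys g))

∑-single : ∀ {xs : List (Fin n)} → Unique xs → ∀ {i} → i ∈ xs → (f : Fin n → ℕ) →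
  ∑ xs (λ v → χ (i ≟F v) * f v) ≡ f i
∑-single {xs = x ∷ xs} (x≢ ∷ _) (here refl) f = trans
  (cong₂ _+_ (trans (cong (_* f x) (χ-yes (x ≟F x) refl)) (*-identityˡ (f x)))
    (trans (∑-cong xs (λ y y∈ → cong (_* f y) (χ-no (x ≟F y) (All.lookup x≢ y∈)))) (∑-zero xs)))
  (+-identityʳ (f x))
∑-single {xs = x ∷ xs} (x≢ ∷ !xs) {i} (there i∈) f =
  cong₂ _+_ (cong (_* f x) (χ-no (i ≟F x) (λ i≡x → All.lookup x≢ i∈ (sym i≡x)))) (∑-single !xs i∈ f)

-- Degrees

vertices : (n : ℕ) → List (Fin n)
vertices = allFin

length-vertices : ∀ n → length (vertices n) ≡ n
length-vertices n = length-tabulate id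

∑-vertex : ∀ (i : Fin n) (f : Fin n → ℕ) → ∑ (vertices n) (λ v → χ (i ≟F v) * f v) ≡ f i
∑-vertex {n} i f = ∑-single (Unique.allFin⁺ n) (∈-allFin i) f

-- Written with the test by which `degree` filters; for edges with distinct ends `inc-proper` turns
-- it into a sum of two indicators.
inc : Edge n → Fin n → ℕ
inc (i , j) v = if ⌊ i ≟F v ⌋ ∨ ⌊ j ≟F v ⌋ then 1 else 0

inc≤1 : ∀ (x : Edge n) v → inc x v ≤ 1
inc≤1 (i , j) v with ⌊ i ≟F v ⌋ ∨ ⌊ j ≟F v ⌋
... | true = s≤s z≤n
... | false = z≤n

Proper : Edge n → Set
Proper (i , j) = i ≢ j

inc-proper : ∀ (x : Edge n) → Proper x → ∀ v → inc x v ≡ χ (proj₁ x ≟F v) + χ (proj₂ x ≟F v)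
inc-proper (i , j) i≢j v with i ≟F v | j ≟F v
... | yes refl | yes refl = ⊥-elim (i≢j refl)
... | yes _ | no _ = refl
... | no _ | yes _ = refl
... | no _ | no _ = refl

∑-inc : ∀ (x : Edge n) → Proper x → (f : Fin n → ℕ) →
  ∑ (vertices n) (λ v → inc x v * f v) ≡ f (proj₁ x) + f (proj₂ x)
∑-inc {n} x p f = begin
  ∑ (vertices n) (λ v → inc x v * f v)
    ≡⟨ ∑-cong (vertices n) (λ v _ → trans (cong (_* f v) (inc-proper x p v)) (*-distribʳ-+ (f v) (χ (proj₁ x ≟F v)) _)) ⟩
  ∑ (vertices n) (λ v → χ (proj₁ x ≟F v) * f v + χ (proj₂ x ≟F v) * f v)
    ≡⟨ ∑-+ (vertices n) _ _ ⟩
  ∑ (vertices n) (λ v → χ (proj₁ x ≟F v) * f v) + ∑ (vertices n) (λ v → χ (proj₂ x ≟F v) * f v)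
    ≡⟨ cong₂ _+_ (∑-vertex (proj₁ x) f) (∑-vertex (proj₂ x) f) ⟩
  f (proj₁ x) + f (proj₂ x) ∎
  where open ≡-Reasoning

degree-∷ : ∀ (x : Edge n) es v → degree (x ∷ es) v ≡ inc x v + degree es v
degree-∷ (i , j) es v with ⌊ i ≟F v ⌋ ∨ ⌊ j ≟F v ⌋
... | true = refl
... | false = refl

degree-∑ : ∀ (es : List (Edge n)) v → degree es v ≡ ∑ es (λ x → inc x v)
degree-∑ [] v = refl
degree-∑ (x ∷ es) v = trans (degree-∷ x es v) (cong (inc x v +_) (degree-∑ es v))

degree-++ : ∀ (h r : List (Edge n)) v → degree (h ++ r) v ≡ degree h v + degree r v
degree-++ h r v = trans (degree-∑ (h ++ r) v)
  (trans (∑-++ h r _) (cong₂ _+_ (sym (degree-∑ h v)) (sym (degree-∑ r v))))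

degree-∷ʳ : ∀ (h : List (Edge n)) x v → degree (h ∷ʳ x) v ≡ degree h v + inc x v
degree-∷ʳ h x v = trans (degree-++ h [ x ] v)
  (cong (degree h v +_) (trans (degree-∷ x [] v) (+-identityʳ _)))

degree-↭ : ∀ {es fs : List (Edge n)} → es ↭ fs → ∀ v → degree es v ≡ degree fs v
degree-↭ {es = es} {fs} p v = trans (degree-∑ es v) (trans (∑-↭ _ p) (sym (degree-∑ fs v)))

∑-degree-weighted : ∀ (es : List (Edge n)) (f : Fin n → ℕ) →
  ∑ es (λ x → ∑ (vertices n) (λ v → inc x v * f v)) ≡ ∑ (vertices n) (λ v → degree es v * f v)
∑-degree-weighted {n} es f = trans (∑-comm es (vertices n) _)
  (∑-cong (vertices n) (λ v _ → trans (∑-*ʳ es (λ x → inc x v) (f v)) (cong (_* f v) (sym (degree-∑ es v)))))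

-- The complete graph

allEdges-proper : ∀ {x : Edge n} → x ∈ allEdges n → Proper x
allEdges-proper {n} x∈ with ∈-filter⁻ _ {xs = cartesianProduct (allFin n) (allFin n)} x∈
... | _ , i<j = Fin.<⇒≢ i<j

allEdges-unique : ∀ n → Unique (allEdges n)
allEdges-unique n = Unique.filter⁺ _ (Unique.cartesianProduct⁺ (Unique.allFin⁺ n) (Unique.allFin⁺ n))

-- Summed over edges, the two products run through both orders of the ends. If `f` and `g` are the
-- indicator of one set, the value is 2 on an edge inside the set and 0 on any other.
symmetric : (f g : Fin n → ℕ) → Edge n → ℕ
symmetric f g (i , j) = f i * g j + f j * g i

-- Ordered pairs split into those with `i < j`, those with `j < i`, which become the former when the
-- names are exchanged, and the diagonal.
∑-allEdges : ∀ (f g : Fin n → ℕ) →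
  ∑ (allEdges n) (symmetric f g) + ∑ (vertices n) (λ v → f v * g v) ≡ ∑ (vertices n) f * ∑ (vertices n) g
∑-allEdges {n} f g = begin
  ∑ (allEdges n) (symmetric f g) + ∑ V (λ v → f v * g v)
    ≡⟨ cong₂ _+_ (trans (∑-filter _ (cartesianProduct V V) _) (∑-cartesianProduct V V _))
                 (∑-cong V (λ v _ → sym (∑-vertex v (λ w → f v * g w)))) ⟩
  ∑ V (λ i → ∑ V (λ j → χ (i <F? j) * (f i * g j + f j * g i))) + ∑ V (λ i → ∑ V (λ j → χ (i ≟F j) * (f i * g j)))
    ≡⟨ cong (_+ diagonal) (trans (∑²-cong (λ i j → *-distribˡ-+ (χ (i <F? j)) (f i * g j) (f j * g i))) (∑²-+ _ _)) ⟩
  (upper + ∑ V (λ i → ∑ V (λ j → χ (i <F? j) * (f j * g i)))) + diagonal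
    ≡⟨ cong (λ s → (upper + s) + diagonal) (∑-comm V V _) ⟩
  (upper + ∑ V (λ i → ∑ V (λ j → χ (j <F? i) * (f i * g j)))) + diagonal
    ≡⟨ cong (_+ diagonal) (∑²-+ _ _) ⟨
  ∑ V (λ i → ∑ V (λ j → χ (i <F? j) * (f i * g j) + χ (j <F? i) * (f i * g j))) + diagonal
    ≡⟨ ∑²-+ _ _ ⟨
  ∑ V (λ i → ∑ V (λ j → (χ (i <F? j) * (f i * g j) + χ (j <F? i) * (f i * g j)) + χ (i ≟F j) * (f i * g j)))
    ≡⟨ ∑²-cong (λ i j → trichotomy i j (f i * g j)) ⟩
  ∑ V (λ i → ∑ V (λ j → f i * g j))
    ≡⟨ ∑-product V V f g ⟩
  ∑ V f * ∑ V g ∎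
  where
  open ≡-Reasoning
  V = vertices n
  upper = ∑ V (λ i → ∑ V (λ j → χ (i <F? j) * (f i * g j)))
  diagonal = ∑ V (λ i → ∑ V (λ j → χ (i ≟F j) * (f i * g j)))
  ∑²-cong : ∀ {a b : Fin n → Fin n → ℕ} → (∀ i j → a i j ≡ b i j) → ∑ V (λ i → ∑ V (a i)) ≡ ∑ V (λ i → ∑ V (b i))
  ∑²-cong eq = ∑-cong V (λ i _ → ∑-cong V (λ j _ → eq i j))
  ∑²-+ : ∀ (a b : Fin n → Fin n → ℕ) →
    ∑ V (λ i → ∑ V (λ j → a i j + b i j)) ≡ ∑ V (λ i → ∑ V (a i)) + ∑ V (λ i → ∑ V (b i))
  ∑²-+ a b = trans (∑-cong V (λ i _ → ∑-+ V (a i) (b i))) (∑-+ V _ _)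
  trichotomy : ∀ (i j : Fin n) t → (χ (i <F? j) * t + χ (j <F? i) * t) + χ (i ≟F j) * t ≡ t
  trichotomy i j t with i <F? j | j <F? i | i ≟F j
  ... | yes i<j | yes j<i | _ = ⊥-elim (Fin.<-asym i<j j<i)
  ... | yes i<j | no _ | yes refl = ⊥-elim (Fin.<-irrefl refl i<j)
  ... | yes i<j | no _ | no _ = trans (+-identityʳ _) (trans (+-identityʳ _) (+-identityʳ _))
  ... | no _ | yes j<i | yes refl = ⊥-elim (Fin.<-irrefl refl j<i)
  ... | no _ | yes j<i | no _ = trans (+-identityʳ _) (+-identityʳ _)
  ... | no _ | no _ | yes _ = +-identityʳ t
  ... | no i≮j | no j≮i | no i≢j with Fin.<-cmp i j
  ...   | tri< i<j _ _ = ⊥-elim (i≮j i<j)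
  ...   | tri≈ _ i≡j _ = ⊥-elim (i≢j i≡j)
  ...   | tri> _ _ j<i = ⊥-elim (j≮i j<i)

∑-vertices-1 : ∀ n → ∑ (vertices n) (λ _ → 1) ≡ n
∑-vertices-1 n = trans (∑-const (vertices n) 1) (trans (*-identityʳ _) (length-vertices n))

-- The case of `∑-allEdges` in which one weight is the indicator of `v` and the other is constantly
-- 1; the diagonal contributes the `suc`.
degree-allEdges : ∀ (v : Fin n) → suc (degree (allEdges n) v) ≡ n
degree-allEdges {n} v = begin
  suc (degree (allEdges n) v)
    ≡⟨ cong suc (trans (degree-∑ (allEdges n) v) (∑-cong (allEdges n) (λ x x∈ → inc-sym x (allEdges-proper x∈)))) ⟩
  1 + ∑ (allEdges n) (symmetric (λ w → χ (v ≟F w)) (λ _ → 1))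
    ≡⟨ +-comm 1 _ ⟩
  ∑ (allEdges n) (symmetric (λ w → χ (v ≟F w)) (λ _ → 1)) + 1
    ≡⟨ cong (∑ (allEdges n) (symmetric (λ w → χ (v ≟F w)) (λ _ → 1)) +_) (sym (∑-vertex v (λ _ → 1))) ⟩
  ∑ (allEdges n) (symmetric (λ w → χ (v ≟F w)) (λ _ → 1)) + ∑ (vertices n) (λ w → χ (v ≟F w) * 1)
    ≡⟨ ∑-allEdges (λ w → χ (v ≟F w)) (λ _ → 1) ⟩
  ∑ (vertices n) (λ w → χ (v ≟F w)) * ∑ (vertices n) (λ _ → 1)
    ≡⟨ cong₂ _*_ (trans (∑-cong (vertices n) (λ w _ → sym (*-identityʳ _))) (∑-vertex v (λ _ → 1))) (∑-vertices-1 n) ⟩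
  1 * n
    ≡⟨ *-identityˡ n ⟩
  n ∎
  where
  open ≡-Reasoning
  χ-sym : ∀ (a b : Fin n) → χ (a ≟F b) ≡ χ (b ≟F a)
  χ-sym a b with a ≟F b | b ≟F a
  ... | yes _ | yes _ = refl
  ... | no _ | no _ = refl
  ... | yes p | no ¬p = ⊥-elim (¬p (sym p))
  ... | no ¬p | yes p = ⊥-elim (¬p (sym p))
  inc-sym : ∀ x → Proper x → inc x v ≡ symmetric (λ w → χ (v ≟F w)) (λ _ → 1) x
  inc-sym (i , j) p = trans (inc-proper (i , j) p v)
    (cong₂ _+_ (trans (χ-sym i v) (sym (*-identityʳ _))) (trans (χ-sym j v) (sym (*-identityʳ _))))

length-allEdges : ∀ n → 2 * length (allEdges n) + n ≡ n * n
length-allEdges n = begin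
  2 * length (allEdges n) + n
    ≡⟨ cong₂ _+_ (trans (*-comm 2 (length (allEdges n))) (sym (∑-const (allEdges n) 2))) (sym (∑-vertices-1 n)) ⟩
  ∑ (allEdges n) (symmetric (λ _ → 1) (λ _ → 1)) + ∑ (vertices n) (λ _ → 1)
    ≡⟨ ∑-allEdges {n} (λ _ → 1) (λ _ → 1) ⟩
  ∑ (vertices n) (λ _ → 1) * ∑ (vertices n) (λ _ → 1)
    ≡⟨ cong₂ _*_ (∑-vertices-1 n) (∑-vertices-1 n) ⟩
  n * n ∎
  where open ≡-Reasoning

-- `h` is the history, `r` the list of unseen edges. As arguments of a record type both can be
-- inferred, which a bare permutation of `h ++ r` would not allow.
record Splits {n} (h r : List (Edge n)) : Set where
  constructor splits
  field
    h++r : h ++ r ↭ allEdges n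

module _ {h r : List (Edge n)} (s : Splits h r) where
  open Splits s

  splits-proper : ∀ {x} → x ∈ h ++ r → Proper x
  splits-proper x∈ = allEdges-proper (∈-resp-↭ h++r x∈)

  splits-degree : ∀ v → suc (degree h v + degree r v) ≡ n
  splits-degree v = trans (cong suc (trans (sym (degree-++ h r v)) (degree-↭ h++r v))) (degree-allEdges v)

  splits-degree-pred : ∀ v → degree h v + degree r v ≡ n ∸ 1
  splits-degree-pred v = cong (_∸ 1) (splits-degree v)

  splits-degree≤ : ∀ v → degree r v ≤ n ∸ 1
  splits-degree≤ v = subst (degree r v ≤_) (splits-degree-pred v) (m≤n+m _ (degree h v))

  splits-length : length h + length r ≡ length (allEdges n)
  splits-length = trans (sym (length-++ h)) (↭-length h++r)

  splits-∑ : ∀ (f g : Fin n → ℕ) →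
    ∑ h (symmetric f g) + ∑ r (symmetric f g) + ∑ (vertices n) (λ v → f v * g v) ≡ ∑ (vertices n) f * ∑ (vertices n) g
  splits-∑ f g = trans (cong (_+ ∑ (vertices n) (λ v → f v * g v)) (trans (sym (∑-++ h r _)) (∑-↭ _ h++r))) (∑-allEdges f g)

  splits-∑≤ : ∀ (f g : Fin n → ℕ) → ∑ r (symmetric f g) ≤ ∑ (vertices n) f * ∑ (vertices n) g
  splits-∑≤ f g = subst (∑ r (symmetric f g) ≤_) (splits-∑ f g)
    (≤-trans (m≤n+m _ (∑ h (symmetric f g))) (m≤m+n _ _))

orders : (n : ℕ) → List (List (Edge n))
orders n = perms (allEdges n)

∑-inc≤ : ∀ (x : Edge n) → Proper x → (f : Fin n → ℕ) (b : ℕ) → (∀ v → f v ≤ b) →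
  ∑ (vertices n) (λ v → inc x v * f v) ≤ 2 * b
∑-inc≤ x p f b f≤b = ≤-trans (≤-reflexive (∑-inc x p f))
  (subst (f (proj₁ x) + f (proj₂ x) ≤_) (cong (b +_) (sym (+-identityʳ b))) (+-mono-≤ (f≤b _) (f≤b _)))

∑-vertices≤ : ∀ (f : Fin n → ℕ) (b : ℕ) → (∀ v → f v ≤ b) → ∑ (vertices n) f ≤ n * b
∑-vertices≤ {n} f b f≤b = subst (λ l → ∑ (vertices n) f ≤ l * b) (length-vertices n)
  (∑-≤-const (vertices n) b (λ v _ → f≤b v))

-- Isolated vertices

isolated : List (Edge n) → Fin n → ℕ
isolated h v = χ (degree h v ≟ 0)

isolated≤1 : ∀ (h : List (Edge n)) v → isolated h v ≤ 1
isolated≤1 h v = χ≤1 (degree h v ≟ 0)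

#isolated : List (Edge n) → ℕ
#isolated {n} h = ∑ (vertices n) (isolated h)

#isolatedEnds : List (Edge n) → Edge n → ℕ
#isolatedEnds {n} h x = ∑ (vertices n) (λ v → inc x v * isolated h v)

#isolated≤ : ∀ (h : List (Edge n)) → #isolated h ≤ n
#isolated≤ {n} h = subst (#isolated h ≤_) (*-identityʳ n) (∑-vertices≤ (isolated h) 1 (λ v → χ≤1 _))

#isolated-[] : #isolated {n} [] ≡ n
#isolated-[] {n} = ∑-vertices-1 n

isolated-∷ʳ : ∀ (h : List (Edge n)) x v → isolated (h ∷ʳ x) v + inc x v * isolated h v ≡ isolated h v
isolated-∷ʳ h x v rewrite degree-∷ʳ h x v = lemma (degree h v) (inc x v) (inc≤1 x v)
  where
  lemma : ∀ d c → c ≤ 1 → χ (d + c ≟ 0) + c * χ (d ≟ 0) ≡ χ (d ≟ 0)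
  lemma zero zero _ = refl
  lemma zero (suc zero) _ = refl
  lemma (suc d) c _ = *-zeroʳ c
  lemma zero (suc (suc c)) (s≤s ())

#isolated-∷ʳ : ∀ (h : List (Edge n)) x → #isolated (h ∷ʳ x) + #isolatedEnds h x ≡ #isolated h
#isolated-∷ʳ {n} h x = trans (sym (∑-+ (vertices n) _ _)) (∑-cong (vertices n) (λ v _ → isolated-∷ʳ h x v))

-- All `n ∸ 1` edges at an isolated vertex are still unseen.
∑-isolatedEnds : ∀ {h r : List (Edge n)} → Splits h r → ∑ r (#isolatedEnds h) ≡ #isolated h * (n ∸ 1)
∑-isolatedEnds {n} {h} {r} s = trans (∑-degree-weighted r (isolated h))
  (trans (∑-cong (vertices n) (λ v _ → pointwise v)) (∑-*ʳ (vertices n) (isolated h) (n ∸ 1)))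
  where
  pointwise : ∀ v → degree r v * isolated h v ≡ isolated h v * (n ∸ 1)
  pointwise v with degree h v ≟ 0
  ... | yes d≡0 = trans (*-identityʳ _)
    (trans (trans (cong (_+ degree r v) (sym d≡0)) (splits-degree-pred s v)) (sym (+-identityʳ _)))
  ... | no _ = *-zeroʳ (degree r v)

-- An integral substitute for the potential 1 / (#isolated + 1).
scaledInverse : ℕ → ℕ → ℕ
scaledInverse n i = suc n ! / suc i

-- `suc i` divides `suc n !` for `i ≤ n`, so the rounded division is exact.
scaledInverse-* : ∀ n i → i ≤ n → suc i * scaledInverse n i ≡ suc n !
scaledInverse-* n i i≤n = m*[n/m]≡n (∣-trans (m∣m*n (i !)) (m≤n⇒m!∣n! (s≤s i≤n)))

-- An edge removes `c ≤ 2` isolated vertices. The growth of the potential is bounded linearly in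
-- `c`, so that in the sum over the next edge only the mean of `c` enters; multiplied out, this is a
-- polynomial inequality checked for each `c`.
scaledInverse-step : ∀ n i c → c ≤ 2 → c + i ≤ n →
  (c + i) * scaledInverse n i ≤ ((c + i) + 2 * c) * scaledInverse n (c + i)
scaledInverse-step n i c c≤2 ci≤n = *-cancelˡ-≤ (suc i) (begin
  suc i * ((c + i) * u) ≡⟨ *-left-comm (suc i) (c + i) u ⟩
  (c + i) * (suc i * u) ≡⟨ cong ((c + i) *_) (trans (scaledInverse-* n i (≤-trans (m≤n+m i c) ci≤n)) (sym (scaledInverse-* n (c + i) ci≤n))) ⟩
  (c + i) * (suc (c + i) * w) ≡⟨ *-assoc (c + i) (suc (c + i)) w ⟨
  (c + i) * suc (c + i) * w ≤⟨ *-monoˡ-≤ w (coefficients c c≤2) ⟩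
  suc i * ((c + i) + 2 * c) * w ≡⟨ *-assoc (suc i) ((c + i) + 2 * c) w ⟩
  suc i * (((c + i) + 2 * c) * w) ∎)
  where
  open ≤-Reasoning
  u = scaledInverse n i
  w = scaledInverse n (c + i)
  coefficients : ∀ c → c ≤ 2 → (c + i) * suc (c + i) ≤ suc i * ((c + i) + 2 * c)
  coefficients 0 _ = ≤-reflexive (lemma i)
    where
    lemma : ∀ i → i * suc i ≡ suc i * (i + 0)
    lemma = solve-∀
  coefficients 1 _ = subst₂ _≤_ refl (lemma i) (m≤m+n _ (suc i))
    where
    lemma : ∀ i → suc i * suc (suc i) + suc i ≡ suc i * (suc i + 2)
    lemma = solve-∀
  coefficients 2 _ = subst₂ _≤_ refl (lemma i) (m≤m+n _ (2 * i))
    where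
    lemma : ∀ i → suc (suc i) * suc (suc (suc i)) + 2 * i ≡ suc i * (suc (suc i) + 4)
    lemma = solve-∀
  coefficients (suc (suc (suc _))) (s≤s (s≤s ()))

scaledInverse-drift : ∀ {h r : List (Edge n)} → Splits h r →
  ∑ r (λ x → scaledInverse n (#isolated (h ∷ʳ x))) ≤ (length r + 2 * (n ∸ 1)) * scaledInverse n (#isolated h)
scaledInverse-drift {n} {h} {r} s with #isolated h in eq
-- Without isolated vertices the potential keeps its maximal value; the other case divides by their
-- number.
... | zero = begin
  ∑ r (λ x → scaledInverse n (#isolated (h ∷ʳ x)))
    ≡⟨ ∑-cong r (λ x _ → cong (scaledInverse n) (m+n≡0⇒m≡0 _ (trans (#isolated-∷ʳ h x) eq))) ⟩
  ∑ r (λ _ → scaledInverse n 0) ≡⟨ ∑-const r _ ⟩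
  length r * scaledInverse n 0 ≤⟨ *-monoˡ-≤ _ (m≤m+n (length r) _) ⟩
  (length r + 2 * (n ∸ 1)) * scaledInverse n 0 ∎
  where open ≤-Reasoning
... | suc i = *-cancelˡ-≤ (suc i) (begin
  suc i * ∑ r (λ x → scaledInverse n (#isolated (h ∷ʳ x))) ≡⟨ ∑-*ˡ r (suc i) _ ⟨
  ∑ r (λ x → suc i * scaledInverse n (#isolated (h ∷ʳ x))) ≤⟨ ∑-mono r pointwise ⟩
  ∑ r (λ x → (suc i + 2 * #isolatedEnds h x) * w) ≡⟨ ∑-*ʳ r _ w ⟩
  ∑ r (λ x → suc i + 2 * #isolatedEnds h x) * w
    ≡⟨ cong (_* w) (trans (∑-+ r _ _) (cong₂ _+_ (∑-const r (suc i))
        (trans (∑-*ˡ r 2 (#isolatedEnds h)) (cong (2 *_) (trans (∑-isolatedEnds s) (cong (_* (n ∸ 1)) eq)))))) ⟩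
  (length r * suc i + 2 * (suc i * (n ∸ 1))) * w ≡⟨ factor (length r) (suc i) (n ∸ 1) w ⟩
  suc i * ((length r + 2 * (n ∸ 1)) * w) ∎)
  where
  open ≤-Reasoning
  w = scaledInverse n (suc i)
  factor : ∀ l i m w → (l * i + 2 * (i * m)) * w ≡ i * ((l + 2 * m) * w)
  factor = solve-∀
  pointwise : ∀ x → x ∈ r → suc i * scaledInverse n (#isolated (h ∷ʳ x)) ≤ (suc i + 2 * #isolatedEnds h x) * w
  pointwise x x∈ = subst
    (λ a → a * scaledInverse n (#isolated (h ∷ʳ x)) ≤ (a + 2 * #isolatedEnds h x) * scaledInverse n a)
    (trans (+-comm (#isolatedEnds h x) _) (trans (#isolated-∷ʳ h x) eq))
    (scaledInverse-step n _ (#isolatedEnds h x)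
      (∑-inc≤ x (splits-proper s (∈-++⁺ʳ h x∈)) (isolated h) 1 (λ v → χ≤1 _))
      (subst (_≤ n) (sym (trans (+-comm (#isolatedEnds h x) _) (#isolated-∷ʳ h x))) (#isolated≤ h)))

-- Normalised, the potential starts at 1 / (n + 1) and is 1 once no vertex is isolated. While at
-- least 2 q (n - 1) edges are unseen, its mean grows by a factor of at most 1 + 1 / q per edge.
-- Markov's inequality bounds the probability by (1 + 1 / q)^m / (n + 1).
no-isolated-rare : ∀ n q m → 2 * q * (n ∸ 1) + m ≤ length (allEdges n) →
  suc n * (q ^ m * ∑ (orders n) (λ π → χ (#isolated (take m π) ≟ 0))) ≤ suc q ^ m * totalOrders n
no-isolated-rare n q m bound = *-cancelˡ-≤ (suc n !) {{suc n !≢0}} (begin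
  suc n ! * (suc n * (q ^ m * S)) ≡⟨ reorder (suc n !) (suc n) (q ^ m) S ⟩
  suc n * (q ^ m * (suc n ! * S)) ≡⟨ cong (λ z → suc n * (q ^ m * z)) (∑-*ˡ (orders n) (suc n !) _) ⟨
  suc n * (q ^ m * ∑ (orders n) (λ π → suc n ! * χ (#isolated (take m π) ≟ 0)))
    ≤⟨ *-monoʳ-≤ (suc n) (*-monoʳ-≤ (q ^ m) (∑-mono (orders n) (λ π _ → pointwise (take m π)))) ⟩
  suc n * (q ^ m * ∑ (orders n) (λ π → scaledInverse n (#isolated (take m π))))
    ≤⟨ *-monoʳ-≤ (suc n) (multiplicative-drift (allEdges-unique n) (λ h → scaledInverse n (#isolated h)) (suc q) q m
         (m+n≤o⇒n≤o (2 * q * (n ∸ 1)) bound) drift) ⟩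
  suc n * (suc q ^ m * (totalOrders n * scaledInverse n (#isolated {n} [])))
    ≡⟨ cong (λ i → suc n * (suc q ^ m * (totalOrders n * scaledInverse n i))) (#isolated-[] {n}) ⟩
  suc n * (suc q ^ m * (totalOrders n * scaledInverse n n))
    ≡⟨ reorder′ (suc n) (suc q ^ m) (totalOrders n) _ ⟩
  suc n * scaledInverse n n * (suc q ^ m * totalOrders n)
    ≡⟨ cong (_* (suc q ^ m * totalOrders n)) (scaledInverse-* n n ≤-refl) ⟩
  suc n ! * (suc q ^ m * totalOrders n) ∎)
  where
  open ≤-Reasoning
  S = ∑ (orders n) (λ π → χ (#isolated (take m π) ≟ 0))
  reorder : ∀ a b c d → a * (b * (c * d)) ≡ b * (c * (a * d))
  reorder = solve-∀
  reorder′ : ∀ a b c d → a * (b * (c * d)) ≡ a * d * (b * c)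
  reorder′ = solve-∀
  pointwise : ∀ h → suc n ! * χ (#isolated h ≟ 0) ≤ scaledInverse n (#isolated h)
  pointwise h with #isolated h ≟ 0
  ... | yes p = ≤-reflexive (trans (*-identityʳ (suc n !)) (trans (sym (scaledInverse-* n 0 z≤n))
                  (trans (*-identityˡ _) (cong (scaledInverse n) (sym p)))))
  ... | no _ = ≤-trans (≤-reflexive (*-zeroʳ (suc n !))) z≤n
  drift : ∀ h r → length h < m → h ++ r ↭ allEdges n →
    q * ∑ r (λ x → scaledInverse n (#isolated (h ∷ʳ x))) ≤ length r * (suc q * scaledInverse n (#isolated h))
  drift h r h< p = begin
    q * ∑ r (λ x → scaledInverse n (#isolated (h ∷ʳ x))) ≤⟨ *-monoʳ-≤ q (scaledInverse-drift s) ⟩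
    q * ((length r + 2 * (n ∸ 1)) * w) ≡⟨ expand q (length r) (n ∸ 1) w ⟩
    (q * length r + 2 * q * (n ∸ 1)) * w ≤⟨ *-monoˡ-≤ w (+-monoʳ-≤ (q * length r) remaining) ⟩
    (q * length r + length r) * w ≡⟨ collect q (length r) w ⟩
    length r * (suc q * w) ∎
    where
    s : Splits h r
    s = splits p
    w = scaledInverse n (#isolated h)
    expand : ∀ q l m w → q * ((l + 2 * m) * w) ≡ (q * l + 2 * q * m) * w
    expand = solve-∀
    collect : ∀ q l w → (q * l + l) * w ≡ l * (suc q * w)
    collect = solve-∀
    remaining : 2 * q * (n ∸ 1) ≤ length r
    remaining = +-cancelˡ-≤ m _ _ (≤-trans (≤-reflexive (+-comm m _)) (≤-trans bound
      (≤-trans (≤-reflexive (sym (splits-length s))) (+-monoˡ-≤ (length r) (<⇒≤ h<)))))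

-- Vertices of degree below k

low : ℕ → List (Edge n) → Fin n → ℕ
low k h v = χ (degree h v <? k)

low≤1 : ∀ k (h : List (Edge n)) v → low k h v ≤ 1
low≤1 k h v = χ≤1 (degree h v <? k)

#low : ℕ → List (Edge n) → ℕ
#low {n} k h = ∑ (vertices n) (low k h)

-- Each edge at a vertex at least halves its weight, whatever the degree, so one multiplicative
-- drift serves all degrees below `k`.
lowWeight : ℕ → ℕ → ℕ
lowWeight k d = χ (d <? k) * 2 ^ (k ∸ d)

lowWeight-suc : ∀ k d → 2 * lowWeight k (suc d) ≤ lowWeight k d
lowWeight-suc k d with suc d <? k | d <? k
... | no _ | _ = z≤n
... | yes p | no q = ⊥-elim (q (<⇒≤ p))
... | yes p | yes q = ≤-reflexive (begin
  2 * (2 ^ (k ∸ suc d) + 0) ≡⟨ cong (2 *_) (+-identityʳ (2 ^ (k ∸ suc d))) ⟩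
  2 ^ suc (k ∸ suc d) ≡⟨ cong (2 ^_) (sym (+-∸-assoc 1 q)) ⟩
  2 ^ (k ∸ d) ≡⟨ +-identityʳ _ ⟨
  2 ^ (k ∸ d) + 0 ∎)
  where open ≡-Reasoning

lowWeight-step : ∀ k d c → c ≤ 1 → 2 * lowWeight k (d + c) + c * lowWeight k d ≤ 2 * lowWeight k d
lowWeight-step k d zero _ = ≤-reflexive (trans (+-identityʳ _) (cong (λ e → 2 * lowWeight k e) (+-identityʳ d)))
lowWeight-step k d (suc zero) _ = +-mono-≤
  (≤-trans (≤-reflexive (cong (λ e → 2 * lowWeight k e) (+-comm d 1))) (lowWeight-suc k d)) ≤-refl
lowWeight-step k d (suc (suc c)) (s≤s ())

#lowWeight : ℕ → List (Edge n) → ℕ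
#lowWeight {n} k h = ∑ (vertices n) (λ v → lowWeight k (degree h v))

-- A vertex of degree below `k` has at least `n ∸ k` unseen edges, and each of them would take at
-- least half of its weight.
lowWeight-drift : ∀ k {h r : List (Edge n)} → Splits h r →
  2 * ∑ r (λ x → #lowWeight k (h ∷ʳ x)) + (n ∸ k) * #lowWeight k h ≤ 2 * length r * #lowWeight k h
lowWeight-drift {n} k {h} {r} s = begin
  2 * ∑ r (λ x → #lowWeight k (h ∷ʳ x)) + (n ∸ k) * #lowWeight k h
    ≡⟨ cong₂ _+_ (cong (2 *_) (∑-comm r V _)) (sym (∑-*ˡ V (n ∸ k) _)) ⟩
  2 * ∑ V (λ v → ∑ r (λ x → lowWeight k (degree (h ∷ʳ x) v))) + ∑ V (λ v → (n ∸ k) * lowWeight k (degree h v))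
    ≡⟨ cong (_+ _) (∑-*ˡ V 2 _) ⟨
  ∑ V (λ v → 2 * ∑ r (λ x → lowWeight k (degree (h ∷ʳ x) v))) + ∑ V (λ v → (n ∸ k) * lowWeight k (degree h v))
    ≡⟨ ∑-+ V _ _ ⟨
  ∑ V (λ v → 2 * ∑ r (λ x → lowWeight k (degree (h ∷ʳ x) v)) + (n ∸ k) * lowWeight k (degree h v))
    ≤⟨ ∑-mono V (λ v _ → pointwise v) ⟩
  ∑ V (λ v → 2 * length r * lowWeight k (degree h v))
    ≡⟨ ∑-*ˡ V (2 * length r) _ ⟩
  2 * length r * #lowWeight k h ∎
  where
  open ≤-Reasoning
  V = vertices n
  remaining : ∀ v → (n ∸ k) * lowWeight k (degree h v) ≤ degree r v * lowWeight k (degree h v)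
  remaining v with degree h v <? k
  ... | no _ = ≤-reflexive (trans (*-zeroʳ (n ∸ k)) (sym (*-zeroʳ (degree r v))))
  ... | yes d<k = *-monoˡ-≤ (1 * 2 ^ (k ∸ degree h v)) (m≤n+o⇒m∸n≤o n k (begin
    n ≡⟨ splits-degree s v ⟨
    suc (degree h v) + degree r v ≤⟨ +-monoˡ-≤ (degree r v) d<k ⟩
    k + degree r v ∎))
  pointwise : ∀ v → 2 * ∑ r (λ x → lowWeight k (degree (h ∷ʳ x) v)) + (n ∸ k) * lowWeight k (degree h v)
    ≤ 2 * length r * lowWeight k (degree h v)
  pointwise v = begin
    2 * ∑ r (λ x → lowWeight k (degree (h ∷ʳ x) v)) + (n ∸ k) * g
      ≤⟨ +-monoʳ-≤ _ (remaining v) ⟩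
    2 * ∑ r (λ x → lowWeight k (degree (h ∷ʳ x) v)) + degree r v * g
      ≡⟨ cong₂ _+_ (sym (∑-*ˡ r 2 _)) (trans (cong (_* g) (degree-∑ r v)) (sym (∑-*ʳ r _ g))) ⟩
    ∑ r (λ x → 2 * lowWeight k (degree (h ∷ʳ x) v)) + ∑ r (λ x → inc x v * g)
      ≡⟨ ∑-+ r _ _ ⟨
    ∑ r (λ x → 2 * lowWeight k (degree (h ∷ʳ x) v) + inc x v * g)
      ≤⟨ ∑-≤-const r (2 * g) (λ x _ → subst (λ d → 2 * lowWeight k d + inc x v * g ≤ 2 * g)
           (sym (degree-∷ʳ h x v)) (lowWeight-step k (degree h v) (inc x v) (inc≤1 x v))) ⟩
    length r * (2 * g) ≡⟨ reorder (length r) g ⟩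
    2 * length r * g ∎
    where
    g = lowWeight k (degree h v)
    reorder : ∀ l g → l * (2 * g) ≡ 2 * l * g
    reorder = solve-∀

-- At most `n * (n ∸ k)` edges are unseen, so each edge multiplies the mean total weight by at most
-- 1 - 1 / (2 n) = y / (2 n). The total is at most n 2^k at the start and at least 1 while some
-- vertex is low.
low-degree-rare : ∀ n k m y → suc y ≡ 2 * n → length (allEdges n) ≤ n * (n ∸ k) → m ≤ length (allEdges n) →
  (2 * n) ^ m * ∑ (orders n) (λ π → χ (1 ≤? #low k (take m π))) ≤ y ^ m * (totalOrders n * (n * 2 ^ k))
low-degree-rare n k m y y≡ N≤ m≤N = begin
  (2 * n) ^ m * ∑ (orders n) (λ π → χ (1 ≤? #low k (take m π)))
    ≤⟨ *-monoʳ-≤ ((2 * n) ^ m) (∑-mono (orders n) (λ π _ → pointwise (take m π))) ⟩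
  (2 * n) ^ m * ∑ (orders n) (λ π → #lowWeight k (take m π))
    ≤⟨ multiplicative-drift (allEdges-unique n) (#lowWeight k) y (2 * n) m m≤N drift ⟩
  y ^ m * (totalOrders n * #lowWeight {n} k [])
    ≤⟨ *-monoʳ-≤ (y ^ m) (*-monoʳ-≤ (totalOrders n) (∑-vertices≤ {n} (λ _ → lowWeight k 0) (2 ^ k) (λ v → initial))) ⟩
  y ^ m * (totalOrders n * (n * 2 ^ k)) ∎
  where
  open ≤-Reasoning
  initial : lowWeight k 0 ≤ 2 ^ k
  initial = subst (lowWeight k 0 ≤_) (*-identityˡ (2 ^ k)) (*-monoˡ-≤ (2 ^ k) (χ≤1 (0 <? k)))
  low≤weight : ∀ d → χ (d <? k) ≤ lowWeight k d
  low≤weight d = subst (_≤ lowWeight k d) (*-identityʳ _) (*-monoʳ-≤ (χ (d <? k)) (m^n>0 2 (k ∸ d)))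
  pointwise : ∀ h → χ (1 ≤? #low k h) ≤ #lowWeight k h
  pointwise h = ≤-trans (χ≤id (#low k h)) (∑-mono (vertices n) (λ v _ → low≤weight (degree h v)))
    where
    χ≤id : ∀ a → χ (1 ≤? a) ≤ a
    χ≤id zero = z≤n
    χ≤id (suc a) = ≤-trans (χ≤1 (1 ≤? suc a)) (s≤s z≤n)
  drift : ∀ h r → length h < m → h ++ r ↭ allEdges n → 2 * n * ∑ r (λ x → #lowWeight k (h ∷ʳ x)) ≤ length r * (y * #lowWeight k h)
  drift h r _ p = +-cancelʳ-≤ (length r * V) _ _ (begin
    2 * n * S + length r * V ≤⟨ +-monoʳ-≤ (2 * n * S) (*-monoˡ-≤ V (≤-trans (m≤n+m (length r) (length h))
                                              (≤-trans (≤-reflexive (splits-length s)) N≤))) ⟩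
    2 * n * S + n * (n ∸ k) * V ≡⟨ factor n S (n ∸ k) V ⟩
    n * (2 * S + (n ∸ k) * V) ≤⟨ *-monoʳ-≤ n (lowWeight-drift k s) ⟩
    n * (2 * length r * V) ≡⟨ regroup n (length r) V ⟩
    length r * (2 * n * V) ≡⟨ cong (λ t → length r * (t * V)) y≡ ⟨
    length r * (suc y * V) ≡⟨ expand (length r) y V ⟩
    length r * (y * V) + length r * V ∎)
    where
    s : Splits h r
    s = splits p
    S = ∑ r (λ x → #lowWeight k (h ∷ʳ x))
    V = #lowWeight k h
    factor : ∀ n s d v → 2 * n * s + n * d * v ≡ n * (2 * s + d * v)
    factor = solve-∀
    regroup : ∀ n l v → n * (2 * l * v) ≡ l * (2 * n * v)
    regroup = solve-∀
    expand : ∀ l y v → l * (suc y * v) ≡ l * (y * v) + l * v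
    expand = solve-∀

-- Squares of bounded supermartingale increments

-- For the excesses y and z of `x` and `x′` over `a` this says z^2 - y^2 <= c^2 + 2 y (x′ - x), with
-- negative terms moved across. For `x′` above `a` it expands the square; below `a` it reduces to 2
-- y d <= y^2 + d^2 where d = x - x′ <= c.
square-step : ∀ a x x′ c → a ≤ x → x′ ≤ x + c → x ≤ x′ + c →
  (x′ ∸ a) * (x′ ∸ a) + 2 * (x ∸ a) * x ≤ ((x ∸ a) * (x ∸ a) + c * c) + 2 * (x ∸ a) * x′
square-step a x x′ c a≤x up down with ≤-total a x′
square-step a x x′ c a≤x up down | inj₁ a≤x′ =
  subst₂ (λ u u′ → z * z + 2 * y * u ≤ (y * y + c * c) + 2 * y * u′) (m+[n∸m]≡n a≤x) (m+[n∸m]≡n a≤x′) (shifted (≤-total z y))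
  where
  open ≤-Reasoning
  y = x ∸ a
  z = x′ ∸ a
  z≤y+c : z ≤ y + c
  z≤y+c = +-cancelˡ-≤ a _ _ (subst₂ _≤_ (sym (m+[n∸m]≡n a≤x′)) (trans (cong (_+ c) (sym (m+[n∸m]≡n a≤x))) (+-assoc a y c)) up)
  y≤z+c : y ≤ z + c
  y≤z+c = +-cancelˡ-≤ a _ _ (subst₂ _≤_ (sym (m+[n∸m]≡n a≤x)) (trans (cong (_+ c) (sym (m+[n∸m]≡n a≤x′))) (+-assoc a z c)) down)
  shifted : z ≤ y ⊎ y ≤ z → z * z + 2 * y * (a + y) ≤ (y * y + c * c) + 2 * y * (a + z)
  shifted (inj₁ z≤y) = subst (λ y → z * z + 2 * y * (a + y) ≤ (y * y + c * c) + 2 * y * (a + z)) (m+[n∸m]≡n z≤y) (begin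
    z * z + 2 * (z + t) * (a + (z + t)) ≡⟨ expand z t a ⟩
    ((z + t) * (z + t) + t * t) + 2 * (z + t) * (a + z) ≤⟨ +-monoˡ-≤ _ (+-monoʳ-≤ ((z + t) * (z + t)) (*-mono-≤ t≤c t≤c)) ⟩
    ((z + t) * (z + t) + c * c) + 2 * (z + t) * (a + z) ∎)
    where
    t = y ∸ z
    t≤c : t ≤ c
    t≤c = m≤n+o⇒m∸n≤o y z y≤z+c
    expand : ∀ z t a → z * z + 2 * (z + t) * (a + (z + t)) ≡ ((z + t) * (z + t) + t * t) + 2 * (z + t) * (a + z)
    expand = solve-∀
  shifted (inj₂ y≤z) = subst (λ z → z * z + 2 * y * (a + y) ≤ (y * y + c * c) + 2 * y * (a + z)) (m+[n∸m]≡n y≤z) (begin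
    (y + t) * (y + t) + 2 * y * (a + y) ≡⟨ expand y t a ⟩
    (y * y + t * t) + 2 * y * (a + (y + t)) ≤⟨ +-monoˡ-≤ _ (+-monoʳ-≤ (y * y) (*-mono-≤ t≤c t≤c)) ⟩
    (y * y + c * c) + 2 * y * (a + (y + t)) ∎)
    where
    t = z ∸ y
    t≤c : t ≤ c
    t≤c = m≤n+o⇒m∸n≤o z y z≤y+c
    expand : ∀ y t a → (y + t) * (y + t) + 2 * y * (a + y) ≡ (y * y + t * t) + 2 * y * (a + (y + t))
    expand = solve-∀
square-step a x x′ c a≤x up down | inj₂ x′≤a rewrite m≤n⇒m∸n≡0 x′≤a = begin
  2 * y * x ≡⟨ cong (2 * y *_) x≡ ⟩
  2 * y * (x′ + (s + y)) ≤⟨ m≤m+n _ (s * s) ⟩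
  2 * y * (x′ + (s + y)) + s * s ≡⟨ expand x′ s y ⟩
  (y * y + (s + y) * (s + y)) + 2 * y * x′ ≤⟨ +-monoˡ-≤ (2 * y * x′) (+-monoʳ-≤ (y * y) (*-mono-≤ s+y≤c s+y≤c)) ⟩
  (y * y + c * c) + 2 * y * x′ ∎
  where
  open ≤-Reasoning
  y = x ∸ a
  s = a ∸ x′
  x≡ : x ≡ x′ + (s + y)
  x≡ = sym (trans (sym (+-assoc x′ s y)) (trans (cong (_+ y) (m+[n∸m]≡n x′≤a)) (m+[n∸m]≡n a≤x)))
  s+y≤c : s + y ≤ c
  s+y≤c = +-cancelˡ-≤ x′ _ _ (subst (_≤ x′ + c) x≡ down)
  expand : ∀ x s y → 2 * y * (x + (s + y)) + s * s ≡ (y * y + (s + y) * (s + y)) + 2 * y * x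
  expand = solve-∀

-- The linear term of `square-step` has mean at most 0 by the supermartingale hypothesis. Only the
-- excess over `a` is squared, because a downward drift below `a` would enlarge the full square.
square-drift : ∀ (r : List A) (X′ : A → ℕ) (a X c : ℕ) →
  (∀ x → x ∈ r → X′ x ≤ X + c) → (∀ x → x ∈ r → X ≤ X′ x + c) → ∑ r X′ ≤ length r * X →
  ∑ r (λ x → (X′ x ∸ a) * (X′ x ∸ a)) ≤ length r * ((X ∸ a) * (X ∸ a) + c * c)
square-drift r X′ a X c up down mean with ≤-total a X
... | inj₂ X≤a = ∑-≤-const r _ (λ x x∈ →
      let d≤c = m≤n+o⇒m∸n≤o (X′ x) a (≤-trans (up x x∈) (+-monoˡ-≤ c X≤a)) in
      ≤-trans (*-mono-≤ d≤c d≤c) (m≤n+m (c * c) ((X ∸ a) * (X ∸ a))))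
... | inj₁ a≤X = +-cancelʳ-≤ (length r * (2 * y * X)) _ _ (begin
  ∑ r (λ x → (X′ x ∸ a) * (X′ x ∸ a)) + length r * (2 * y * X)
    ≡⟨ cong (∑ r (λ x → (X′ x ∸ a) * (X′ x ∸ a)) +_) (∑-const r (2 * y * X)) ⟨
  ∑ r (λ x → (X′ x ∸ a) * (X′ x ∸ a)) + ∑ r (λ _ → 2 * y * X)
    ≡⟨ ∑-+ r _ _ ⟨
  ∑ r (λ x → (X′ x ∸ a) * (X′ x ∸ a) + 2 * y * X)
    ≤⟨ ∑-mono r (λ x x∈ → square-step a X (X′ x) c a≤X (up x x∈) (down x x∈)) ⟩
  ∑ r (λ x → (y * y + c * c) + 2 * y * X′ x)
    ≡⟨ ∑-+ r _ _ ⟩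
  ∑ r (λ _ → y * y + c * c) + ∑ r (λ x → 2 * y * X′ x)
    ≡⟨ cong₂ _+_ (∑-const r (y * y + c * c)) (∑-*ˡ r (2 * y) X′) ⟩
  length r * (y * y + c * c) + 2 * y * ∑ r X′
    ≤⟨ +-monoʳ-≤ (length r * (y * y + c * c)) (*-monoʳ-≤ (2 * y) mean) ⟩
  length r * (y * y + c * c) + 2 * y * (length r * X)
    ≡⟨ cong (length r * (y * y + c * c) +_) (*-left-comm (2 * y) (length r) X) ⟩
  length r * (y * y + c * c) + length r * (2 * y * X) ∎)
  where
  open ≤-Reasoning
  y = X ∸ a

-- First edges that arrive at a saturated vertex

full : ℕ → List (Edge n) → Fin n → ℕ
full k h v = χ (k ≤? degree h v)

full≤1 : ∀ k (h : List (Edge n)) v → full k h v ≤ 1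
full≤1 k h v = χ≤1 (k ≤? degree h v)

-- Fullness is judged by the seen edges, not the bought ones. Then waste does not depend on
-- Builder's choices, and it still covers every first edge at a saturated vertex, since she never
-- has more edges than were seen.
wasteful : ℕ → List (Edge n) → Edge n → ℕ
wasteful k h = symmetric (isolated h) (full k h)

wasteFrom : ℕ → List (Edge n) → List (Edge n) → ℕ
wasteFrom k seen [] = 0
wasteFrom k seen (x ∷ es) = wasteful k seen x + wasteFrom k (seen ∷ʳ x) es

waste : ℕ → List (Edge n) → ℕ
waste k h = wasteFrom k [] h

waste-∷ʳ : ∀ k (h : List (Edge n)) x → waste k (h ∷ʳ x) ≡ waste k h + wasteful k h x
waste-∷ʳ k h x = go [] h
  where
  go : ∀ seen es → wasteFrom k seen (es ∷ʳ x) ≡ wasteFrom k seen es + wasteful k (seen ++ es) x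
  go seen [] = trans (+-identityʳ _) (cong (λ s → wasteful k s x) (sym (++-identityʳ seen)))
  go seen (y ∷ es) = trans (cong (wasteful k seen y +_) (go (seen ∷ʳ y) es))
    (trans (sym (+-assoc (wasteful k seen y) _ _))
      (cong (λ s → wasteful k seen y + wasteFrom k (seen ∷ʳ y) es + wasteful k s x) (++-assoc seen [ y ] es)))

-- 2^k times the probability that, among equally likely arrivals at v and at an isolated vertex,
-- v becomes saturated first.
chance : ℕ → List (Edge n) → Fin n → ℕ
chance k h v = 2 ^ (degree h v ⊓ k)

#chance : ℕ → List (Edge n) → ℕ
#chance {n} k h = ∑ (vertices n) (chance k h)

#chanceGain : ℕ → List (Edge n) → Edge n → ℕ
#chanceGain {n} k h x = ∑ (vertices n) (λ v → inc x v * (low k h v * chance k h v))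

#full : ℕ → List (Edge n) → ℕ
#full {n} k h = ∑ (vertices n) (full k h)

chance≤ : ∀ k (h : List (Edge n)) v → chance k h v ≤ 2 ^ k
chance≤ k h v = ^-monoʳ-≤ 2 (m⊓n≤n (degree h v) k)

chance-∷ʳ : ∀ k (h : List (Edge n)) x v →
  chance k (h ∷ʳ x) v ≡ chance k h v + inc x v * (low k h v * chance k h v)
chance-∷ʳ k h x v rewrite degree-∷ʳ h x v = lemma (degree h v) (inc x v) (inc≤1 x v)
  where
  lemma : ∀ d c → c ≤ 1 → 2 ^ ((d + c) ⊓ k) ≡ 2 ^ (d ⊓ k) + c * (χ (d <? k) * 2 ^ (d ⊓ k))
  lemma d zero _ = trans (cong (λ e → 2 ^ (e ⊓ k)) (+-identityʳ d)) (sym (+-identityʳ _))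
  lemma d (suc zero) _ rewrite +-comm d 1 with d <? k
  ... | yes d<k rewrite m≤n⇒m⊓n≡m d<k | m≤n⇒m⊓n≡m (<⇒≤ d<k) = double (2 ^ d)
    where
    double : ∀ a → 2 * a ≡ a + 1 * (1 * a)
    double = solve-∀
  ... | no d≮k rewrite m≥n⇒m⊓n≡n (≮⇒≥ d≮k) | m≥n⇒m⊓n≡n (m≤n⇒m≤1+n (≮⇒≥ d≮k)) = sym (+-identityʳ _)
  lemma d (suc (suc c)) (s≤s ())

#chance-∷ʳ : ∀ k (h : List (Edge n)) x → #chance k (h ∷ʳ x) ≡ #chance k h + #chanceGain k h x
#chance-∷ʳ {n} k h x = trans (∑-cong (vertices n) (λ v _ → chance-∷ʳ k h x v)) (∑-+ (vertices n) _ _)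

#chance-split : ∀ k (h : List (Edge n)) → ∑ (vertices n) (λ v → low k h v * chance k h v) + 2 ^ k * #full k h ≡ #chance k h
#chance-split {n} k h = trans (cong (∑ (vertices n) (λ v → low k h v * chance k h v) +_) (sym (∑-*ˡ (vertices n) (2 ^ k) (full k h))))
  (trans (sym (∑-+ (vertices n) _ _)) (∑-cong (vertices n) (λ v _ → pointwise (degree h v))))
  where
  pointwise : ∀ d → χ (d <? k) * 2 ^ (d ⊓ k) + 2 ^ k * χ (k ≤? d) ≡ 2 ^ (d ⊓ k)
  pointwise d with d <? k | k ≤? d
  ... | yes d<k | yes k≤d = ⊥-elim (<⇒≱ d<k k≤d)
  ... | no d≮k | no k≰d = ⊥-elim (d≮k (≰⇒> k≰d))
  ... | yes _ | no _ = trans (cong (1 * 2 ^ (d ⊓ k) +_) (*-zeroʳ (2 ^ k))) (trans (+-identityʳ _) (*-identityˡ _))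
  ... | no _ | yes k≤d = trans (*-identityʳ (2 ^ k)) (cong (2 ^_) (sym (m≥n⇒m⊓n≡n k≤d)))

-- Up to the factor (n - 1) 2^k, the waste so far plus an estimate of the waste to come: the first
-- edge of an isolated `v` goes to `w` with probability about 1 / (n - 1), and it is wasteful if `w`
-- fills up before `v` is touched, which has probability about `chance k h w` / 2^k. The initial
-- value n^2 stands for about n / 2^k wasted edges.
wastePotential : ℕ → List (Edge n) → ℕ
wastePotential {n} k h = (n ∸ 1) * 2 ^ k * waste k h + #isolated h * #chance k h

module _ (k : ℕ) (h : List (Edge n)) (x : Edge n) where

  private
    I = #isolated h
    I′ = #isolated (h ∷ʳ x)
    c = #isolatedEnds h x
    H = #chance k h
    e = #chanceGain k h x
    m = (n ∸ 1) * 2 ^ k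
    W = waste k h
    w = wasteful k h x

    potential-∷ʳ : wastePotential k (h ∷ʳ x) ≡ m * (W + w) + I′ * (H + e)
    potential-∷ʳ = cong₂ _+_ (cong (m *_) (waste-∷ʳ k h x)) (cong (I′ *_) (#chance-∷ʳ k h x))

  -- `c * H` is lost at the isolated ends, `m * w` is the new waste and `I * e` the rise of the
  -- chances; the cross term `c * e` has the favourable sign and is dropped.
  wastePotential-upper : wastePotential k (h ∷ʳ x) + c * H ≤ (wastePotential k h + m * w) + I * e
  wastePotential-upper = begin
    wastePotential k (h ∷ʳ x) + c * H ≡⟨ cong (_+ c * H) potential-∷ʳ ⟩
    (m * (W + w) + I′ * (H + e)) + c * H ≤⟨ m≤m+n _ (c * e) ⟩
    (m * (W + w) + I′ * (H + e)) + c * H + c * e ≡⟨ regroup m W w I′ H e c ⟩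
    (m * W + (I′ + c) * H + m * w) + (I′ + c) * e ≡⟨ cong (λ i → (m * W + i * H + m * w) + i * e) (#isolated-∷ʳ h x) ⟩
    (m * W + I * H + m * w) + I * e ∎
    where
    open ≤-Reasoning
    regroup : ∀ m W w i H e c → (m * (W + w) + i * (H + e)) + c * H + c * e ≡ (m * W + (i + c) * H + m * w) + (i + c) * e
    regroup = solve-∀

  wastePotential-lower : wastePotential k h ≤ wastePotential k (h ∷ʳ x) + c * H
  wastePotential-lower = begin
    m * W + I * H ≡⟨ cong (λ i → m * W + i * H) (#isolated-∷ʳ h x) ⟨
    m * W + (I′ + c) * H ≤⟨ m≤m+n _ (m * w + I′ * e) ⟩
    m * W + (I′ + c) * H + (m * w + I′ * e) ≡⟨ regroup m W w I′ H e c ⟩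
    (m * (W + w) + I′ * (H + e)) + c * H ≡⟨ cong (_+ c * H) potential-∷ʳ ⟨
    wastePotential k (h ∷ʳ x) + c * H ∎
    where
    open ≤-Reasoning
    regroup : ∀ m W w i H e c → m * W + (i + c) * H + (m * w + i * e) ≡ (m * (W + w) + i * (H + e)) + c * H
    regroup = solve-∀

-- An isolated vertex is hit by all of its n ∸ 1 edges, any other vertex by at most that many; a vertex
-- hit below saturation doubles its chance, and this is offset by the losses at the isolated vertices.
wastePotential-drift : ∀ k {h r : List (Edge n)} → Splits h r →
  ∑ r (λ x → wastePotential k (h ∷ʳ x)) ≤ length r * wastePotential k h
wastePotential-drift {n} k {h} {r} s = +-cancelʳ-≤ (I * (n ∸ 1) * H) _ _ (begin
  ∑ r (λ x → wastePotential k (h ∷ʳ x)) + I * (n ∸ 1) * H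
    ≡⟨ cong (∑ r (λ x → wastePotential k (h ∷ʳ x)) +_) (trans (∑-*ʳ r (#isolatedEnds h) H) (cong (_* H) (∑-isolatedEnds s))) ⟨
  ∑ r (λ x → wastePotential k (h ∷ʳ x)) + ∑ r (λ x → #isolatedEnds h x * H)
    ≡⟨ ∑-+ r _ _ ⟨
  ∑ r (λ x → wastePotential k (h ∷ʳ x) + #isolatedEnds h x * H)
    ≤⟨ ∑-mono r (λ x _ → wastePotential-upper k h x) ⟩
  ∑ r (λ x → (X + m * wasteful k h x) + I * #chanceGain k h x)
    ≡⟨ trans (∑-+ r _ _) (cong₂ _+_ (trans (∑-+ r _ _) (cong₂ _+_ (∑-const r X) (∑-*ˡ r m (wasteful k h)))) (∑-*ˡ r I (#chanceGain k h))) ⟩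
  (length r * X + m * ∑ r (wasteful k h)) + I * ∑ r (#chanceGain k h)
    ≤⟨ +-mono-≤ (+-monoʳ-≤ (length r * X) (*-monoʳ-≤ m (splits-∑≤ s (isolated h) (full k h)))) (*-monoʳ-≤ I gains) ⟩
  (length r * X + m * (I * #full k h)) + I * ((n ∸ 1) * L)
    ≡⟨ regroup (length r * X) (n ∸ 1) (2 ^ k) I (#full k h) L ⟩
  length r * X + I * (n ∸ 1) * (L + 2 ^ k * #full k h)
    ≡⟨ cong (λ t → length r * X + I * (n ∸ 1) * t) (#chance-split k h) ⟩
  length r * X + I * (n ∸ 1) * H ∎)
  where
  open ≤-Reasoning
  I = #isolated h
  H = #chance k h
  X = wastePotential k h
  m = (n ∸ 1) * 2 ^ k
  L = ∑ (vertices n) (λ v → low k h v * chance k h v)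
  gains : ∑ r (#chanceGain k h) ≤ (n ∸ 1) * L
  gains = ≤-trans (≤-reflexive (∑-degree-weighted r (λ v → low k h v * chance k h v)))
    (≤-trans (∑-mono (vertices n) (λ v _ → *-monoˡ-≤ (low k h v * chance k h v) (splits-degree≤ s v)))
      (≤-reflexive (∑-*ˡ (vertices n) (n ∸ 1) _)))
  regroup : ∀ a p q i f l → (a + p * q * (i * f)) + i * (p * l) ≡ a + i * p * (l + q * f)
  regroup = solve-∀

-- A single edge moves the potential by order n only, against an initial value n^2; a linear number
-- of steps therefore keeps it concentrated.
wastePotential-increment : ∀ k {h r : List (Edge n)} → Splits h r → ∀ x → x ∈ r →
  wastePotential k (h ∷ʳ x) ≤ wastePotential k h + 4 * n * 2 ^ k ×
  wastePotential k h ≤ wastePotential k (h ∷ʳ x) + 4 * n * 2 ^ k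
wastePotential-increment {n} k {h} {r} s x x∈ =
  (begin
    wastePotential k (h ∷ʳ x) ≤⟨ m≤m+n _ (c * H) ⟩
    wastePotential k (h ∷ʳ x) + c * H ≤⟨ wastePotential-upper k h x ⟩
    (X + (n ∸ 1) * 2 ^ k * wasteful k h x) + I * #chanceGain k h x
      ≤⟨ +-mono-≤ (+-monoʳ-≤ X (*-mono-≤ (*-monoˡ-≤ (2 ^ k) (m∸n≤m n 1)) wasteful≤)) (*-mono-≤ (#isolated≤ h) gain≤) ⟩
    (X + n * 2 ^ k * 2) + n * (2 * 2 ^ k) ≡⟨ collect X n (2 ^ k) ⟩
    X + 4 * n * 2 ^ k ∎) ,
  (begin
    X ≤⟨ wastePotential-lower k h x ⟩
    wastePotential k (h ∷ʳ x) + c * H ≤⟨ +-monoʳ-≤ (wastePotential k (h ∷ʳ x)) (*-mono-≤ c≤2 H≤) ⟩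
    wastePotential k (h ∷ʳ x) + 2 * (n * 2 ^ k) ≤⟨ +-monoʳ-≤ (wastePotential k (h ∷ʳ x)) enlarge ⟩
    wastePotential k (h ∷ʳ x) + 4 * n * 2 ^ k ∎)
  where
  open ≤-Reasoning
  I = #isolated h
  H = #chance k h
  X = wastePotential k h
  c = #isolatedEnds h x
  proper : Proper x
  proper = splits-proper s (∈-++⁺ʳ h x∈)
  c≤2 : c ≤ 2
  c≤2 = ∑-inc≤ x proper (isolated h) 1 (isolated≤1 h)
  H≤ : H ≤ n * 2 ^ k
  H≤ = ∑-vertices≤ (chance k h) (2 ^ k) (chance≤ k h)
  wasteful≤ : wasteful k h x ≤ 2
  wasteful≤ = +-mono-≤ (*-mono-≤ (isolated≤1 h (proj₁ x)) (full≤1 k h (proj₂ x))) (*-mono-≤ (isolated≤1 h (proj₂ x)) (full≤1 k h (proj₁ x)))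
  gain≤ : #chanceGain k h x ≤ 2 * 2 ^ k
  gain≤ = ∑-inc≤ x proper (λ v → low k h v * chance k h v) (2 ^ k) (λ v → subst (low k h v * chance k h v ≤_) (*-identityˡ (2 ^ k)) (*-mono-≤ (low≤1 k h v) (chance≤ k h v)))
  collect : ∀ X n a → (X + n * a * 2) + n * (2 * a) ≡ X + 4 * n * a
  collect = solve-∀
  enlarge : 2 * (n * 2 ^ k) ≤ 4 * n * 2 ^ k
  enlarge = ≤-trans (m≤m+n _ (2 * (n * 2 ^ k))) (≤-reflexive (double n (2 ^ k)))
    where
    double : ∀ n a → 2 * (n * a) + 2 * (n * a) ≡ 4 * n * a
    double = solve-∀

-- Chebyshev's inequality for the excess over n^2. The threshold 2 n is what the term 2^-k n of the
-- budget allows at 1/2 per wasted edge, about twice the mean; beyond it the excess is at least 2 n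
-- (n - 1) - n^2 = n (n - 2).
waste-rare : ∀ n k m → m ≤ length (allEdges n) →
  ∑ (orders n) (λ π → χ (2 * n <? 2 ^ k * waste k (take m π))) * ((n * (n ∸ 2)) * (n * (n ∸ 2)))
    ≤ totalOrders n * (m * ((4 * n * 2 ^ k) * (4 * n * 2 ^ k)))
waste-rare n k m m≤N = begin
  ∑ (orders n) (λ π → χ (2 * n <? 2 ^ k * waste k (take m π))) * (b * b) ≡⟨ ∑-*ʳ (orders n) _ (b * b) ⟨
  ∑ (orders n) (λ π → χ (2 * n <? 2 ^ k * waste k (take m π)) * (b * b)) ≤⟨ ∑-mono (orders n) (λ π _ → pointwise (take m π)) ⟩
  ∑ (orders n) (λ π → V (take m π)) ≤⟨ additive-drift (allEdges-unique n) V (c * c) m m≤N drift ⟩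
  totalOrders n * (V [] + m * (c * c)) ≡⟨ cong (λ d → totalOrders n * (d * d + m * (c * c))) initial ⟩
  totalOrders n * (m * (c * c)) ∎
  where
  open ≤-Reasoning
  b = n * (n ∸ 2)
  c = 4 * n * 2 ^ k
  V : List (Edge n) → ℕ
  V h = (wastePotential k h ∸ n * n) * (wastePotential k h ∸ n * n)
  initial : wastePotential {n} k [] ∸ n * n ≡ 0
  initial = m≤n⇒m∸n≡0 (≤-reflexive (begin-equality
    (n ∸ 1) * 2 ^ k * 0 + #isolated {n} [] * #chance {n} k []
      ≡⟨ cong₂ _+_ (*-zeroʳ ((n ∸ 1) * 2 ^ k)) (cong₂ _*_ (#isolated-[] {n}) (∑-vertices-1 n)) ⟩
    n * n ∎))
  drift : ∀ h r → length h < m → h ++ r ↭ allEdges n → ∑ r (λ x → V (h ∷ʳ x)) ≤ length r * (V h + c * c)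
  drift h r _ p = square-drift r (λ x → wastePotential k (h ∷ʳ x)) (n * n) (wastePotential k h) c
    (λ x x∈ → proj₁ (wastePotential-increment k s x x∈)) (λ x x∈ → proj₂ (wastePotential-increment k s x x∈))
    (wastePotential-drift k s)
    where
    s : Splits h r
    s = splits p
  threshold : ∀ n {X} → (n ∸ 1) * (2 * n) ≤ X → n * (n ∸ 2) ≤ X ∸ n * n
  threshold zero _ = z≤n
  threshold (suc zero) _ = z≤n
  threshold (suc (suc n)) ≤X = m+n≤o⇒m≤o∸n _ (≤-trans (≤-reflexive (lemma n)) ≤X)
    where
    lemma : ∀ n → suc (suc n) * n + suc (suc n) * suc (suc n) ≡ suc n * (2 * suc (suc n))
    lemma = solve-∀
  pointwise : ∀ h → χ (2 * n <? 2 ^ k * waste k h) * (b * b) ≤ V h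
  pointwise h with 2 * n <? 2 ^ k * waste k h
  ... | no _ = z≤n
  ... | yes large = ≤-trans (≤-reflexive (*-identityˡ (b * b))) (*-mono-≤ b≤ b≤)
    where
    b≤ : b ≤ wastePotential k h ∸ n * n
    b≤ = threshold n (begin
      (n ∸ 1) * (2 * n) ≤⟨ *-monoʳ-≤ (n ∸ 1) (<⇒≤ large) ⟩
      (n ∸ 1) * (2 ^ k * waste k h) ≡⟨ *-assoc (n ∸ 1) (2 ^ k) (waste k h) ⟨
      (n ∸ 1) * 2 ^ k * waste k h ≤⟨ m≤m+n _ _ ⟩
      wastePotential k h ∎)

-- Degrees along an ordering

incAt : List (Edge n) → ℕ → Fin n → ℕ
incAt [] l v = 0
incAt (x ∷ π) zero v = inc x v
incAt (x ∷ π) (suc l) v = incAt π l v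

incAt≤1 : ∀ (π : List (Edge n)) l v → incAt π l v ≤ 1
incAt≤1 [] l v = z≤n
incAt≤1 (x ∷ π) zero v = inc≤1 x v
incAt≤1 (x ∷ π) (suc l) v = incAt≤1 π l v

degree-take-suc : ∀ (π : List (Edge n)) m v → degree (take (suc m) π) v ≡ degree (take m π) v + incAt π m v
degree-take-suc [] zero v = refl
degree-take-suc [] (suc m) v = refl
degree-take-suc (x ∷ π) zero v = trans (degree-∷ x [] v) (+-identityʳ _)
degree-take-suc (x ∷ π) (suc m) v = trans (degree-∷ x (take (suc m) π) v)
  (trans (cong (inc x v +_) (degree-take-suc π m v))
  (trans (sym (+-assoc (inc x v) _ _)) (cong (_+ incAt π m v) (sym (degree-∷ x (take m π) v)))))

degree-take-mono : ∀ (π : List (Edge n)) {m m′} v → m ≤ m′ → degree (take m π) v ≤ degree (take m′ π) v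
degree-take-mono π {m} {m′} v m≤m′ = go (m′ ∸ m) (m∸n+n≡m m≤m′)
  where
  go : ∀ {m′} d → d + m ≡ m′ → degree (take m π) v ≤ degree (take m′ π) v
  go zero refl = ≤-refl
  go (suc d) refl = ≤-trans (go d refl)
    (≤-trans (m≤m+n _ (incAt π (d + m) v)) (≤-reflexive (sym (degree-take-suc π (d + m) v))))

∑-incAt≤2 : ∀ (π : List (Edge n)) → (∀ {x} → x ∈ π → Proper x) → ∀ l → ∑ (vertices n) (incAt π l) ≤ 2
∑-incAt≤2 {n} [] p l = ≤-trans (≤-reflexive (∑-zero (vertices n))) z≤n
∑-incAt≤2 {n} (x ∷ π) p zero = ≤-trans
  (≤-reflexive (∑-cong (vertices n) (λ v _ → sym (*-identityʳ (inc x v)))))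
  (∑-inc≤ x (p (here refl)) (λ _ → 1) 1 (λ _ → ≤-refl))
∑-incAt≤2 (x ∷ π) p (suc l) = ∑-incAt≤2 π (p ∘ there) l

module _ (x : Edge n) (v : Fin n) where

  private
    displaced : ℕ → List (Edge n) → Edge n
    displaced d xs = proj₁ (exchange d x xs)
    rest : ℕ → List (Edge n) → List (Edge n)
    rest d xs = proj₂ (exchange d x xs)

  exchange-displaced : ∀ d xs → d < length xs → inc (displaced d xs) v ≡ incAt xs d v
  exchange-displaced zero (y ∷ ys) _ = refl
  exchange-displaced (suc d) (y ∷ ys) (s≤s d<) = exchange-displaced d ys d<

  exchange-incAt : ∀ d xs → d < length xs → incAt (rest d xs) d v ≡ inc x v
  exchange-incAt zero (y ∷ ys) _ = refl
  exchange-incAt (suc d) (y ∷ ys) (s≤s d<) = exchange-incAt d ys d<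

  exchange-before : ∀ d xs m → m ≤ d → degree (take m (rest d xs)) v ≡ degree (take m xs) v
  exchange-before d [] m _ = refl
  exchange-before d (y ∷ ys) zero _ = refl
  exchange-before (suc d) (y ∷ ys) (suc m) (s≤s m≤d) = trans (degree-∷ y (take m (rest d ys)) v)
    (trans (cong (inc y v +_) (exchange-before d ys m m≤d)) (sym (degree-∷ y (take m ys) v)))

  exchange-after : ∀ d xs m → d < m →
    inc (displaced d xs) v + degree (take m (rest d xs)) v ≡ inc x v + degree (take m xs) v
  exchange-after d [] (suc m) _ = refl
  exchange-after zero (y ∷ ys) (suc m) _ = trans (cong (inc y v +_) (degree-∷ x (take m ys) v))
    (trans (+-left-comm (inc y v) (inc x v) _) (cong (inc x v +_) (sym (degree-∷ y (take m ys) v))))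
  exchange-after (suc d) (y ∷ ys) (suc m) (s≤s d<m) = trans
    (cong (inc (displaced d ys) v +_) (degree-∷ y (take m (rest d ys)) v))
    (trans (+-left-comm (inc (displaced d ys) v) (inc y v) _) (trans (cong (inc y v +_) (exchange-after d ys m d<m))
      (trans (+-left-comm (inc y v) (inc x v) _) (cong (inc x v +_) (sym (degree-∷ y (take m ys) v))))))

-- A prefix ending between the two positions gives away entry `i` and receives entry `i + d`.
transpose-between : ∀ i d (π : List (Edge n)) m v → i + d < length π → i < m → m ≤ i + d →
  degree (take m (transpose i d π)) v + incAt π i v ≡ degree (take m π) v + incAt π (i + d) v
transpose-between zero zero π m v _ 0<m m≤0 = ⊥-elim (<⇒≱ 0<m m≤0)
transpose-between zero (suc d) (x ∷ xs) (suc m) v (s≤s d<) _ (s≤s m≤d) = begin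
  degree (y ∷ take m ys) v + inc x v ≡⟨ cong (_+ inc x v) (degree-∷ y (take m ys) v) ⟩
  inc y v + degree (take m ys) v + inc x v
    ≡⟨ cong₂ (λ a b → a + b + inc x v) (exchange-displaced x v d xs d<) (exchange-before x v d xs m m≤d) ⟩
  incAt xs d v + degree (take m xs) v + inc x v ≡⟨ reverse (incAt xs d v) _ (inc x v) ⟩
  inc x v + degree (take m xs) v + incAt xs d v ≡⟨ cong (_+ incAt xs d v) (degree-∷ x (take m xs) v) ⟨
  degree (x ∷ take m xs) v + incAt xs d v ∎
  where
  open ≡-Reasoning
  y = proj₁ (exchange d x xs)
  ys = proj₂ (exchange d x xs)
  reverse : ∀ a b c → a + b + c ≡ c + b + a
  reverse = solve-∀
transpose-between (suc i) d (x ∷ xs) (suc m) v (s≤s i+d<) (s≤s i<m) (s≤s m≤) = begin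
  degree (x ∷ take m (transpose i d xs)) v + incAt xs i v ≡⟨ cong (_+ incAt xs i v) (degree-∷ x _ v) ⟩
  inc x v + degree (take m (transpose i d xs)) v + incAt xs i v ≡⟨ +-assoc (inc x v) _ _ ⟩
  inc x v + (degree (take m (transpose i d xs)) v + incAt xs i v)
    ≡⟨ cong (inc x v +_) (transpose-between i d xs m v i+d< i<m m≤) ⟩
  inc x v + (degree (take m xs) v + incAt xs (i + d) v) ≡⟨ +-assoc (inc x v) _ _ ⟨
  inc x v + degree (take m xs) v + incAt xs (i + d) v ≡⟨ cong (_+ incAt xs (i + d) v) (degree-∷ x (take m xs) v) ⟨
  degree (x ∷ take m xs) v + incAt xs (i + d) v ∎
  where open ≡-Reasoning

transpose-after : ∀ i d (π : List (Edge n)) m v → i + d < m → degree (take m (transpose i d π)) v ≡ degree (take m π) v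
transpose-after i d [] m v _ = refl
transpose-after zero zero (x ∷ xs) m v _ = refl
transpose-after zero (suc d) (x ∷ xs) (suc m) v (s≤s d<m) = trans (degree-∷ (proj₁ (exchange d x xs)) (take m (proj₂ (exchange d x xs))) v)
  (trans (exchange-after x v d xs m d<m) (sym (degree-∷ x (take m xs) v)))
transpose-after (suc i) d (x ∷ xs) (suc m) v (s≤s lt) = trans (degree-∷ x (take m (transpose i d xs)) v)
  (trans (cong (inc x v +_) (transpose-after i d xs m v lt)) (sym (degree-∷ x (take m xs) v)))

transpose-incAt : ∀ i d (π : List (Edge n)) v → i + d < length π → incAt (transpose i d π) (i + d) v ≡ incAt π i v
transpose-incAt zero zero (x ∷ xs) v _ = refl
transpose-incAt zero (suc d) (x ∷ xs) v (s≤s d<) = exchange-incAt x v d xs d<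
transpose-incAt (suc i) d (x ∷ xs) v (s≤s lt) = transpose-incAt i d xs v lt

∑-upTo-∷ʳ : ∀ m (f : ℕ → ℕ) → ∑ (upTo (suc m)) f ≡ ∑ (upTo m) f + f m
∑-upTo-∷ʳ m f = trans (cong (λ l → ∑ l f) (sym (upTo-∷ʳ m))) (∑-∷ʳ (upTo m) m f)

∑-upTo-mono : ∀ {m m′} (f : ℕ → ℕ) → m ≤ m′ → ∑ (upTo m) f ≤ ∑ (upTo m′) f
∑-upTo-mono {m} {m′} f m≤m′ = go (m′ ∸ m) (m∸n+n≡m m≤m′)
  where
  go : ∀ {m′} d → d + m ≡ m′ → ∑ (upTo m) f ≤ ∑ (upTo m′) f
  go zero refl = ≤-refl
  go (suc d) refl = ≤-trans (go d refl) (≤-trans (m≤m+n _ (f (d + m))) (≤-reflexive (sym (∑-upTo-∷ʳ (d + m) f))))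

module _ (π : List (Edge n)) (v : Fin n) where

  private
    deg : ℕ → ℕ
    deg m = degree (take m π) v

  ∑-incAt : ∀ m → ∑ (upTo m) (λ l → incAt π l v) ≡ deg m
  ∑-incAt zero = refl
  ∑-incAt (suc m) = trans (∑-upTo-∷ʳ m _) (trans (cong (_+ incAt π m v) (∑-incAt m)) (sym (degree-take-suc π m v)))

  -- Each position from `a` on either misses `v` or raises its degree by one.
  missing-count : ∀ a m → a ≤ m →
    m + deg a ≤ a + ∑ (upTo m) (λ j → χ (a ≤? j ×-dec incAt π j v ≟ 0)) + deg m
  missing-count a m a≤m = go (m ∸ a) (m∸n+n≡m a≤m)
    where
    open ≤-Reasoning
    f : ℕ → ℕ
    f j = χ (a ≤? j ×-dec incAt π j v ≟ 0)
    term : ∀ m → a ≤ m → 1 ≤ f m + incAt π m v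
    term m a≤m with incAt π m v in eq
    ... | suc c = ≤-trans (s≤s z≤n) (m≤n+m (suc c) _)
    ... | zero = ≤-trans (≤-reflexive (sym (χ-yes (a ≤? m ×-dec 0 ≟ 0) (a≤m , refl)))) (m≤m+n _ 0)
    go : ∀ {m} d → d + a ≡ m → m + deg a ≤ a + ∑ (upTo m) f + deg m
    go zero refl = +-monoˡ-≤ (deg a) (m≤m+n a _)
    go (suc d) refl = begin
      suc (d + a) + deg a ≤⟨ +-mono-≤ (term (d + a) (m≤n+m a d)) (go d refl) ⟩
      (f (d + a) + incAt π (d + a) v) + (a + S + deg (d + a)) ≡⟨ regroup (f (d + a)) (incAt π (d + a) v) a S (deg (d + a)) ⟩
      a + (S + f (d + a)) + (deg (d + a) + incAt π (d + a) v)
        ≡⟨ cong₂ (λ s t → a + s + t) (∑-upTo-∷ʳ (d + a) f) (degree-take-suc π (d + a) v) ⟨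
      a + ∑ (upTo (suc (d + a))) f + deg (suc (d + a)) ∎
      where
      S = ∑ (upTo (d + a)) f
      regroup : ∀ f i a s t → (f + i) + (a + s + t) ≡ a + (s + f) + (t + i)
      regroup = solve-∀

  -- The counted positions are among the first `c` edges at `v` from position `a` on.
  early-count : ∀ a c m →
    ∑ (upTo m) (λ j → χ (incAt π j v ≟ 1 ×-dec a ≤? j ×-dec deg (suc j) ≤? deg a + c)) ≤ c
  early-count a c m = proj₁ (go m)
    where
    f : ℕ → ℕ
    f j = χ (incAt π j v ≟ 1 ×-dec a ≤? j ×-dec deg (suc j) ≤? deg a + c)
    S : ℕ → ℕ
    S m = ∑ (upTo m) f
    -- Before position `a` nothing is counted, but the degree may still be below `deg a`; the second
    -- alternative holds from the first counted position on.
    go : ∀ m → S m ≤ c × (S m ≡ 0 ⊎ S m + deg a ≤ deg m)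
    go zero = z≤n , inj₁ refl
    go (suc m) rewrite ∑-upTo-∷ʳ m f with incAt π m v ≟ 1 ×-dec a ≤? m ×-dec deg (suc m) ≤? deg a + c | go m
    ... | no _ | S≤ , inj₁ S≡0 rewrite +-identityʳ (S m) = S≤ , inj₁ S≡0
    ... | no _ | S≤ , inj₂ S+≤ rewrite +-identityʳ (S m) = S≤ , inj₂ (≤-trans S+≤ (degree-take-mono π v (n≤1+n m)))
    ... | yes (i≡1 , a≤m , deg≤) | S≤ , hyp =
      +-cancelʳ-≤ (deg a) _ _ (≤-trans grown (≤-trans deg≤ (≤-reflexive (+-comm (deg a) c)))) , inj₂ grown
      where
      before : S m ≡ 0 ⊎ S m + deg a ≤ deg m → S m + deg a ≤ deg m
      before (inj₁ S≡0) rewrite S≡0 = degree-take-mono π v a≤m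
      before (inj₂ S+≤) = S+≤
      grown : S m + 1 + deg a ≤ deg (suc m)
      grown = subst₂ _≤_ (regroup (S m) (deg a)) (sym (trans (degree-take-suc π m v) (cong (deg m +_) i≡1)))
        (+-monoˡ-≤ 1 (before hyp))
        where
        regroup : ∀ s d → s + d + 1 ≡ s + 1 + d
        regroup = solve-∀

-- Switchings

transposition : ℕ → ℕ → List A → List A
transposition i j = transpose i (j ∸ i)

-- Double counting. Each pair in `F` can be switched in at least `a` ways. From the outcome, `j` is
-- one of at most `b` positions allowed by `R`, `i` is one of `t`, and the transposition undoes
-- itself.
switching : ∀ {n} {F F′ : List (Edge n) → Fin n → Set} {R : List (Edge n) → Fin n → ℕ → Set}
  (F? : ∀ π v → Dec (F π v)) (F′? : ∀ π v → Dec (F′ π v)) (R? : ∀ π v j → Dec (R π v j)) (t a b : ℕ) →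
  let N = length (allEdges n) in
  (∀ π v → π ∈ orders n → F π v → ∃ λ i → i < t ×
     a ≤ ∑ (upTo N) (λ j → χ (F′? (transposition i j π) v) * χ (R? (transposition i j π) v j))) →
  (∀ π v → π ∈ orders n → ∑ (upTo N) (λ j → χ (R? π v j)) ≤ b) →
  a * ∑ (orders n) (λ π → ∑ (vertices n) (λ v → χ (F? π v)))
    ≤ t * b * ∑ (orders n) (λ π → ∑ (vertices n) (λ v → χ (F′? π v)))
switching {n} F? F′? R? t a b forward backward = begin
  a * ∑ Π (λ π → ∑ V (λ v → χ (F? π v)))
    ≡⟨ trans (sym (∑-*ˡ Π a _)) (∑-cong Π (λ π _ → sym (∑-*ˡ V a _))) ⟩
  ∑ Π (λ π → ∑ V (λ v → a * χ (F? π v)))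
    ≤⟨ ∑-mono Π (λ π π∈ → ∑-mono V (λ v _ → choose π v π∈)) ⟩
  ∑ Π (λ π → ∑ V (λ v → ∑ (upTo t) (λ i → ∑ (upTo N) (λ j → g v j (transposition i j π)))))
    ≡⟨ trans (∑-comm Π V _) (∑-cong V (λ v _ → trans (∑-comm Π (upTo t) _) (∑-cong (upTo t) (λ i _ →
         trans (∑-comm Π (upTo N) _) (∑-cong (upTo N) (λ j _ → ∑-transpose (allEdges-unique n) i (j ∸ i) (g v j))))))) ⟩
  ∑ V (λ v → ∑ (upTo t) (λ i → ∑ (upTo N) (λ j → ∑ Π (g v j))))
    ≡⟨ ∑-cong V (λ v _ → trans (∑-const (upTo t) _) (cong₂ _*_ (length-upTo t) (sym (∑-comm Π (upTo N) (λ π j → g v j π))))) ⟩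
  ∑ V (λ v → t * ∑ Π (λ π → ∑ (upTo N) (λ j → g v j π)))
    ≤⟨ ∑-mono V (λ v _ → *-monoʳ-≤ t (∑-mono Π (λ π π∈ → collapse π v π∈))) ⟩
  ∑ V (λ v → t * ∑ Π (λ π → χ (F′? π v) * b))
    ≡⟨ trans (∑-*ˡ V t _) (cong (t *_) (trans (∑-comm V Π _) (trans (∑-cong Π (λ π _ → ∑-*ʳ V _ b)) (∑-*ʳ Π _ b)))) ⟩
  t * (∑ Π (λ π → ∑ V (λ v → χ (F′? π v))) * b)
    ≡⟨ reorder t _ b ⟩
  t * b * ∑ Π (λ π → ∑ V (λ v → χ (F′? π v))) ∎
  where
  open ≤-Reasoning
  Π = orders n
  V = vertices n
  N = length (allEdges n)
  reorder : ∀ t s b → t * (s * b) ≡ t * b * s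
  reorder = solve-∀
  g : Fin n → ℕ → List (Edge n) → ℕ
  g v j π = χ (F′? π v) * χ (R? π v j)
  choose : ∀ π v → π ∈ Π → a * χ (F? π v) ≤ ∑ (upTo t) (λ i → ∑ (upTo N) (λ j → g v j (transposition i j π)))
  choose π v π∈ = *χ-≤ (F? π v) (λ f → from (forward π v π∈ f))
    where
    from : (∃ λ i → i < t × a ≤ ∑ (upTo N) (λ j → g v j (transposition i j π))) →
      a ≤ ∑ (upTo t) (λ i → ∑ (upTo N) (λ j → g v j (transposition i j π)))
    from (i , i<t , a≤) = ≤-trans a≤ (∑-∈ (λ i → ∑ (upTo N) (λ j → g v j (transposition i j π))) (∈-upTo⁺ i<t))
    *χ-≤ : {P : Set} (d : Dec P) {b : ℕ} → (P → a ≤ b) → a * χ d ≤ b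
    *χ-≤ (yes p) f = ≤-trans (≤-reflexive (*-identityʳ a)) (f p)
    *χ-≤ (no _) f = ≤-trans (≤-reflexive (*-zeroʳ a)) z≤n
  collapse : ∀ π v → π ∈ Π → ∑ (upTo N) (λ j → g v j π) ≤ χ (F′? π v) * b
  collapse π v π∈ = ≤-trans (≤-reflexive (∑-*ˡ (upTo N) (χ (F′? π v)) _)) (*-monoʳ-≤ (χ (F′? π v)) (backward π v π∈))

lowOthers : ℕ → List (Edge n) → Fin n → ℕ
lowOthers {n} k h v = ∑ (vertices n) (λ u → χ (¬? (v ≟F u)) * low k h u)

least : ∀ {P : ℕ → Set} → (∀ m → Dec (P m)) → ∀ m → P m → ∃ λ l → P l × (∀ {j} → P j → l ≤ j)
least P? m p = go m m ≤-refl p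
  where
  go : ∀ fuel m → m ≤ fuel → _ → _
  go fuel m m≤ p with anyUpTo? P? m
  ... | no none = m , p , λ {j} q → ≮⇒≥ (λ j<m → none (j , j<m , q))
  go zero zero z≤n p | yes (_ , () , _)
  go (suc fuel) m m≤ p | yes (l , l<m , q) = go fuel l (≤-pred (≤-trans l<m m≤)) q

module Switch (n k t m₀ m₁ : ℕ) (t≤m₀ : t ≤ m₀) (m₀≤m₁ : m₀ ≤ m₁) (m₁≤N : m₁ ≤ length (allEdges n)) where

  private
    N = length (allEdges n)

  -- In the application `m` is the hitting time and `x` is 0. A switch may change the hitting time
  -- and make another vertex low; therefore `m` is any time between `m₀` and `m₁`, and `x` counts
  -- the low vertices tolerated besides `v`.
  At : ℕ → ℕ → ℕ → List (Edge n) → Fin n → ℕ → Set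
  At d c x π v m = m₀ ≤ m × degree (take t π) v ≡ d × degree (take m π) v ≤ d + c × lowOthers k (take m π) v ≤ x

  at? : ∀ d c x π v m → Dec (At d c x π v m)
  at? d c x π v m = m₀ ≤? m ×-dec degree (take t π) v ≟ d ×-dec degree (take m π) v ≤? d + c ×-dec lowOthers k (take m π) v ≤? x

  Late : ℕ → ℕ → ℕ → List (Edge n) → Fin n → Set
  Late d c x π v = ∃ λ m → m < suc m₁ × At d c x π v m

  late? : ∀ d c x π v → Dec (Late d c x π v)
  late? d c x π v = anyUpTo? (at? d c x π v) (suc m₁)

  #late : ℕ → ℕ → ℕ → ℕ
  #late d c x = ∑ (orders n) (λ π → ∑ (vertices n) (λ v → χ (late? d c x π v)))

  private
    order-length : ∀ {π} → π ∈ orders n → length π ≡ N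
    order-length π∈ = ↭-length (perms⇒↭ (allEdges n) π∈)

    order-proper : ∀ {π} → π ∈ orders n → ∀ {x} → x ∈ π → Proper x
    order-proper π∈ x∈ = allEdges-proper (∈-resp-↭ (perms⇒↭ (allEdges n) π∈) x∈)

    order-degree : ∀ {π} → π ∈ orders n → ∀ v → degree (take N π) v ≡ n ∸ 1
    order-degree {π} π∈ v = trans (cong (λ es → degree es v) (take-all N π (≤-reflexive (order-length π∈))))
      (trans (degree-↭ (perms⇒↭ (allEdges n) π∈) v) (cong (_∸ 1) (degree-allEdges v)))

    early-position : ∀ (π : List (Edge n)) v {d} → degree (take t π) v ≡ suc d → ∃ λ i → i < t × incAt π i v ≡ 1
    early-position π v deg≡ with ∑-positive (upTo t) (λ l → incAt π l v)
      (subst (1 ≤_) (sym (trans (∑-incAt π v t) deg≡)) (s≤s z≤n))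
    ... | i , i∈ , pos = i , ∈-upTo⁻ i∈ , ≤-antisym (incAt≤1 π i v) pos

  module Moved {π} (π∈ : π ∈ orders n) {i j : ℕ} (i<j : i < j) (j<N : j < N) where

    π′ : List (Edge n)
    π′ = transposition i j π

    private
      i+[j∸i] : i + (j ∸ i) ≡ j
      i+[j∸i] = m+[n∸m]≡n (<⇒≤ i<j)
      in-range : i + (j ∸ i) < length π
      in-range = subst₂ _<_ (sym i+[j∸i]) (sym (order-length π∈)) j<N

    between : ∀ m v → i < m → m ≤ j → degree (take m π′) v + incAt π i v ≡ degree (take m π) v + incAt π j v
    between m v i<m m≤j = trans
      (transpose-between i (j ∸ i) π m v in-range i<m (subst (m ≤_) (sym i+[j∸i]) m≤j))
      (cong (λ l → degree (take m π) v + incAt π l v) i+[j∸i])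

    after : ∀ m v → j < m → degree (take m π′) v ≡ degree (take m π) v
    after m v j<m = transpose-after i (j ∸ i) π m v (subst (_< m) (sym i+[j∸i]) j<m)

    moved : ∀ v → incAt π′ j v ≡ incAt π i v
    moved v = trans (cong (λ l → incAt π′ l v) (sym i+[j∸i])) (transpose-incAt i (j ∸ i) π v in-range)

    dropped : ∀ m v → i < m → m ≤ j → incAt π i v ≡ 1 → incAt π j v ≡ 0 → suc (degree (take m π′) v) ≡ degree (take m π) v
    dropped m v i<m m≤j at-i at-j = trans (+-comm 1 _) (trans (cong (degree (take m π′) v +_) (sym at-i))
      (trans (between m v i<m m≤j) (trans (cong (degree (take m π) v +_) at-j) (+-identityʳ _))))

    lowOthers-after : ∀ m v → j < m → lowOthers k (take m π′) v ≡ lowOthers k (take m π) v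
    lowOthers-after m v j<m = ∑-cong (vertices n)
      (λ u _ → cong (λ d → χ (¬? (v ≟F u)) * χ (d <? k)) (after m u j<m))

    -- The edge taken away from position `i` has only one end other than `v`, and only that end can
    -- drop below degree `k`.
    lowOthers-between : ∀ m v → i < m → m ≤ j → incAt π i v ≡ 1 → lowOthers k (take m π′) v ≤ suc (lowOthers k (take m π) v)
    lowOthers-between m v i<m m≤j at-i = begin
      ∑ V (λ u → other u * low k (take m π′) u) ≤⟨ ∑-mono V (λ u _ → *-monoʳ-≤ (other u) (pointwise u)) ⟩
      ∑ V (λ u → other u * (low k (take m π) u + incAt π i u)) ≡⟨ ∑-cong V (λ u _ → *-distribˡ-+ (other u) (low k (take m π) u) (incAt π i u)) ⟩
      ∑ V (λ u → other u * low k (take m π) u + other u * incAt π i u) ≡⟨ ∑-+ V _ _ ⟩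
      lowOthers k (take m π) v + ∑ V (λ u → other u * incAt π i u) ≤⟨ +-monoʳ-≤ (lowOthers k (take m π) v) one-other ⟩
      lowOthers k (take m π) v + 1 ≡⟨ +-comm _ 1 ⟩
      suc (lowOthers k (take m π) v) ∎
      where
      open ≤-Reasoning
      V = vertices n
      other : Fin n → ℕ
      other u = χ (¬? (v ≟F u))
      pointwise : ∀ u → low k (take m π′) u ≤ low k (take m π) u + incAt π i u
      pointwise u = cases (incAt π i u) refl
        where
        cases : ∀ a → incAt π i u ≡ a → low k (take m π′) u ≤ low k (take m π) u + a
        cases (suc a) _ = ≤-trans (low≤1 k (take m π′) u) (≤-trans (s≤s z≤n) (m≤n+m (suc a) (low k (take m π) u)))
        cases zero eq = ≤-trans (χ-mono (degree (take m π′) u <? k) (degree (take m π) u <? k) (≤-<-trans grows)) (m≤m+n _ 0)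
          where
          grows : degree (take m π) u ≤ degree (take m π′) u
          grows = ≤-trans (m≤m+n _ (incAt π j u)) (≤-reflexive (trans (sym (between m u i<m m≤j))
            (trans (cong (degree (take m π′) u +_) eq) (+-identityʳ _))))
      split : ∀ u → χ (v ≟F u) * incAt π i u + other u * incAt π i u ≡ incAt π i u
      split u with v ≟F u
      ... | yes _ = trans (+-identityʳ _) (+-identityʳ _)
      ... | no _ = +-identityʳ _
      one-other : ∑ V (λ u → other u * incAt π i u) ≤ 1
      one-other = +-cancelˡ-≤ 1 _ _ (begin
        1 + ∑ V (λ u → other u * incAt π i u)
          ≡⟨ cong (_+ ∑ V (λ u → other u * incAt π i u)) (trans (∑-vertex v (incAt π i)) at-i) ⟨
        ∑ V (λ u → χ (v ≟F u) * incAt π i u) + ∑ V (λ u → other u * incAt π i u) ≡⟨ ∑-+ V _ _ ⟨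
        ∑ V (λ u → χ (v ≟F u) * incAt π i u + other u * incAt π i u) ≡⟨ ∑-cong V (λ u _ → split u) ⟩
        ∑ V (incAt π i) ≤⟨ ∑-incAt≤2 π (order-proper π∈) i ⟩
        2 ∎)

  private
    χ*χ : {P Q : Set} (p : Dec P) (q : Dec Q) → P → Q → 1 ≤ χ p * χ q
    χ*χ p q x y = ≤-reflexive (sym (cong₂ _*_ (χ-yes p x) (χ-yes q y)))

  private
    χ-at : {F : List (Edge n) → Fin n → Set} {R : List (Edge n) → Fin n → ℕ → Set} → (∀ π v → Dec (F π v)) →
      (∀ π v j → Dec (R π v j)) → List (Edge n) → Fin n → ℕ → ℕ → ℕ
    χ-at F? R? π v i j = χ (F? (transposition i j π) v) * χ (R? (transposition i j π) v j)

  -- An early edge at `v` changes places with an edge of the window that avoids `v`; there are at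
  -- least `m₀ ∸ (t + c)` of these. Backwards, the moved edge is among the first `suc c` edges at
  -- `v` after time `t`. This gains if `m₀` is far above `t`.
  switch-inside : ∀ d c x → (m₀ ∸ (t + c)) * #late (suc d) c x ≤ t * suc c * #late d (suc c) x
  switch-inside d c x = switching (late? (suc d) c x) (late? d (suc c) x) R? t (m₀ ∸ (t + c)) (suc c) forward
    (λ π v _ → early-count π v t (suc c) N)
    where
    R : List (Edge n) → Fin n → ℕ → Set
    R π v j = incAt π j v ≡ 1 × t ≤ j × degree (take (suc j) π) v ≤ degree (take t π) v + suc c
    R? : ∀ π v j → Dec (R π v j)
    R? π v j = incAt π j v ≟ 1 ×-dec t ≤? j ×-dec degree (take (suc j) π) v ≤? degree (take t π) v + suc c
    forward : ∀ π v → π ∈ orders n → Late (suc d) c x π v → ∃ λ i → i < t ×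
      m₀ ∸ (t + c) ≤ ∑ (upTo N) (λ j → χ-at (late? d (suc c) x) R? π v i j)
    forward π v π∈ (m , m<m₁ , m₀≤m , deg-t , deg-m , others) = i , i<t , (begin
      m₀ ∸ (t + c) ≤⟨ m≤n+o⇒m∸n≤o m₀ (t + c) count ⟩
      ∑ (upTo m) (λ j → χ (t ≤? j ×-dec incAt π j v ≟ 0)) ≤⟨ ∑-mono (upTo m) valid ⟩
      ∑ (upTo m) (λ j → χ-at (late? d (suc c) x) R? π v i j)
        ≤⟨ ∑-upTo-mono _ (≤-trans (≤-pred m<m₁) m₁≤N) ⟩
      ∑ (upTo N) (λ j → χ-at (late? d (suc c) x) R? π v i j) ∎)
      where
      open ≤-Reasoning
      position = early-position π v deg-t
      i = proj₁ position
      i<t = proj₁ (proj₂ position)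
      at-i = proj₂ (proj₂ position)
      S = ∑ (upTo m) (λ j → χ (t ≤? j ×-dec incAt π j v ≟ 0))
      t≤m : t ≤ m
      t≤m = ≤-trans t≤m₀ m₀≤m
      count : m₀ ≤ t + c + S
      count = +-cancelʳ-≤ (suc d) _ _ (begin
        m₀ + suc d ≤⟨ +-monoˡ-≤ (suc d) m₀≤m ⟩
        m + suc d ≡⟨ cong (m +_) deg-t ⟨
        m + degree (take t π) v ≤⟨ missing-count π v t m t≤m ⟩
        t + S + degree (take m π) v ≤⟨ +-monoʳ-≤ (t + S) deg-m ⟩
        t + S + (suc d + c) ≡⟨ regroup t S (suc d) c ⟩
        t + c + S + suc d ∎)
        where
        regroup : ∀ t s d c → t + s + (d + c) ≡ t + c + s + d
        regroup = solve-∀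
      valid : ∀ j → j ∈ upTo m → χ (t ≤? j ×-dec incAt π j v ≟ 0)
        ≤ χ-at (late? d (suc c) x) R? π v i j
      valid j j∈ = χ-≤ (t ≤? j ×-dec incAt π j v ≟ 0) check
        where
        j<m : j < m
        j<m = ∈-upTo⁻ j∈
        check : t ≤ j × incAt π j v ≡ 0 →
          1 ≤ χ-at (late? d (suc c) x) R? π v i j
        check (t≤j , at-j) = χ*χ (late? d (suc c) x π′ v) (R? π′ v j)
          (m , m<m₁ , m₀≤m , deg-t′ , ≤-trans (≤-reflexive (after m v j<m)) (≤-trans deg-m (≤-reflexive (sym (+-suc d c)))) ,
            ≤-trans (≤-reflexive (lowOthers-after m v j<m)) others)
          (trans (moved v) at-i , t≤j , (begin
            degree (take (suc j) π′) v ≡⟨ after (suc j) v ≤-refl ⟩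
            degree (take (suc j) π) v ≤⟨ degree-take-mono π v j<m ⟩
            degree (take m π) v ≤⟨ deg-m ⟩
            suc d + c ≡⟨ +-suc d c ⟨
            d + suc c ≡⟨ cong (_+ suc c) deg-t′ ⟨
            degree (take t π′) v + suc c ∎))
          where
          open Moved π∈ (<-≤-trans i<t t≤j) (<-≤-trans j<m (≤-trans (≤-pred m<m₁) m₁≤N))
          deg-t′ : degree (take t π′) v ≡ d
          deg-t′ = suc-injective (trans (dropped t v i<t t≤j at-i at-j) deg-t)

  -- The early edge goes beyond `m₁`, so its other end may become low and `x` grows by one.
  -- Backwards it can be any edge at `v`, so for linear `t` the factor is bounded but not small.
  switch-outside : ∀ d c x → (N ∸ (m₁ + (n ∸ 1))) * #late (suc d) c x ≤ t * (n ∸ 1) * #late d c (suc x)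
  switch-outside d c x = switching (late? (suc d) c x) (late? d c (suc x)) R? t (N ∸ (m₁ + (n ∸ 1))) (n ∸ 1) forward backward
    where
    R? : ∀ π v j → Dec (incAt π j v ≡ 1)
    R? π v j = incAt π j v ≟ 1
    backward : ∀ π v → π ∈ orders n → ∑ (upTo N) (λ j → χ (R? π v j)) ≤ n ∸ 1
    backward π v π∈ = ≤-trans (∑-mono (upTo N) (λ j _ → pointwise (incAt π j v)))
      (≤-reflexive (trans (∑-incAt π v N) (order-degree π∈ v)))
      where
      pointwise : ∀ a → χ (a ≟ 1) ≤ a
      pointwise zero = z≤n
      pointwise (suc a) = ≤-trans (χ≤1 (suc a ≟ 1)) (s≤s z≤n)
    forward : ∀ π v → π ∈ orders n → Late (suc d) c x π v → ∃ λ i → i < t ×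
      N ∸ (m₁ + (n ∸ 1)) ≤ ∑ (upTo N) (λ j → χ-at (late? d c (suc x)) R? π v i j)
    forward π v π∈ (m , m<m₁ , m₀≤m , deg-t , deg-m , others) = i , i<t , ≤-trans (m≤n+o⇒m∸n≤o N (m₁ + (n ∸ 1)) count) (∑-mono (upTo N) valid)
      where
      open ≤-Reasoning
      position = early-position π v deg-t
      i = proj₁ position
      i<t = proj₁ (proj₂ position)
      at-i = proj₂ (proj₂ position)
      S = ∑ (upTo N) (λ j → χ (m₁ ≤? j ×-dec incAt π j v ≟ 0))
      count : N ≤ m₁ + (n ∸ 1) + S
      count = begin
        N ≤⟨ m≤m+n N (degree (take m₁ π) v) ⟩
        N + degree (take m₁ π) v ≤⟨ missing-count π v m₁ N m₁≤N ⟩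
        m₁ + S + degree (take N π) v ≡⟨ cong (m₁ + S +_) (order-degree π∈ v) ⟩
        m₁ + S + (n ∸ 1) ≡⟨ regroup m₁ S (n ∸ 1) ⟩
        m₁ + (n ∸ 1) + S ∎
        where
        regroup : ∀ a b c → a + b + c ≡ a + c + b
        regroup = solve-∀
      valid : ∀ j → j ∈ upTo N → χ (m₁ ≤? j ×-dec incAt π j v ≟ 0)
        ≤ χ-at (late? d c (suc x)) R? π v i j
      valid j j∈ = χ-≤ (m₁ ≤? j ×-dec incAt π j v ≟ 0) check
        where
        check : m₁ ≤ j × incAt π j v ≡ 0 →
          1 ≤ χ-at (late? d c (suc x)) R? π v i j
        check (m₁≤j , at-j) = χ*χ (late? d c (suc x) π′ v) (R? π′ v j)
          (m , m<m₁ , m₀≤m , suc-injective (trans (dropped t v i<t t≤j at-i at-j) deg-t) ,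
            ≤-pred (≤-trans (≤-reflexive (dropped m v i<m m≤j at-i at-j)) deg-m) ,
            ≤-trans (lowOthers-between m v i<m m≤j at-i) (s≤s others))
          (trans (moved v) at-i)
          where
          m≤j : m ≤ j
          m≤j = ≤-trans (≤-pred m<m₁) m₁≤j
          i<m : i < m
          i<m = <-≤-trans i<t (≤-trans t≤m₀ m₀≤m)
          t≤j : t ≤ j
          t≤j = ≤-trans (≤-trans t≤m₀ m₀≤m) m≤j
          open Moved π∈ (<-≤-trans i<t t≤j) (∈-upTo⁻ j∈)

  -- At the least witnessing time all the other late vertices are still of degree below k.
  few-late : ∀ c x → c < k → ∀ π → ∑ (vertices n) (λ v → χ (late? 0 c x π v)) ≤ suc x
  few-late c x c<k π = bound (1 ≤? ∑ V (λ v → χ (late? 0 c x π v)))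
    where
    open ≤-Reasoning
    V = vertices n
    Earliest : Set
    Earliest = ∃ λ l → (∃ λ w → At 0 c x π w l) × (∀ {m} → (∃ λ v → At 0 c x π v m) → l ≤ m)
    from-earliest : Earliest → ∑ V (λ v → χ (late? 0 c x π v)) ≤ suc x
    from-earliest (l , (w , (_ , _ , _ , others)) , minimal) = begin
      ∑ V (λ v → χ (late? 0 c x π v)) ≤⟨ ∑-mono V (λ v _ → χ-≤ (late? 0 c x π v) (counted v)) ⟩
      ∑ V (λ v → χ (w ≟F v) * 1 + χ (¬? (w ≟F v)) * low k (take l π) v) ≡⟨ ∑-+ V _ _ ⟩
      ∑ V (λ v → χ (w ≟F v) * 1) + lowOthers k (take l π) w ≡⟨ cong (_+ lowOthers k (take l π) w) (∑-vertex w (λ _ → 1)) ⟩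
      suc (lowOthers k (take l π) w) ≤⟨ s≤s others ⟩
      suc x ∎
      where
      counted : ∀ v → Late 0 c x π v → 1 ≤ χ (w ≟F v) * 1 + χ (¬? (w ≟F v)) * low k (take l π) v
      counted v (m , _ , atm@(_ , _ , deg-m , _)) with w ≟F v
      ... | yes _ = s≤s z≤n
      ... | no _ = ≤-reflexive (sym (trans (+-identityʳ _) (χ-yes (degree (take l π) v <? k)
        (≤-<-trans (≤-trans (degree-take-mono π v (minimal (v , atm))) deg-m) c<k))))
    bound : Dec (1 ≤ ∑ V (λ v → χ (late? 0 c x π v))) → ∑ V (λ v → χ (late? 0 c x π v)) ≤ suc x
    bound (no none) = ≤-trans (≤-pred (≰⇒> none)) z≤n
    bound (yes some) = from-positive (∑-positive V (λ v → χ (late? 0 c x π v)) some)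
      where
      from-witness : ∀ v → Late 0 c x π v → Earliest
      from-witness v (m , _ , atm) = least (λ m → Fin.any? (λ v → at? 0 c x π v m)) m (v , atm)
      from-positive : (∃ λ v → v ∈ V × 1 ≤ χ (late? 0 c x π v)) → ∑ V (λ v → χ (late? 0 c x π v)) ≤ suc x
      from-positive (v , _ , pos) = from-earliest (from-witness v (χ-pos (late? 0 c x π v) pos))

  -- After `d` outward switches `v` has no early edges and at most `x + d` other vertices are low,
  -- so `few-late` applies.
  late-outside : ∀ d c x → c < k →
    (N ∸ (m₁ + (n ∸ 1))) ^ d * #late d c x ≤ (t * (n ∸ 1)) ^ d * (totalOrders n * suc (x + d))
  late-outside zero c x c<k = *-monoʳ-≤ 1 (≤-trans (∑-≤-const (orders n) (suc x) (λ π _ → few-late c x c<k π))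
    (≤-reflexive (cong (λ y → totalOrders n * suc y) (sym (+-identityʳ x)))))
  late-outside (suc d) c x c<k = begin
    a * a ^ d * #late (suc d) c x ≡⟨ *-swap-assoc a (a ^ d) _ ⟩
    a ^ d * (a * #late (suc d) c x) ≤⟨ *-monoʳ-≤ (a ^ d) (switch-outside d c x) ⟩
    a ^ d * (b * #late d c (suc x)) ≡⟨ *-left-comm (a ^ d) b _ ⟩
    b * (a ^ d * #late d c (suc x)) ≤⟨ *-monoʳ-≤ b (late-outside d c (suc x) c<k) ⟩
    b * (b ^ d * (totalOrders n * suc (suc x + d))) ≡⟨ *-assoc b (b ^ d) _ ⟨
    b * b ^ d * (totalOrders n * suc (suc x + d)) ≡⟨ cong (λ y → b * b ^ d * (totalOrders n * suc y)) (+-suc x d) ⟨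
    b * b ^ d * (totalOrders n * suc (x + suc d)) ∎
    where
    open ≤-Reasoning
    a = N ∸ (m₁ + (n ∸ 1))
    b = t * (n ∸ 1)

  -- One inward switch supplies the small factor. For `c` equal to k - 2 a second one is not
  -- affordable: `few-late` asks for fewer than `k` edges in the window.
  late-rare : ∀ d c → suc c < k →
    (m₀ ∸ (t + c)) * ((N ∸ (m₁ + (n ∸ 1))) ^ d * #late (suc d) c 0) ≤ t * suc c * ((t * (n ∸ 1)) ^ d * (totalOrders n * suc d))
  late-rare d c c<k = begin
    a₁ * (a ^ d * #late (suc d) c 0) ≡⟨ *-left-comm a₁ (a ^ d) _ ⟩
    a ^ d * (a₁ * #late (suc d) c 0) ≤⟨ *-monoʳ-≤ (a ^ d) (switch-inside d c 0) ⟩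
    a ^ d * (t * suc c * #late d (suc c) 0) ≡⟨ *-left-comm (a ^ d) (t * suc c) _ ⟩
    t * suc c * (a ^ d * #late d (suc c) 0) ≤⟨ *-monoʳ-≤ (t * suc c) (late-outside d (suc c) 0 c<k) ⟩
    t * suc c * ((t * (n ∸ 1)) ^ d * (totalOrders n * suc d)) ∎
    where
    open ≤-Reasoning
    a₁ = m₀ ∸ (t + c)
    a = N ∸ (m₁ + (n ∸ 1))

-- Online play

-- Invariants of play are preserved when an edge is appended on the right, while lists are taken
-- apart from the left.
extend : ∀ {A : Set} {P : List A → Set} {Q : A → Set} → (∀ g x → Q x → P g → P (g ∷ʳ x)) →
  ∀ h es → (∀ {x} → x ∈ es → Q x) → P h → P (h ++ es)
extend {P = P} step h [] q p = subst P (sym (++-identityʳ h)) p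
extend {P = P} step h (x ∷ es) q p =
  subst P (++-assoc h [ x ] es) (extend {P = P} step (h ∷ʳ x) es (q ∘ there) (step h x (q (here refl)) p))

-- A rule may also consult the edges bought so far. They are determined by the history, so
-- `strategy` recovers them by replaying it.
Rule : ℕ → Set
Rule n = List (Edge n) → List (Edge n) → Edge n → Bool

play : Rule n → List (Edge n) → List (Edge n) → List (Edge n) → List (Edge n)
play ρ seen b [] = b
play ρ seen b (x ∷ es) = play ρ (seen ∷ʳ x) (if ρ seen b x then b ∷ʳ x else b) es

play-∷ʳ : ∀ (ρ : Rule n) seen b es x → play ρ seen b (es ∷ʳ x) ≡
  (if ρ (seen ++ es) (play ρ seen b es) x then play ρ seen b es ∷ʳ x else play ρ seen b es)
play-∷ʳ ρ seen b [] x = cong (λ s → if ρ s b x then b ∷ʳ x else b) (sym (++-identityʳ seen))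
play-∷ʳ ρ seen b (y ∷ es) x = trans (play-∷ʳ ρ (seen ∷ʳ y) b′ es x)
  (cong (λ s → if ρ s (play ρ (seen ∷ʳ y) b′ es) x then play ρ (seen ∷ʳ y) b′ es ∷ʳ x else play ρ (seen ∷ʳ y) b′ es)
    (++-assoc seen [ y ] es))
  where
  b′ = if ρ seen b y then b ∷ʳ y else b

strategy : Rule n → Strategy n
strategy ρ seen x = ρ seen (play ρ [] [] seen) x

run-strategy : ∀ (ρ : Rule n) π → run (strategy ρ) π ≡ play ρ [] [] π
run-strategy {n} ρ π = sym (go [] π)
  where
  go : ∀ seen es → play ρ seen (play ρ [] [] seen) es ≡ play ρ [] [] seen ++ runAux (strategy ρ) seen es
  go seen [] = sym (++-identityʳ _)
  go seen (x ∷ es) with ρ seen (play ρ [] [] seen) x in eq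
  ... | true = trans (cong (λ b → play ρ (seen ∷ʳ x) b es) (sym now))
                 (trans (go (seen ∷ʳ x) es) (trans (cong (_++ runAux (strategy ρ) (seen ∷ʳ x) es) now) (++-assoc _ [ x ] _)))
    where
    now : play ρ [] [] (seen ∷ʳ x) ≡ play ρ [] [] seen ∷ʳ x
    now = trans (play-∷ʳ ρ [] [] seen x) (cong (λ c → if c then play ρ [] [] seen ∷ʳ x else play ρ [] [] seen) eq)
  ... | false = trans (cong (λ b → play ρ (seen ∷ʳ x) b es) (sym now))
                  (trans (go (seen ∷ʳ x) es) (cong (_++ runAux (strategy ρ) (seen ∷ʳ x) es) now))
    where
    now : play ρ [] [] (seen ∷ʳ x) ≡ play ρ [] [] seen
    now = trans (play-∷ʳ ρ [] [] seen x) (cong (λ c → if c then play ρ [] [] seen ∷ʳ x else play ρ [] [] seen) eq)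

-- The budget has to hold for every sequence of edges and not only with high probability; the cap
-- enforces this.
capped : (ℕ → Bool) → Rule n → Rule n
capped fits ρ seen b x = fits (suc (length b)) ∧ ρ seen b x

length-∷ʳ : ∀ (xs : List A) x → length (xs ∷ʳ x) ≡ suc (length xs)
length-∷ʳ xs x = trans (length-++ xs) (+-comm (length xs) 1)

play-capped-fits : ∀ (fits : ℕ → Bool) (ρ : Rule n) seen b es → fits (length b) ≡ true →
  fits (length (play (capped fits ρ) seen b es)) ≡ true
play-capped-fits fits ρ seen b [] ok = ok
play-capped-fits fits ρ seen b (x ∷ es) ok = play-capped-fits fits ρ (seen ∷ʳ x) _ es still
  where
  still : fits (length (if capped fits ρ seen b x then b ∷ʳ x else b)) ≡ true
  still with fits (suc (length b)) in eq | ρ seen b x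
  ... | true | true = trans (cong fits (length-∷ʳ b x)) eq
  ... | true | false = ok
  ... | false | _ = ok

play-length : ∀ (ρ : Rule n) seen b es → length b ≤ length (play ρ seen b es)
play-length ρ seen b [] = ≤-refl
play-length ρ seen b (x ∷ es) with ρ seen b x
... | true = ≤-trans (≤-trans (n≤1+n _) (≤-reflexive (sym (length-∷ʳ b x)))) (play-length ρ (seen ∷ʳ x) (b ∷ʳ x) es)
... | false = play-length ρ (seen ∷ʳ x) b es

-- Play that ends within the budget was within it throughout, so the cap never acted.
play-capped : ∀ (fits : ℕ → Bool) → (∀ {a b} → a ≤ b → fits b ≡ true → fits a ≡ true) →
  ∀ (ρ : Rule n) seen b es → fits (length (play ρ seen b es)) ≡ true → play (capped fits ρ) seen b es ≡ play ρ seen b es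
play-capped fits down ρ seen b [] ok = refl
play-capped fits down ρ seen b (x ∷ es) ok with ρ seen b x | fits (suc (length b)) in eq
... | true | true = play-capped fits down ρ (seen ∷ʳ x) (b ∷ʳ x) es ok
... | false | true = play-capped fits down ρ (seen ∷ʳ x) b es ok
... | false | false = play-capped fits down ρ (seen ∷ʳ x) b es ok
... | true | false = contradiction (trans (sym eq)
  (down (≤-trans (≤-reflexive (sym (length-∷ʳ b x))) (play-length ρ (seen ∷ʳ x) (b ∷ʳ x) es)) ok)) (λ ())

inc⇒end : ∀ (x : Edge n) v → inc x v ≡ 1 → proj₁ x ≡ v ⊎ proj₂ x ≡ v
inc⇒end (i , j) v eq with i ≟F v | j ≟F v
... | yes p | _ = inj₁ p
... | no _ | yes q = inj₂ q

symmetric-inc : ∀ (x : Edge n) → Proper x → (f : Fin n → ℕ) → (∀ v → f v ≤ 1) →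
  symmetric f f x ≤ ∑ (vertices n) (λ v → inc x v * f v)
symmetric-inc x p f f≤1 = ≤-trans (+-mono-≤ (bound (f (proj₁ x)) (f≤1 _)) (bound (f (proj₂ x)) (f≤1 _)))
  (≤-reflexive (sym (∑-inc x p f)))
  where
  bound : ∀ a {b} → b ≤ 1 → a * b ≤ a
  bound a {b} b≤1 = subst (a * b ≤_) (*-identityʳ a) (*-monoʳ-≤ a b≤1)

-- `D`, `I`, `F`, `U` stand for deficient, isolated, full and urgent ends. Two deficient ends give
-- two units. A single one gives one; the second comes from its urgency or, for a first edge, from
-- the other end, which is full because it is not deficient.
two-units : {D D′ I I′ F F′ U U′ : Set} (d : Dec D) (d′ : Dec D′) (i : Dec I) (i′ : Dec I′)
  (f : Dec F) (f′ : Dec F′) (u : Dec U) (u′ : Dec U′) →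
  (I → D) → (I′ → D′) → (¬ D → F) → (¬ D′ → F′) → (D × D′) ⊎ (I ⊎ D × U) ⊎ (I′ ⊎ D′ × U′) →
  2 ≤ (χ d + χ d′) + (χ i * χ f′ + χ i′ * χ f) + (χ d * χ u + χ d′ * χ u′)
two-units (yes _) (yes _) _ _ _ _ _ _ _ _ _ _ _ = s≤s (s≤s z≤n)
two-units (no ¬d) d′ i i′ f f′ u u′ I⇒D I′⇒D′ ¬D⇒F _ (inj₁ (p , _)) = ⊥-elim (¬d p)
two-units (no ¬d) d′ i i′ f f′ u u′ I⇒D I′⇒D′ ¬D⇒F _ (inj₂ (inj₁ (inj₁ p))) = ⊥-elim (¬d (I⇒D p))
two-units (no ¬d) d′ i i′ f f′ u u′ I⇒D I′⇒D′ ¬D⇒F _ (inj₂ (inj₁ (inj₂ (p , _)))) = ⊥-elim (¬d p)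
two-units (no ¬d) d′ i i′ f f′ u u′ I⇒D I′⇒D′ ¬D⇒F _ (inj₂ (inj₂ (inj₁ p)))
  rewrite χ-yes d′ (I′⇒D′ p) | χ-yes i′ p | χ-yes f (¬D⇒F ¬d) | +-comm (χ i * χ f′) 1 = s≤s (s≤s z≤n)
two-units (no ¬d) d′ i i′ f f′ u u′ I⇒D I′⇒D′ ¬D⇒F _ (inj₂ (inj₂ (inj₂ (p , q))))
  rewrite χ-yes d′ p | χ-yes u′ q = s≤s (m≤n+m 1 (χ i * χ f′ + χ i′ * χ f))
two-units (yes _) (no ¬d′) i i′ f f′ u u′ _ I′⇒D′ _ ¬D′⇒F′ (inj₁ (_ , p)) = ⊥-elim (¬d′ p)
two-units (yes _) (no ¬d′) i i′ f f′ u u′ _ I′⇒D′ _ ¬D′⇒F′ (inj₂ (inj₁ (inj₁ p)))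
  rewrite χ-yes i p | χ-yes f′ (¬D′⇒F′ ¬d′) = s≤s (s≤s z≤n)
two-units (yes _) (no ¬d′) i i′ f f′ u u′ _ I′⇒D′ _ ¬D′⇒F′ (inj₂ (inj₁ (inj₂ (_ , p))))
  rewrite χ-yes u p = s≤s (m≤n+m 1 (χ i * χ f′ + χ i′ * χ f))
two-units (yes _) (no ¬d′) i i′ f f′ u u′ _ I′⇒D′ _ ¬D′⇒F′ (inj₂ (inj₂ (inj₁ p))) = ⊥-elim (¬d′ (I′⇒D′ p))
two-units (yes _) (no ¬d′) i i′ f f′ u u′ _ I′⇒D′ _ ¬D′⇒F′ (inj₂ (inj₂ (inj₂ (p , _)))) = ⊥-elim (¬d′ p)

-- Builder's rule and the edges at a deficient vertex

module Builder (n k t K : ℕ) (1≤k : 1 ≤ k) where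

  private
    V = vertices n
    E = Edge n

  -- The end `v` alone justifies the purchase, whatever the other end is.
  Helps : List E → List E → Fin n → Set
  Helps h b v = degree h v ≡ 0 ⊎ (degree b v < k × (t ≤ length h ⊎ K ≤ degree h v))

  Wanted : List E → List E → E → Set
  Wanted h b (i , j) = (degree b i < k × degree b j < k) ⊎ (Helps h b i ⊎ Helps h b j)

  helps? : ∀ h b v → Dec (Helps h b v)
  helps? h b v = degree h v ≟ 0 ⊎-dec (degree b v <? k ×-dec (t ≤? length h ⊎-dec K ≤? degree h v))

  wanted? : ∀ h b x → Dec (Wanted h b x)
  wanted? h b (i , j) = (degree b i <? k ×-dec degree b j <? k) ⊎-dec (helps? h b i ⊎-dec helps? h b j)

  rule : Rule n
  rule h b x = ⌊ wanted? h b x ⌋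

  bought : List E → List E
  bought = play rule [] []

  Wants : List E → E → Set
  Wants h = Wanted h (bought h)

  wants? : ∀ h x → Dec (Wants h x)
  wants? h = wanted? h (bought h)

  deficient : List E → Fin n → ℕ
  deficient h = low k (bought h)

  #deficient : List E → ℕ
  #deficient h = ∑ V (deficient h)

  buys : ∀ h x → Wants h x → bought (h ∷ʳ x) ≡ bought h ∷ʳ x
  buys h x w = trans (play-∷ʳ rule [] [] h x) (lemma (wants? h x))
    where
    lemma : (d : Dec (Wants h x)) → (if ⌊ d ⌋ then bought h ∷ʳ x else bought h) ≡ bought h ∷ʳ x
    lemma (yes _) = refl
    lemma (no ¬w) = ⊥-elim (¬w w)

  skips : ∀ h x → ¬ Wants h x → bought (h ∷ʳ x) ≡ bought h
  skips h x ¬w = trans (play-∷ʳ rule [] [] h x) (lemma (wants? h x))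
    where
    lemma : (d : Dec (Wants h x)) → (if ⌊ d ⌋ then bought h ∷ʳ x else bought h) ≡ bought h
    lemma (yes w) = ⊥-elim (¬w w)
    lemma (no _) = refl

  bought-degree : ∀ h x → Wants h x → ∀ v → degree (bought (h ∷ʳ x)) v ≡ degree (bought h) v + inc x v
  bought-degree h x w v = trans (cong (λ b → degree b v) (buys h x w)) (degree-∷ʳ (bought h) x v)

  skipped-degree : ∀ h x → ¬ Wants h x → ∀ v → degree (bought (h ∷ʳ x)) v ≡ degree (bought h) v
  skipped-degree h x ¬w v = cong (λ b → degree b v) (skips h x ¬w)

  bought-degree-mono : ∀ h x v → degree (bought h) v ≤ degree (bought (h ∷ʳ x)) v
  bought-degree-mono h x v = by-cases (wants? h x)
    (λ w → ≤-trans (m≤m+n _ (inc x v)) (≤-reflexive (sym (bought-degree h x w v))))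
    (λ ¬w → ≤-reflexive (sym (skipped-degree h x ¬w v)))

  bought-degree≤ : ∀ h v → degree (bought h) v ≤ degree h v
  bought-degree≤ h v = extend {P = λ g → degree (bought g) v ≤ degree g v} {Q = λ _ → ⊤} step [] h (λ _ → tt) z≤n
    where
    step : ∀ g x → ⊤ → degree (bought g) v ≤ degree g v → degree (bought (g ∷ʳ x)) v ≤ degree (g ∷ʳ x) v
    step g x _ ih = by-cases (wants? g x)
      (λ w → subst₂ _≤_ (sym (bought-degree g x w v)) (sym (degree-∷ʳ g x v)) (+-monoˡ-≤ (inc x v) ih))
      (λ ¬w → subst₂ _≤_ (sym (skipped-degree g x ¬w v)) (sym (degree-∷ʳ g x v)) (≤-trans ih (m≤m+n _ (inc x v))))

  bought-⊆ : ∀ h {x} → x ∈ bought h → x ∈ h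
  bought-⊆ h = extend {P = λ g → ∀ {x} → x ∈ bought g → x ∈ g} {Q = λ _ → ⊤} step [] h (λ _ → tt) (λ ())
    where
    step : ∀ g x → ⊤ → (∀ {y} → y ∈ bought g → y ∈ g) → ∀ {y} → y ∈ bought (g ∷ʳ x) → y ∈ g ∷ʳ x
    step g x _ ih {y} y∈ = by-cases (wants? g x)
      (λ w → [ ∈-++⁺ˡ ∘ ih , ∈-++⁺ʳ g ]′ (∈-++⁻ (bought g) (subst (y ∈_) (buys g x w) y∈)))
      (λ ¬w → ∈-++⁺ˡ (ih (subst (y ∈_) (skips g x ¬w) y∈)))

  helps⇒wanted : ∀ h b x v → inc x v ≡ 1 → Helps h b v → Wanted h b x
  helps⇒wanted h b x v at-v help with inc⇒end x v at-v
  ... | inj₁ refl = inj₂ (inj₁ help)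
  ... | inj₂ refl = inj₂ (inj₂ help)

  isolated⇒deficient : ∀ h v → degree h v ≡ 0 → degree (bought h) v < k
  isolated⇒deficient h v d≡0 = ≤-<-trans (≤-trans (bought-degree≤ h v) (≤-reflexive d≡0)) 1≤k

  private
    0∨1 : ∀ {a} → a ≤ 1 → a ≡ 0 ⊎ a ≡ 1
    0∨1 {zero} _ = inj₁ refl
    0∨1 {suc zero} _ = inj₂ refl
    0∨1 {suc (suc a)} (s≤s ())

  -- This gains the one unit by which a failing vertex has at most k - 2, and not k - 1, edges after
  -- time `t`.
  first-edge-bought : ∀ h v → 1 ≤ degree h v → 1 ≤ degree (bought h) v
  first-edge-bought h v = extend {P = P} {Q = λ _ → ⊤} step [] h (λ _ → tt) (λ ())
    where
    P : List E → Set
    P g = 1 ≤ degree g v → 1 ≤ degree (bought g) v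
    step : ∀ g x → ⊤ → P g → P (g ∷ʳ x)
    step g x _ ih 1≤ = by-cases (degree g v ≟ 0)
      (λ d≡0 → [ (λ at-v → ⊥-elim (<⇒≢ 1≤ (sym (trans (degree-∷ʳ g x v) (cong₂ _+_ d≡0 at-v)))))
               , (λ at-v → ≤-trans (≤-reflexive (sym at-v)) (≤-trans (m≤n+m _ (degree (bought g) v))
                   (≤-reflexive (sym (bought-degree g x (helps⇒wanted g (bought g) x v at-v (inj₁ d≡0)) v))))) ]′ (0∨1 (inc≤1 x v)))
      (λ d≢0 → ≤-trans (ih (n≢0⇒n>0 d≢0)) (bought-degree-mono g x v))

  -- A vertex deficient at the end was deficient throughout, hence urgent from time `t` on, and none
  -- of its later edges was refused.
  late-edges-bought : ∀ h es v → t ≤ length h → degree (bought (h ++ es)) v < k →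
    degree (h ++ es) v + degree (bought h) v ≤ degree h v + degree (bought (h ++ es)) v
  late-edges-bought h es v t≤h = proj₂ (extend {P = P} {Q = λ _ → ⊤} step h es (λ _ → tt) (t≤h , λ _ → ≤-refl))
    where
    P : List E → Set
    P g = t ≤ length g × (degree (bought g) v < k → degree g v + degree (bought h) v ≤ degree h v + degree (bought g) v)
    step : ∀ g x → ⊤ → P g → P (g ∷ʳ x)
    step g x _ (t≤g , ih) = ≤-trans t≤g (≤-trans (n≤1+n _) (≤-reflexive (sym (length-∷ʳ g x)))) , next
      where
      open ≤-Reasoning
      next : degree (bought (g ∷ʳ x)) v < k →
        degree (g ∷ʳ x) v + degree (bought h) v ≤ degree h v + degree (bought (g ∷ʳ x)) v
      next def = [ missing , present ]′ (0∨1 (inc≤1 x v))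
        where
        def-g : degree (bought g) v < k
        def-g = ≤-<-trans (bought-degree-mono g x v) def
        rotate : ∀ a b c → a + b + c ≡ a + c + b
        rotate = solve-∀
        missing : inc x v ≡ 0 → degree (g ∷ʳ x) v + degree (bought h) v ≤ degree h v + degree (bought (g ∷ʳ x)) v
        missing at-v = begin
          degree (g ∷ʳ x) v + degree (bought h) v ≡⟨ cong (_+ degree (bought h) v) (trans (degree-∷ʳ g x v) (trans (cong (degree g v +_) at-v) (+-identityʳ _))) ⟩
          degree g v + degree (bought h) v ≤⟨ ih def-g ⟩
          degree h v + degree (bought g) v ≤⟨ +-monoʳ-≤ (degree h v) (bought-degree-mono g x v) ⟩
          degree h v + degree (bought (g ∷ʳ x)) v ∎
        present : inc x v ≡ 1 → degree (g ∷ʳ x) v + degree (bought h) v ≤ degree h v + degree (bought (g ∷ʳ x)) v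
        present at-v = begin
          degree (g ∷ʳ x) v + degree (bought h) v ≡⟨ cong (_+ degree (bought h) v) (degree-∷ʳ g x v) ⟩
          degree g v + inc x v + degree (bought h) v ≡⟨ rotate (degree g v) (inc x v) (degree (bought h) v) ⟩
          degree g v + degree (bought h) v + inc x v ≤⟨ +-monoˡ-≤ (inc x v) (ih def-g) ⟩
          degree h v + degree (bought g) v + inc x v ≡⟨ +-assoc (degree h v) _ _ ⟩
          degree h v + (degree (bought g) v + inc x v)
            ≡⟨ cong (degree h v +_) (bought-degree g x (helps⇒wanted g (bought g) x v at-v (inj₂ (def-g , inj₁ t≤g))) v) ⟨
          degree h v + degree (bought (g ∷ʳ x)) v ∎

  -- An edge at a deficient vertex is refused only while fewer than `K` edges have been seen there.
  missed-edges : ∀ h v → degree (bought h) v < k → degree h v ≤ K + degree (bought h) v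
  missed-edges h v = extend {P = P} {Q = λ _ → ⊤} step [] h (λ _ → tt) (λ _ → z≤n)
    where
    open ≤-Reasoning
    P : List E → Set
    P g = degree (bought g) v < k → degree g v ≤ K + degree (bought g) v
    step : ∀ g x → ⊤ → P g → P (g ∷ʳ x)
    step g x _ ih def = by-cases (wants? g x) bought-case (λ ¬w → [ missing ¬w , present ¬w ]′ (0∨1 (inc≤1 x v)))
      where
      def-g : degree (bought g) v < k
      def-g = ≤-<-trans (bought-degree-mono g x v) def
      bought-case : Wants g x → degree (g ∷ʳ x) v ≤ K + degree (bought (g ∷ʳ x)) v
      bought-case w = begin
        degree (g ∷ʳ x) v ≡⟨ degree-∷ʳ g x v ⟩
        degree g v + inc x v ≤⟨ +-monoˡ-≤ (inc x v) (ih def-g) ⟩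
        K + degree (bought g) v + inc x v ≡⟨ +-assoc K _ _ ⟩
        K + (degree (bought g) v + inc x v) ≡⟨ cong (K +_) (bought-degree g x w v) ⟨
        K + degree (bought (g ∷ʳ x)) v ∎
      missing : ¬ Wants g x → inc x v ≡ 0 → degree (g ∷ʳ x) v ≤ K + degree (bought (g ∷ʳ x)) v
      missing ¬w at-v = begin
        degree (g ∷ʳ x) v ≡⟨ trans (degree-∷ʳ g x v) (trans (cong (degree g v +_) at-v) (+-identityʳ _)) ⟩
        degree g v ≤⟨ ih def-g ⟩
        K + degree (bought g) v ≤⟨ +-monoʳ-≤ K (bought-degree-mono g x v) ⟩
        K + degree (bought (g ∷ʳ x)) v ∎
      present : ¬ Wants g x → inc x v ≡ 1 → degree (g ∷ʳ x) v ≤ K + degree (bought (g ∷ʳ x)) v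
      present ¬w at-v = begin
        degree (g ∷ʳ x) v ≡⟨ trans (degree-∷ʳ g x v) (trans (cong (degree g v +_) at-v) (+-comm _ 1)) ⟩
        suc (degree g v) ≤⟨ ≰⇒> (λ K≤ → ¬w (helps⇒wanted g (bought g) x v at-v (inj₂ (def-g , inj₂ K≤)))) ⟩
        K ≤⟨ m≤m+n K _ ⟩
        K + degree (bought (g ∷ʳ x)) v ∎

  -- The number of purchases

  fill : List E → Fin n → ℕ
  fill h v = k ⊓ degree (bought h) v

  #fill : List E → ℕ
  #fill h = ∑ V (fill h)

  heavy : List E → Fin n → ℕ
  heavy h v = χ (K ≤? degree h v)

  #heavy : List E → ℕ
  #heavy h = ∑ V (heavy h)

  #deficientEnds : List E → E → ℕ
  #deficientEnds h x = ∑ V (λ v → inc x v * deficient h v)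

  private
    ⊓-step : ∀ b c → c ≤ 1 → k ⊓ (b + c) ≡ k ⊓ b + c * χ (b <? k)
    ⊓-step b c c≤1 with b <? k
    ... | yes b<k = trans (m≥n⇒m⊓n≡n (≤-trans (+-monoʳ-≤ b c≤1) (≤-trans (≤-reflexive (+-comm b 1)) b<k)))
                      (cong₂ _+_ (sym (m≥n⇒m⊓n≡n (<⇒≤ b<k))) (sym (*-identityʳ c)))
    ... | no b≮k = trans (m≤n⇒m⊓n≡m (≤-trans (≮⇒≥ b≮k) (m≤m+n b c)))
                     (trans (sym (m≤n⇒m⊓n≡m (≮⇒≥ b≮k))) (sym (trans (cong (k ⊓ b +_) (*-zeroʳ c)) (+-identityʳ _))))

    ∸-step : ∀ b c → c ≤ 1 → (k ∸ (b + c)) + c * χ (b <? k) ≡ k ∸ b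
    ∸-step b zero _ = trans (+-identityʳ _) (cong (k ∸_) (+-identityʳ b))
    ∸-step b (suc (suc c)) (s≤s ())
    ∸-step b (suc zero) _ with b <? k
    ... | yes b<k = trans (cong (λ a → (k ∸ a) + 1) (+-comm b 1)) (trans (+-comm _ 1) (sym (+-∸-assoc 1 b<k)))
    ... | no b≮k = trans (+-identityʳ _) (trans (m≤n⇒m∸n≡0 (≤-trans (≮⇒≥ b≮k) (m≤m+n b 1))) (sym (m≤n⇒m∸n≡0 (≮⇒≥ b≮k))))

  fill-bought : ∀ h x → Wants h x → ∀ v → fill (h ∷ʳ x) v ≡ fill h v + inc x v * deficient h v
  fill-bought h x w v = trans (cong (k ⊓_) (bought-degree h x w v)) (⊓-step (degree (bought h) v) (inc x v) (inc≤1 x v))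

  #fill-bought : ∀ h x → Wants h x → #fill (h ∷ʳ x) ≡ #fill h + #deficientEnds h x
  #fill-bought h x w = trans (∑-cong V (λ v _ → fill-bought h x w v)) (∑-+ V _ _)

  fill-skipped : ∀ h x → ¬ Wants h x → ∀ v → fill (h ∷ʳ x) v ≡ fill h v
  fill-skipped h x ¬w v = cong (k ⊓_) (skipped-degree h x ¬w v)

  fill-mono : ∀ h x v → fill h v ≤ fill (h ∷ʳ x) v
  fill-mono h x v = ⊓-monoʳ-≤ k (bought-degree-mono h x v)

  fill≤ : ∀ h v → fill h v ≤ k
  fill≤ h v = m⊓n≤m k _

  heavy-mono : ∀ h x v → heavy h v ≤ heavy (h ∷ʳ x) v
  heavy-mono h x v = χ-mono (K ≤? degree h v) (K ≤? degree (h ∷ʳ x) v)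
    (λ K≤ → ≤-trans K≤ (≤-trans (m≤m+n _ (inc x v)) (≤-reflexive (sym (degree-∷ʳ h x v)))))

  private
    heavyFill : List E → ℕ
    heavyFill h = ∑ V (λ v → heavy h v * fill h v)

    heavyFill-bought : ∀ h x → Wants h x →
      heavyFill h + ∑ V (λ v → inc x v * (deficient h v * heavy h v)) ≤ heavyFill (h ∷ʳ x)
    heavyFill-bought h x w = begin
      heavyFill h + ∑ V (λ v → inc x v * (deficient h v * heavy h v)) ≡⟨ ∑-+ V _ _ ⟨
      ∑ V (λ v → heavy h v * fill h v + inc x v * (deficient h v * heavy h v)) ≡⟨ ∑-cong V (λ v _ → regroup (heavy h v) (fill h v) (inc x v) (deficient h v)) ⟩
      ∑ V (λ v → heavy h v * (fill h v + inc x v * deficient h v)) ≡⟨ ∑-cong V (λ v _ → cong (heavy h v *_) (sym (fill-bought h x w v))) ⟩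
      ∑ V (λ v → heavy h v * fill (h ∷ʳ x) v) ≤⟨ ∑-mono V (λ v _ → *-monoˡ-≤ (fill (h ∷ʳ x) v) (heavy-mono h x v)) ⟩
      heavyFill (h ∷ʳ x) ∎
      where
      open ≤-Reasoning
      regroup : ∀ a b c d → a * b + c * (d * a) ≡ a * (b + c * d)
      regroup = solve-∀

    -- Every purchase before time t is paid for twice: by the deficient ends, by the isolated end of
    -- a wasted edge, or by the heavy deficient end.
    paid-twice : ∀ h x → Proper x → length h < t → Wants h x →
      2 ≤ #deficientEnds h x + wasteful k h x + ∑ V (λ v → inc x v * (deficient h v * heavy h v))
    paid-twice h x@(i , j) p h<t w = subst₂ (λ a b → 2 ≤ a + wasteful k h x + b)
      (sym (∑-inc x p (deficient h))) (sym (∑-inc x p (λ v → deficient h v * heavy h v)))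
      (two-units (degree (bought h) i <? k) (degree (bought h) j <? k) (degree h i ≟ 0) (degree h j ≟ 0)
        (k ≤? degree h i) (k ≤? degree h j) (K ≤? degree h i) (K ≤? degree h j)
        (isolated⇒deficient h i) (isolated⇒deficient h j) (saturated i) (saturated j) (reason w))
      where
      saturated : ∀ v → ¬ (degree (bought h) v < k) → k ≤ degree h v
      saturated v ¬def = ≤-trans (≮⇒≥ ¬def) (bought-degree≤ h v)
      early : ∀ v → Helps h (bought h) v → degree h v ≡ 0 ⊎ (degree (bought h) v < k × K ≤ degree h v)
      early v (inj₁ iso) = inj₁ iso
      early v (inj₂ (def , inj₁ t≤h)) = ⊥-elim (<⇒≱ h<t t≤h)
      early v (inj₂ (def , inj₂ K≤)) = inj₂ (def , K≤)
      reason : Wants h x → _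
      reason (inj₁ both) = inj₁ both
      reason (inj₂ (inj₁ help)) = inj₂ (inj₁ (early i help))
      reason (inj₂ (inj₂ help)) = inj₂ (inj₂ (early j help))

  -- `fill` counts the bought edges that found the vertex deficient, so deficient ends contribute at
  -- most n k in all. Waste and heavy vertices supply the second unit of the other purchases.
  purchases-early : ∀ h → (∀ {x} → x ∈ h → Proper x) → length h ≤ t →
    2 * length (bought h) ≤ n * k + waste k h + k * #heavy h
  purchases-early h proper h≤t = ≤-trans (extend {P = P} {Q = Proper} step [] h proper (λ _ → z≤n) h≤t)
    (+-mono-≤ (+-monoˡ-≤ (waste k h) (∑-vertices≤ (fill h) k (fill≤ h)))
      (≤-trans (∑-mono V (λ v _ → *-monoʳ-≤ (heavy h v) (fill≤ h v)))
        (≤-reflexive (trans (∑-*ʳ V (heavy h) k) (*-comm _ k)))))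
    where
    open ≤-Reasoning
    P : List E → Set
    P g = length g ≤ t → 2 * length (bought g) ≤ #fill g + waste k g + heavyFill g
    step : ∀ g x → Proper x → P g → P (g ∷ʳ x)
    step g x p ih gx≤t = cases (wants? g x)
      where
      g<t : length g < t
      g<t = ≤-trans (≤-reflexive (sym (length-∷ʳ g x))) gx≤t
      H = ∑ V (λ v → inc x v * (deficient g v * heavy g v))
      cases : Dec (Wants g x) → 2 * length (bought (g ∷ʳ x)) ≤ #fill (g ∷ʳ x) + waste k (g ∷ʳ x) + heavyFill (g ∷ʳ x)
      cases (yes w) = begin
        2 * length (bought (g ∷ʳ x)) ≡⟨ cong (2 *_) (trans (cong length (buys g x w)) (length-∷ʳ (bought g) x)) ⟩
        2 * suc (length (bought g)) ≡⟨ *-suc 2 _ ⟩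
        2 + 2 * length (bought g) ≤⟨ +-mono-≤ (paid-twice g x p g<t w) (ih (<⇒≤ g<t)) ⟩
        (#deficientEnds g x + wasteful k g x + H) + (#fill g + waste k g + heavyFill g)
          ≡⟨ regroup (#deficientEnds g x) (wasteful k g x) H (#fill g) (waste k g) (heavyFill g) ⟩
        (#fill g + #deficientEnds g x) + (waste k g + wasteful k g x) + (heavyFill g + H)
          ≤⟨ +-mono-≤ (≤-reflexive (cong₂ _+_ (sym (#fill-bought g x w)) (sym (waste-∷ʳ k g x)))) (heavyFill-bought g x w) ⟩
        #fill (g ∷ʳ x) + waste k (g ∷ʳ x) + heavyFill (g ∷ʳ x) ∎
        where
        regroup : ∀ a b c d e f → (a + b + c) + (d + e + f) ≡ (d + a) + (e + b) + (f + c)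
        regroup = solve-∀
      cases (no ¬w) = begin
        2 * length (bought (g ∷ʳ x)) ≡⟨ cong (λ b → 2 * length b) (skips g x ¬w) ⟩
        2 * length (bought g) ≤⟨ ih (<⇒≤ g<t) ⟩
        #fill g + waste k g + heavyFill g ≤⟨ +-mono-≤ (+-mono-≤ (∑-mono V (λ v _ → fill-mono g x v))
              (≤-trans (m≤m+n _ (wasteful k g x)) (≤-reflexive (sym (waste-∷ʳ k g x)))))
              (∑-mono V (λ v _ → *-mono-≤ (heavy-mono g x v) (fill-mono g x v))) ⟩
        #fill (g ∷ʳ x) + waste k (g ∷ʳ x) + heavyFill (g ∷ʳ x) ∎

  private
    wanted⇒deficient : ∀ h x → Proper x → Wants h x → 1 ≤ #deficientEnds h x
    wanted⇒deficient h (i , j) p w = subst (1 ≤_) (sym (∑-inc (i , j) p (deficient h))) (one w)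
      where
      def : ∀ v → Helps h (bought h) v → 1 ≤ deficient h v
      def v (inj₁ iso) = ≤-reflexive (sym (χ-yes (degree (bought h) v <? k) (isolated⇒deficient h v iso)))
      def v (inj₂ (d , _)) = ≤-reflexive (sym (χ-yes (degree (bought h) v <? k) d))
      one : Wants h (i , j) → 1 ≤ deficient h i + deficient h j
      one (inj₁ (d , _)) = ≤-trans (≤-reflexive (sym (χ-yes (degree (bought h) i <? k) d))) (m≤m+n _ (deficient h j))
      one (inj₂ (inj₁ help)) = ≤-trans (def i help) (m≤m+n _ (deficient h j))
      one (inj₂ (inj₂ help)) = ≤-trans (def j help) (m≤n+m _ (deficient h i))

  -- Each purchase raises the fill of some deficient end, and after `h` only vertices deficient in
  -- `h` can gain, each at most `k`.
  purchases-late : ∀ h es → (∀ {x} → x ∈ es → Proper x) →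
    length (bought (h ++ es)) ≤ length (bought h) + k * #deficient h
  purchases-late h es proper = +-cancelʳ-≤ (#fill h) _ _ (begin
    length (bought (h ++ es)) + #fill h ≤⟨ extend {P = P} {Q = Proper} step h es proper ≤-refl ⟩
    length (bought h) + #fill (h ++ es) ≤⟨ +-monoʳ-≤ (length (bought h)) (∑-mono V (λ v _ → remaining v)) ⟩
    length (bought h) + ∑ V (λ v → k * deficient h v + fill h v)
      ≡⟨ cong (length (bought h) +_) (trans (∑-+ V _ _) (cong (_+ #fill h) (∑-*ˡ V k (deficient h)))) ⟩
    length (bought h) + (k * #deficient h + #fill h) ≡⟨ +-assoc (length (bought h)) _ _ ⟨
    length (bought h) + k * #deficient h + #fill h ∎)
    where
    open ≤-Reasoning
    remaining : ∀ v → fill (h ++ es) v ≤ k * deficient h v + fill h v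
    remaining v = lemma (degree (bought h) v <? k)
      where
      lemma : (d : Dec (degree (bought h) v < k)) → fill (h ++ es) v ≤ k * χ d + fill h v
      lemma (yes _) = ≤-trans (fill≤ (h ++ es) v) (≤-trans (≤-reflexive (sym (*-identityʳ k))) (m≤m+n (k * 1) (fill h v)))
      lemma (no ¬def) = ≤-trans (fill≤ (h ++ es) v)
        (≤-trans (≤-reflexive (sym (m≤n⇒m⊓n≡m (≮⇒≥ ¬def)))) (m≤n+m (fill h v) (k * 0)))
    P : List E → Set
    P g = length (bought g) + #fill h ≤ length (bought h) + #fill g
    step : ∀ g x → Proper x → P g → P (g ∷ʳ x)
    step g x p ih = cases (wants? g x)
      where
      cases : Dec (Wants g x) → length (bought (g ∷ʳ x)) + #fill h ≤ length (bought h) + #fill (g ∷ʳ x)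
      cases (yes w) = begin
        length (bought (g ∷ʳ x)) + #fill h ≡⟨ cong (_+ #fill h) (trans (cong length (buys g x w)) (length-∷ʳ (bought g) x)) ⟩
        1 + (length (bought g) + #fill h) ≤⟨ +-mono-≤ (wanted⇒deficient g x p w) ih ⟩
        #deficientEnds g x + (length (bought h) + #fill g) ≡⟨ rotate (#deficientEnds g x) (length (bought h)) (#fill g) ⟩
        length (bought h) + (#fill g + #deficientEnds g x) ≡⟨ cong (length (bought h) +_) (#fill-bought g x w) ⟨
        length (bought h) + #fill (g ∷ʳ x) ∎
        where
        rotate : ∀ a b c → a + (b + c) ≡ b + (c + a)
        rotate = solve-∀
      cases (no ¬w) = begin
        length (bought (g ∷ʳ x)) + #fill h ≡⟨ cong (λ b → length b + #fill h) (skips g x ¬w) ⟩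
        length (bought g) + #fill h ≤⟨ ih ⟩
        length (bought h) + #fill g ≡⟨ cong (length (bought h) +_) (∑-cong V (λ v _ → fill-skipped g x ¬w v)) ⟨
        length (bought h) + #fill (g ∷ʳ x) ∎

  -- Markov's inequality for the degrees.
  heavy-count : ∀ h → (∀ {x} → x ∈ h → Proper x) → K * #heavy h ≤ 2 * length h
  heavy-count h proper = begin
    K * #heavy h ≡⟨ ∑-*ˡ V K (heavy h) ⟨
    ∑ V (λ v → K * heavy h v) ≤⟨ ∑-mono V (λ v _ → pointwise v) ⟩
    ∑ V (λ v → degree h v * 1) ≡⟨ ∑-degree-weighted h (λ _ → 1) ⟨
    ∑ h (λ x → ∑ V (λ v → inc x v * 1)) ≤⟨ ∑-≤-const h 2 (λ x x∈ → ∑-inc≤ x (proper x∈) (λ _ → 1) 1 (λ _ → ≤-refl)) ⟩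
    length h * 2 ≡⟨ *-comm (length h) 2 ⟩
    2 * length h ∎
    where
    open ≤-Reasoning
    pointwise : ∀ v → K * heavy h v ≤ degree h v * 1
    pointwise v = lemma (degree h v) (K ≤? degree h v)
      where
      lemma : ∀ d (p : Dec (K ≤ d)) → K * χ p ≤ d * 1
      lemma d (yes K≤) = *-monoˡ-≤ 1 K≤
      lemma d (no _) = ≤-trans (≤-reflexive (*-zeroʳ K)) z≤n

  -- The deficient vertices shrink quickly: an unseen edge inside the deficient set is always bought,
  -- and few edges inside it have been seen.

  deficit : List E → ℕ
  deficit h = ∑ V (λ v → k ∸ degree (bought h) v)

  deficient-anti : ∀ h x v → deficient (h ∷ʳ x) v ≤ deficient h v
  deficient-anti h x v = χ-mono (degree (bought (h ∷ʳ x)) v <? k) (degree (bought h) v <? k) (≤-<-trans (bought-degree-mono h x v))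

  deficient≤1 : ∀ h v → deficient h v ≤ 1
  deficient≤1 h v = low≤1 k (bought h) v

  private
    unwanted : ∀ h x → ¬ Wants h x → deficient h (proj₁ x) * deficient h (proj₂ x) ≡ 0
    unwanted h (i , j) ¬w = lemma (degree (bought h) i <? k) (degree (bought h) j <? k)
      where
      lemma : (d : Dec (degree (bought h) i < k)) (d′ : Dec (degree (bought h) j < k)) → χ d * χ d′ ≡ 0
      lemma (yes d) (yes d′) = ⊥-elim (¬w (inj₁ (d , d′)))
      lemma (yes _) (no _) = refl
      lemma (no _) _ = refl

  -- A bought edge lowers the deficit by its number of deficient ends; a refused one does not have
  -- two of them, so its symmetric term vanishes.
  deficit-step : ∀ h x → Proper x → deficit (h ∷ʳ x) + symmetric (deficient h) (deficient h) x ≤ deficit h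
  deficit-step h x p = cases (wants? h x)
    where
    open ≤-Reasoning
    cases : Dec (Wants h x) → deficit (h ∷ʳ x) + symmetric (deficient h) (deficient h) x ≤ deficit h
    cases (yes w) = begin
      deficit (h ∷ʳ x) + symmetric (deficient h) (deficient h) x ≤⟨ +-monoʳ-≤ (deficit (h ∷ʳ x)) (symmetric-inc x p (deficient h) (deficient≤1 h)) ⟩
      deficit (h ∷ʳ x) + #deficientEnds h x ≡⟨ ∑-+ V _ _ ⟨
      ∑ V (λ v → (k ∸ degree (bought (h ∷ʳ x)) v) + inc x v * deficient h v)
        ≡⟨ ∑-cong V (λ v _ → trans (cong (λ d → (k ∸ d) + inc x v * deficient h v) (bought-degree h x w v))
             (∸-step (degree (bought h) v) (inc x v) (inc≤1 x v))) ⟩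
      deficit h ∎
    cases (no ¬w) = begin
      deficit (h ∷ʳ x) + symmetric (deficient h) (deficient h) x
        ≡⟨ cong₂ _+_ (∑-cong V (λ v _ → cong (k ∸_) (skipped-degree h x ¬w v)))
             (cong₂ _+_ (unwanted h x ¬w) (trans (*-comm (deficient h (proj₂ x)) _) (unwanted h x ¬w))) ⟩
      deficit h + 0 ≡⟨ +-identityʳ _ ⟩
      deficit h ∎

  -- Deficient sets only shrink, so a seen edge inside the present one found both ends deficient and
  -- was bought; and a deficient vertex has fewer than `k` bought edges.
  seen-inside : ∀ h → (∀ {x} → x ∈ h → Proper x) → ∑ h (symmetric (deficient h) (deficient h)) ≤ k * #deficient h
  seen-inside h proper = begin
    ∑ h (symmetric f f) ≤⟨ extend {P = P} {Q = λ _ → ⊤} step [] h (λ _ → tt) (λ _ → z≤n) (λ _ → ≤-refl) ⟩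
    ∑ (bought h) (symmetric f f) ≤⟨ ∑-mono (bought h) (λ x x∈ → symmetric-inc x (proper (bought-⊆ h x∈)) f (deficient≤1 h)) ⟩
    ∑ (bought h) (λ x → ∑ V (λ v → inc x v * f v)) ≡⟨ ∑-degree-weighted (bought h) f ⟩
    ∑ V (λ v → degree (bought h) v * f v) ≤⟨ ∑-mono V (λ v _ → pointwise v) ⟩
    ∑ V (λ v → k * f v) ≡⟨ ∑-*ˡ V k f ⟩
    k * #deficient h ∎
    where
    open ≤-Reasoning
    f : Fin n → ℕ
    f = deficient h
    pointwise : ∀ v → degree (bought h) v * deficient h v ≤ k * deficient h v
    pointwise v = lemma (degree (bought h) v) (degree (bought h) v <? k)
      where
      lemma : ∀ b (d : Dec (b < k)) → b * χ d ≤ k * χ d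
      lemma b (yes b<k) = *-monoˡ-≤ 1 (<⇒≤ b<k)
      lemma b (no _) = ≤-trans (≤-reflexive (*-zeroʳ b)) z≤n
    -- The weights `f` belong to the final history `h` and stay fixed while the prefix `g` grows.
    P : List E → Set
    P g = (∀ v → f v ≤ deficient g v) → ∑ g (symmetric f f) ≤ ∑ (bought g) (symmetric f f)
    step : ∀ g x → ⊤ → P g → P (g ∷ʳ x)
    step g x _ ih f≤ = cases (wants? g x)
      where
      f≤g : ∀ v → f v ≤ deficient g v
      f≤g v = ≤-trans (f≤ v) (deficient-anti g x v)
      cases : Dec (Wants g x) → ∑ (g ∷ʳ x) (symmetric f f) ≤ ∑ (bought (g ∷ʳ x)) (symmetric f f)
      cases (yes w) = begin
        ∑ (g ∷ʳ x) (symmetric f f) ≡⟨ ∑-∷ʳ g x _ ⟩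
        ∑ g (symmetric f f) + symmetric f f x ≤⟨ +-monoˡ-≤ _ (ih f≤g) ⟩
        ∑ (bought g) (symmetric f f) + symmetric f f x ≡⟨ ∑-∷ʳ (bought g) x _ ⟨
        ∑ (bought g ∷ʳ x) (symmetric f f) ≡⟨ cong (λ b → ∑ b (symmetric f f)) (buys g x w) ⟨
        ∑ (bought (g ∷ʳ x)) (symmetric f f) ∎
      cases (no ¬w) = begin
        ∑ (g ∷ʳ x) (symmetric f f) ≡⟨ ∑-∷ʳ g x _ ⟩
        ∑ g (symmetric f f) + symmetric f f x ≤⟨ +-mono-≤ (ih f≤g) (+-mono-≤ zero-term (≤-trans (≤-reflexive (*-comm (f (proj₂ x)) _)) zero-term)) ⟩
        ∑ (bought g) (symmetric f f) + 0 ≡⟨ +-identityʳ _ ⟩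
        ∑ (bought g) (symmetric f f) ≡⟨ cong (λ b → ∑ b (symmetric f f)) (skips g x ¬w) ⟨
        ∑ (bought (g ∷ʳ x)) (symmetric f f) ∎
        where
        zero-term : f (proj₁ x) * f (proj₂ x) ≤ 0
        zero-term = ≤-trans (*-mono-≤ (f≤g (proj₁ x)) (f≤g (proj₂ x))) (≤-reflexive (unwanted g x ¬w))

  -- The ordered pairs of deficient vertices come from seen edges, from unseen edges and from the
  -- diagonal.
  unseen-inside : ∀ {h r} → Splits h r →
    #deficient h * #deficient h ≤ ∑ r (symmetric (deficient h) (deficient h)) + suc k * #deficient h
  unseen-inside {h} {r} s = begin
    D * D ≡⟨ splits-∑ s (deficient h) (deficient h) ⟨
    ∑ h S + ∑ r S + ∑ V (λ v → deficient h v * deficient h v)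
      ≤⟨ +-mono-≤ (+-monoˡ-≤ (∑ r S) (seen-inside h (λ x∈ → splits-proper s (∈-++⁺ˡ x∈))))
           (∑-mono V (λ v _ → ≤-trans (*-monoʳ-≤ (deficient h v) (deficient≤1 h v)) (≤-reflexive (*-identityʳ _)))) ⟩
    k * D + ∑ r S + D ≡⟨ regroup k D (∑ r S) ⟩
    ∑ r S + suc k * D ∎
    where
    open ≤-Reasoning
    D = #deficient h
    S = symmetric (deficient h) (deficient h)
    regroup : ∀ k d s → k * d + s + d ≡ s + suc k * d
    regroup = solve-∀

  module _ (a : ℕ) (n-large : 2 * (a * suc k) ≤ n) where

    private
      Many : List E → Set
      Many h = n ≤ a * #deficient h

      many? : ∀ h → Dec (Many h)
      many? h = n ≤? a * #deficient h

      -- While many vertices are deficient, a^2 times the deficit plus the elapsed time is a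
      -- supermartingale by `deficit-drift`. The indicator makes it 0 afterwards, and for good,
      -- since the deficient set never grows.
      potential : List E → ℕ
      potential h = χ (many? h) * (a * a * deficit h + length h)

    -- With D >= n / a the bound on `n` makes `suc k * D` at most D^2 / 2. The sum over unseen edges
    -- inside the deficient set is thus at least n^2 / (2 a^2), hence at least `length r` / a^2: the
    -- mean fall per edge is at least 1 / a^2.
    deficit-drift : ∀ {h r} → Splits h r → Many h →
      a * a * ∑ r (λ x → deficit (h ∷ʳ x)) + length r ≤ length r * (a * a * deficit h)
    deficit-drift {h} {r} s many = begin
      a * a * ∑ r (λ x → deficit (h ∷ʳ x)) + length r ≤⟨ +-monoʳ-≤ (a * a * ∑ r (λ x → deficit (h ∷ʳ x))) enough ⟩
      a * a * ∑ r (λ x → deficit (h ∷ʳ x)) + a * a * S ≡⟨ *-distribˡ-+ (a * a) (∑ r (λ x → deficit (h ∷ʳ x))) S ⟨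
      a * a * (∑ r (λ x → deficit (h ∷ʳ x)) + S) ≡⟨ cong (a * a *_) (∑-+ r _ _) ⟨
      a * a * ∑ r (λ x → deficit (h ∷ʳ x) + symmetric (deficient h) (deficient h) x)
        ≤⟨ *-monoʳ-≤ (a * a) (∑-≤-const r (deficit h) (λ x x∈ → deficit-step h x (splits-proper s (∈-++⁺ʳ h x∈)))) ⟩
      a * a * (length r * deficit h) ≡⟨ *-left-comm (a * a) (length r) (deficit h) ⟩
      length r * (a * a * deficit h) ∎
      where
      open ≤-Reasoning
      D = #deficient h
      y = a * D
      S = ∑ r (symmetric (deficient h) (deficient h))
      square : 2 * (y * y) ≤ 2 * (a * a * S) + n * y
      square = begin
        2 * (y * y) ≡⟨ expand a D ⟩
        2 * (a * a * (D * D)) ≤⟨ *-monoʳ-≤ 2 (*-monoʳ-≤ (a * a) (unseen-inside s)) ⟩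
        2 * (a * a * (S + suc k * D)) ≡⟨ expand′ a S (suc k) D ⟩
        2 * (a * a * S) + 2 * (a * suc k) * y ≤⟨ +-monoʳ-≤ (2 * (a * a * S)) (*-monoˡ-≤ y n-large) ⟩
        2 * (a * a * S) + n * y ∎
        where
        expand : ∀ a d → 2 * (a * d * (a * d)) ≡ 2 * (a * a * (d * d))
        expand = solve-∀
        expand′ : ∀ a s k d → 2 * (a * a * (s + k * d)) ≡ 2 * (a * a * s) + 2 * (a * k) * (a * d)
        expand′ = solve-∀
      enough : length r ≤ a * a * S
      enough = *-cancelˡ-≤ 2 (begin
        2 * length r ≤⟨ *-monoʳ-≤ 2 (≤-trans (m≤n+m (length r) (length h)) (≤-reflexive (splits-length s))) ⟩
        2 * length (allEdges n) ≤⟨ m≤m+n _ n ⟩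
        2 * length (allEdges n) + n ≡⟨ length-allEdges n ⟩
        n * n ≤⟨ *-mono-≤ many many ⟩
        y * y ≤⟨ +-cancelʳ-≤ (y * y) _ _ (≤-trans (≤-reflexive (twice (y * y)))
                                                (≤-trans square (+-monoʳ-≤ (2 * (a * a * S)) (*-monoˡ-≤ y many)))) ⟩
        2 * (a * a * S) ∎)
        where
        twice : ∀ b → b + b ≡ 2 * b
        twice = solve-∀

    -- At time `t` the potential is at least `t` if many vertices are deficient, and its mean never
    -- exceeds the initial bound a^2 n k.
    deficient-rare : t ≤ length (allEdges n) →
      t * ∑ (orders n) (λ π → χ (n ≤? a * #deficient (take t π))) ≤ totalOrders n * (a * a * (n * k))
    deficient-rare t≤N = begin
      t * ∑ (orders n) (λ π → χ (many? (take t π))) ≡⟨ ∑-*ˡ (orders n) t _ ⟨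
      ∑ (orders n) (λ π → t * χ (many? (take t π))) ≤⟨ ∑-mono (orders n) final ⟩
      ∑ (orders n) (λ π → potential (take t π)) ≤⟨ additive-drift (allEdges-unique n) potential 0 t t≤N drift ⟩
      totalOrders n * (potential [] + t * 0) ≤⟨ *-monoʳ-≤ (totalOrders n) initial ⟩
      totalOrders n * (a * a * (n * k)) ∎
      where
      open ≤-Reasoning
      final : ∀ π → π ∈ orders n → t * χ (many? (take t π)) ≤ potential (take t π)
      final π π∈ = ≤-trans (≤-reflexive (*-comm t _)) (*-monoʳ-≤ (χ (many? (take t π)))
        (≤-trans (≤-reflexive (sym (trans (length-take t π) (m≤n⇒m⊓n≡m
          (subst (t ≤_) (sym (↭-length (perms⇒↭ (allEdges n) π∈))) t≤N))))) (m≤n+m _ (a * a * deficit (take t π)))))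
      initial : potential [] + t * 0 ≤ a * a * (n * k)
      initial = begin
        potential [] + t * 0 ≡⟨ trans (cong (potential [] +_) (*-zeroʳ t)) (+-identityʳ _) ⟩
        potential [] ≤⟨ *-monoˡ-≤ (a * a * deficit [] + 0) (χ≤1 (many? [])) ⟩
        1 * (a * a * deficit [] + 0) ≡⟨ trans (*-identityˡ _) (+-identityʳ _) ⟩
        a * a * deficit [] ≤⟨ *-monoʳ-≤ (a * a) (∑-vertices≤ (λ v → k ∸ degree (bought []) v) k (λ v → m∸n≤m k (degree (bought []) v))) ⟩
        a * a * (n * k) ∎
      drift : ∀ h r → length h < t → h ++ r ↭ allEdges n →
        ∑ r (λ x → potential (h ∷ʳ x)) ≤ length r * (potential h + 0)
      drift h r _ p = cases (many? h)
        where
        step≤ : ∀ x → potential (h ∷ʳ x) ≤ χ (many? h) * (a * a * deficit (h ∷ʳ x) + suc (length h))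
        step≤ x = *-mono-≤ (χ-mono (many? (h ∷ʳ x)) (many? h) (λ many → ≤-trans many
            (*-monoʳ-≤ a (∑-mono V (λ v _ → deficient-anti h x v)))))
          (≤-reflexive (cong (a * a * deficit (h ∷ʳ x) +_) (length-∷ʳ h x)))
        cases : Dec (Many h) → ∑ r (λ x → potential (h ∷ʳ x)) ≤ length r * (potential h + 0)
        cases (no ¬many) = ≤-trans (∑-mono r (λ x _ → ≤-trans (step≤ x)
          (≤-reflexive (cong (_* (a * a * deficit (h ∷ʳ x) + suc (length h))) (χ-no (many? h) ¬many)))))
          (≤-trans (≤-reflexive (∑-zero r)) z≤n)
        cases (yes many) = begin
          ∑ r (λ x → potential (h ∷ʳ x))
            ≤⟨ ∑-mono r (λ x _ → ≤-trans (step≤ x) (≤-trans (*-monoˡ-≤ _ (χ≤1 (many? h))) (≤-reflexive (*-identityˡ _)))) ⟩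
          ∑ r (λ x → a * a * deficit (h ∷ʳ x) + suc (length h))
            ≡⟨ trans (∑-+ r _ _) (cong₂ _+_ (∑-*ˡ r (a * a) _) (trans (∑-const r _) (*-suc (length r) (length h)))) ⟩
          a * a * ∑ r (λ x → deficit (h ∷ʳ x)) + (length r + length r * length h)
            ≡⟨ +-assoc (a * a * ∑ r (λ x → deficit (h ∷ʳ x))) _ _ ⟨
          a * a * ∑ r (λ x → deficit (h ∷ʳ x)) + length r + length r * length h
            ≤⟨ +-monoˡ-≤ (length r * length h) (deficit-drift (splits {h = h} {r = r} p) many) ⟩
          length r * (a * a * deficit h) + length r * length h
            ≡⟨ *-distribˡ-+ (length r) (a * a * deficit h) (length h) ⟨
          length r * (a * a * deficit h + length h)
            ≡⟨ cong (length r *_) (trans (sym (*-identityˡ _)) (trans (cong (_* (a * a * deficit h + length h)) (sym (χ-yes (many? h) many))) (sym (+-identityʳ _)))) ⟩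
          length r * (potential h + 0) ∎

-- Hitting time

minDegAtLeast⇒ : ∀ k (es : List (Edge n)) → minDegAtLeast k es ≡ true → ∀ v → k ≤ degree es v
minDegAtLeast⇒ {n} k es eq v = go (allFin n) eq (∈-allFin v)
  where
  go : ∀ vs → foldr (λ v acc → (k ≤ᵇ degree es v) ∧ acc) true vs ≡ true → v ∈ vs → k ≤ degree es v
  go (u ∷ vs) eq v∈ with k ≤ᵇ degree es u in test
  go (u ∷ vs) eq (here refl) | true = ≤ᵇ⇒≤ k (degree es u) (subst IsTrue (sym test) tt)
  go (u ∷ vs) eq (there v∈) | true = go vs eq v∈

⇒minDegAtLeast : ∀ k (es : List (Edge n)) → (∀ v → k ≤ degree es v) → minDegAtLeast k es ≡ true
⇒minDegAtLeast {n} k es all = go (allFin n)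
  where
  go : ∀ vs → foldr (λ v acc → (k ≤ᵇ degree es v) ∧ acc) true vs ≡ true
  go [] = refl
  go (u ∷ vs) with k ≤ᵇ degree es u in test
  ... | true = go vs
  ... | false = ⊥-elim (subst IsTrue test (≤⇒≤ᵇ (all u)))

tauAux-spec : ∀ k (π : List (Edge n)) fuel m {l} → m ≤ l → l < m + fuel → minDegAtLeast k (take l π) ≡ true →
  tauAux k π fuel m ≤ l × minDegAtLeast k (take (tauAux k π fuel m) π) ≡ true
tauAux-spec k π zero m m≤l l< _ = ⊥-elim (<⇒≱ l< (≤-trans (≤-reflexive (+-identityʳ m)) m≤l))
tauAux-spec k π (suc fuel) m {l} m≤l l< ok with minDegAtLeast k (take m π) in eq
... | true = m≤l , eq
... | false = tauAux-spec k π fuel (suc m) (≤∧≢⇒< m≤l m≢l) (≤-trans l< (≤-reflexive (+-suc m fuel))) ok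
  where
  m≢l : m ≢ l
  m≢l refl = contradiction (trans (sym eq) ok) (λ ())

tau-spec : ∀ k (π : List (Edge n)) {l} → l ≤ length π → minDegAtLeast k (take l π) ≡ true →
  tau k π ≤ l × minDegAtLeast k (take (tau k π) π) ≡ true
tau-spec k π l≤ = tauAux-spec k π (suc (length π)) 0 z≤n (s≤s l≤)

take-++-drop : ∀ {m l} (xs : List A) → m ≤ l → take m xs ++ drop m (take l xs) ≡ take l xs
take-++-drop xs z≤n = refl
take-++-drop [] (s≤s _) = refl
take-++-drop (x ∷ xs) (s≤s m≤l) = cong (x ∷_) (take-++-drop xs m≤l)

∈-take : ∀ m (xs : List A) {x} → x ∈ take m xs → x ∈ xs
∈-take m xs x∈ = subst (_ ∈_) (take++drop≡id m xs) (∈-++⁺ˡ x∈)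

length-filterᵇ : ∀ (p : A → Bool) xs → length (filterᵇ p xs) ≡ ∑ xs (λ x → if p x then 1 else 0)
length-filterᵇ p [] = refl
length-filterᵇ p (x ∷ xs) with p x
... | true = cong suc (length-filterᵇ p xs)
... | false = length-filterᵇ p xs

-- Union bound over five causes of failure, the last of which is a count.
indicator-≤ : {P₁ P₂ P₃ P₄ : Set} (d₁ : Dec P₁) (d₂ : Dec P₂) (d₃ : Dec P₃) (d₄ : Dec P₄) (e : ℕ) (b : Bool) →
  (¬ P₁ → ¬ P₂ → ¬ P₃ → ¬ P₄ → e ≡ 0 → b ≡ true) → (if not b then 1 else 0) ≤ χ d₁ + χ d₂ + χ d₃ + χ d₄ + e
indicator-≤ _ _ _ _ _ true _ = z≤n
indicator-≤ (yes _) _ _ _ _ false _ = s≤s z≤n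
indicator-≤ (no _) (yes _) _ _ _ false _ = s≤s z≤n
indicator-≤ (no _) (no _) (yes _) _ _ false _ = s≤s z≤n
indicator-≤ (no _) (no _) (no _) (yes _) _ false _ = s≤s z≤n
indicator-≤ (no _) (no _) (no _) (no _) (suc _) false _ = s≤s z≤n
indicator-≤ (no p₁) (no p₂) (no p₃) (no p₄) zero false b≡ = contradiction (b≡ p₁ p₂ p₃ p₄ refl) (λ ())

∑-+⁵ : ∀ (xs : List A) (f₁ f₂ f₃ f₄ f₅ : A → ℕ) →
  ∑ xs (λ x → f₁ x + f₂ x + f₃ x + f₄ x + f₅ x) ≡ ∑ xs f₁ + ∑ xs f₂ + ∑ xs f₃ + ∑ xs f₄ + ∑ xs f₅
∑-+⁵ xs f₁ f₂ f₃ f₄ f₅ = trans (∑-+ xs _ f₅) (cong (_+ ∑ xs f₅) (trans (∑-+ xs _ f₄) (cong (_+ ∑ xs f₄)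
  (trans (∑-+ xs _ f₃) (cong (_+ ∑ xs f₃) (∑-+ xs f₁ f₂))))))

-- The strategy

fits : (k p q n : ℕ) → ℕ → Bool
fits k p q n b = ⌊ b * (2 ^ suc k * q) ≤? n * (k * 2 ^ k * q + 2 * q + 2 ^ suc k * p) ⌋

⌊⌋⇒ : {P : Set} (d : Dec P) → ⌊ d ⌋ ≡ true → P
⌊⌋⇒ (yes p) _ = p

⇒⌊⌋ : {P : Set} (d : Dec P) → P → ⌊ d ⌋ ≡ true
⇒⌊⌋ (yes _) _ = refl
⇒⌊⌋ (no ¬p) p = ⊥-elim (¬p p)

fits-down : ∀ k p q n {a b} → a ≤ b → fits k p q n b ≡ true → fits k p q n a ≡ true
fits-down k p q n {a} {b} a≤b ok = ⇒⌊⌋ (a * (2 ^ suc k * q) ≤? _)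
  (≤-trans (*-monoˡ-≤ (2 ^ suc k * q) a≤b) (⌊⌋⇒ (b * (2 ^ suc k * q) ≤? _) ok))

-- The edges whose two ends are deficient cost kn/2; each wasted first edge costs a further 1/2.
within-budget : ∀ k p q n b b₀ W H D → 1 ≤ p → b ≤ b₀ + k * D → 2 * b₀ ≤ n * k + W + k * H →
  2 ^ k * W ≤ 2 * n → k * q * H ≤ n → 2 * k * q * D ≤ n → WithinBudget k p q n b
within-budget k p q n b b₀ W H D 1≤p b≤ 2b₀≤ W≤ H≤ D≤ = begin
  b * (2 * u * q) ≡⟨ lemma₁ b u q ⟩
  u * q * (2 * b) ≤⟨ *-monoʳ-≤ (u * q) (*-monoʳ-≤ 2 b≤) ⟩
  u * q * (2 * (b₀ + k * D)) ≡⟨ cong (u * q *_) (*-distribˡ-+ 2 b₀ (k * D)) ⟩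
  u * q * (2 * b₀ + 2 * (k * D)) ≤⟨ *-monoʳ-≤ (u * q) (+-monoˡ-≤ (2 * (k * D)) 2b₀≤) ⟩
  u * q * ((n * k + W + k * H) + 2 * (k * D)) ≡⟨ lemma₂ u q n k W H D ⟩
  n * (k * u * q) + (q * (u * W) + u * (k * q * H) + u * (2 * k * q * D))
    ≤⟨ +-monoʳ-≤ (n * (k * u * q)) (+-mono-≤ (+-mono-≤ (*-monoʳ-≤ q W≤) (*-monoʳ-≤ u H≤)) (*-monoʳ-≤ u D≤)) ⟩
  n * (k * u * q) + (q * (2 * n) + u * n + u * n) ≡⟨ lemma₃ n (k * u * q) q u ⟩
  n * (k * u * q + 2 * q + 2 * u * 1) ≤⟨ *-monoʳ-≤ n (+-monoʳ-≤ (k * u * q + 2 * q) (*-monoʳ-≤ (2 * u) 1≤p)) ⟩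
  n * (k * u * q + 2 * q + 2 * u * p) ∎
  where
  open ≤-Reasoning
  u = 2 ^ k
  lemma₁ : ∀ b u q → b * (2 * u * q) ≡ u * q * (2 * b)
  lemma₁ = solve-∀
  lemma₂ : ∀ u q n k W H D → u * q * ((n * k + W + k * H) + 2 * (k * D)) ≡
    n * (k * u * q) + (q * (u * W) + u * (k * q * H) + u * (2 * k * q * D))
  lemma₂ = solve-∀
  lemma₃ : ∀ n a q u → n * a + (q * (2 * n) + u * n + u * n) ≡ n * (a + 2 * q + 2 * u * 1)
  lemma₃ = solve-∀

-- Success on a typical ordering

module Play (c p q T n : ℕ) (1≤p : 1 ≤ p) (1≤T : 1 ≤ T) where

  private
    k = 2 + c
    t = T * n
    V = vertices n

  -- T n early edges leave at most n / (k q) vertices with `K` of them, which cost at most n / (2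
  -- q); the deficient vertices may use up as much again.
  K : ℕ
  K = 2 * k * q * T

  open Builder n k t K (s≤s z≤n) public

  builder : Strategy n
  builder = strategy (capped (fits k p q n) rule)

  builder-budget : ∀ π → WithinBudget k p q n (length (builderGraph k builder π))
  builder-budget π = ⌊⌋⇒ (length (builderGraph k builder π) * (2 ^ suc k * q) ≤? _)
    (subst (λ es → fits k p q n (length es) ≡ true) (sym (run-strategy (capped (fits k p q n) rule) (take (tau k π) π)))
      (play-capped-fits (fits k p q n) rule [] [] (take (tau k π) π) refl))

  module Typical (m₀ m₁ : ℕ) (t≤m₀ : t ≤ m₀) (m₀≤m₁ : m₀ ≤ m₁) (m₁≤N : m₁ ≤ length (allEdges n)) where

    open Switch n k t m₀ m₁ t≤m₀ m₀≤m₁ m₁≤N public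

    module _ {π : List (Edge n)} (π∈ : π ∈ orders n)
      (few-deficient : 2 * k * q * #deficient (take t π) < n)
      (little-waste : 2 ^ k * waste k (take t π) ≤ 2 * n)
      (isolated-left : #isolated (take m₀ π) ≢ 0)
      (none-low : #low k (take m₁ π) ≡ 0)
      (none-late : ∀ d v → d < K + k → ¬ Late (suc d) c 0 π v) where

      private
        τ = tau k π
        h = take t π
        es = drop t (take τ π)

        proper : ∀ {x} → x ∈ π → Proper x
        proper x∈ = allEdges-proper (∈-resp-↭ (perms⇒↭ (allEdges n) π∈) x∈)

        high : ∀ v → k ≤ degree (take m₁ π) v
        high v = ≮⇒≥ (λ low-v → <⇒≢ (≤-trans (≤-reflexive (sym (χ-yes (degree (take m₁ π) v <? k) low-v)))
          (∑-∈ (low k (take m₁ π)) (∈-allFin v))) (sym none-low))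

        hit : τ ≤ m₁ × minDegAtLeast k (take τ π) ≡ true
        hit = tau-spec k π (≤-trans m₁≤N (≤-reflexive (sym (↭-length (perms⇒↭ (allEdges n) π∈)))))
          (⇒minDegAtLeast k (take m₁ π) high)

        high-τ : ∀ v → k ≤ degree (take τ π) v
        high-τ = minDegAtLeast⇒ k (take τ π) (proj₂ hit)

        m₀≤τ : m₀ ≤ τ
        m₀≤τ with ∑-positive V (isolated (take m₀ π)) (n≢0⇒n>0 isolated-left)
        ... | v , _ , iso = ≮⇒≥ λ τ<m₀ → <⇒≱ (s≤s z≤n) (≤-trans (high-τ v)
          (≤-trans (degree-take-mono π v (<⇒≤ τ<m₀)) (≤-reflexive (χ-pos (degree (take m₀ π) v ≟ 0) iso))))

        h++es : h ++ es ≡ take τ π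
        h++es = take-++-drop π (≤-trans t≤m₀ m₀≤τ)

        h-proper : ∀ {x} → x ∈ h → Proper x
        h-proper x∈ = proper (∈-take t π x∈)

        length-h : length h ≤ t
        length-h = ≤-trans (≤-reflexive (length-take t π)) (m⊓n≤m t (length π))

        length-h≡ : length h ≡ t
        length-h≡ = trans (length-take t π) (m≤n⇒m⊓n≡m (≤-trans (≤-trans t≤m₀ m₀≤m₁)
          (≤-trans m₁≤N (≤-reflexive (sym (↭-length (perms⇒↭ (allEdges n) π∈)))))))

        budget : fits k p q n (length (bought (take τ π))) ≡ true
        budget = ⇒⌊⌋ (length (bought (take τ π)) * (2 ^ suc k * q) ≤? _) (within-budget k p q n _ (length (bought h))
          (waste k h) (#heavy h) (#deficient h) 1≤p
          (subst (λ g → length (bought g) ≤ length (bought h) + k * #deficient h) h++es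
            (purchases-late h es (λ x∈ → proper (∈-take τ π (subst (_ ∈_) h++es (∈-++⁺ʳ h x∈))))))
          (purchases-early h h-proper length-h)
          little-waste few-heavy (<⇒≤ few-deficient))
          where
          open ≤-Reasoning
          few-heavy : k * q * #heavy h ≤ n
          few-heavy = *-cancelˡ-≤ (2 * T) {{>-nonZero (*-mono-≤ {1} {2} {1} {T} (s≤s z≤n) 1≤T)}} (begin
            2 * T * (k * q * #heavy h) ≡⟨ regroup T k q (#heavy h) ⟩
            K * #heavy h ≤⟨ heavy-count h h-proper ⟩
            2 * length h ≤⟨ *-monoʳ-≤ 2 length-h ⟩
            2 * (T * n) ≡⟨ *-assoc 2 T n ⟨
            2 * T * n ∎)
            where
            regroup : ∀ T k q H → 2 * T * (k * q * H) ≡ 2 * k * q * T * H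
            regroup = solve-∀

        satisfied : ∀ v → k ≤ degree (bought (take τ π)) v
        satisfied v = ≮⇒≥ (λ def → late (subst (λ g → degree (bought g) v < k) (sym h++es) def))
          where
          open ≤-Reasoning
          b₁ = degree (bought h) v
          bτ = degree (bought (h ++ es)) v
          late : ¬ (bτ < k)
          late def = cases (degree h v) refl
            where
            balance : degree (take τ π) v + b₁ ≤ degree h v + bτ
            balance = subst (λ g → degree g v + b₁ ≤ degree h v + bτ) h++es
              (late-edges-bought h es v (≤-reflexive (sym length-h≡)) def)
            b₁<k : b₁ < k
            b₁<k = ≤-<-trans (extend {P = λ g → b₁ ≤ degree (bought g) v} {Q = λ _ → ⊤}
              (λ g x _ b₁≤ → ≤-trans b₁≤ (bought-degree-mono g x v)) h es (λ _ → tt) ≤-refl) def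
            others : lowOthers k (take τ π) v ≤ 0
            others = ≤-trans (∑-mono V (λ u _ → ≤-reflexive (trans
                (cong (χ (¬? (v ≟F u)) *_) (χ-no (degree (take τ π) u <? k) (≤⇒≯ (high-τ u)))) (*-zeroʳ (χ (¬? (v ≟F u)))))))
              (≤-reflexive (∑-zero V))
            cases : ∀ d → degree h v ≡ d → ⊥
            -- All edges at `v` arrive after time `t`, when none is refused to a deficient vertex.
            cases zero d≡ = <⇒≱ def (begin
              k ≤⟨ high-τ v ⟩
              degree (take τ π) v ≤⟨ m≤m+n _ b₁ ⟩
              degree (take τ π) v + b₁ ≤⟨ balance ⟩
              degree h v + bτ ≡⟨ cong (_+ bτ) d≡ ⟩
              bτ ∎)
            -- `b₁ ≥ 1` and `bτ ≤ suc c` leave at most `c` edges between `t` and the hitting time,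
            -- where no vertex is low any more.
            cases (suc d) d≡ = none-late d v
              (≤-trans (≤-reflexive (sym d≡)) (≤-trans (missed-edges h v b₁<k) (+-monoʳ-≤ K (<⇒≤ b₁<k))))
              (τ , s≤s (proj₁ hit) , m₀≤τ , d≡ , ≤-pred (begin
                suc (degree (take τ π) v) ≡⟨ +-comm 1 _ ⟩
                degree (take τ π) v + 1 ≤⟨ +-monoʳ-≤ (degree (take τ π) v) (first-edge-bought h v (≤-trans (s≤s z≤n) (≤-reflexive (sym d≡)))) ⟩
                degree (take τ π) v + b₁ ≤⟨ balance ⟩
                degree h v + bτ ≤⟨ +-mono-≤ (≤-reflexive d≡) (≤-pred def) ⟩
                suc d + suc c ≡⟨ +-suc (suc d) c ⟩
                suc (suc d + c) ∎) , others)

      typical-success : minDegAtLeast k (builderGraph k builder π) ≡ true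
      typical-success = trans (cong (minDegAtLeast k) (trans (run-strategy (capped (fits k p q n) rule) (take τ π))
          (play-capped (fits k p q n) (fits-down k p q n) rule [] [] (take τ π) budget)))
        (⇒minDegAtLeast k (bought (take τ π)) satisfied)

    deficient? : ∀ (π : List (Edge n)) → Dec (n ≤ 2 * k * q * #deficient (take t π))
    deficient? π = n ≤? 2 * k * q * #deficient (take t π)

    wasted? : ∀ (π : List (Edge n)) → Dec (2 * n < 2 ^ k * waste k (take t π))
    wasted? π = 2 * n <? 2 ^ k * waste k (take t π)

    covered? : ∀ (π : List (Edge n)) → Dec (#isolated (take m₀ π) ≡ 0)
    covered? π = #isolated (take m₀ π) ≟ 0

    low? : ∀ (π : List (Edge n)) → Dec (1 ≤ #low k (take m₁ π))
    low? π = 1 ≤? #low k (take m₁ π)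

    lateCauses : List (Edge n) → ℕ
    lateCauses π = ∑ (upTo (K + k)) (λ d → ∑ V (λ v → χ (late? (suc d) c 0 π v)))

    no-late-cause : ∀ {π} → lateCauses π ≡ 0 → ∀ d v → d < K + k → ¬ Late (suc d) c 0 π v
    no-late-cause {π} none d v d< late = <⇒≱ (≤-reflexive (sym (χ-yes (late? (suc d) c 0 π v) late))) (begin
      χ (late? (suc d) c 0 π v) ≤⟨ ∑-∈ (λ v → χ (late? (suc d) c 0 π v)) (∈-allFin v) ⟩
      ∑ V (λ v → χ (late? (suc d) c 0 π v)) ≤⟨ ∑-∈ (λ d → ∑ V (λ v → χ (late? (suc d) c 0 π v))) (∈-upTo⁺ d<) ⟩
      lateCauses π ≡⟨ none ⟩
      0 ∎)
      where open ≤-Reasoning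

    failure-caused : ∀ π → π ∈ orders n → (if not (minDegAtLeast k (builderGraph k builder π)) then 1 else 0)
      ≤ χ (deficient? π) + χ (wasted? π) + χ (covered? π) + χ (low? π) + lateCauses π
    failure-caused π π∈ = indicator-≤ (deficient? π) (wasted? π) (covered? π) (low? π) (lateCauses π) _
      (λ few little left ¬low none → typical-success π∈ (≰⇒> few) (≮⇒≥ little) left (n<1⇒n≡0 (≰⇒> ¬low)) (no-late-cause none))

    failures-bound : failures n k builder ≤
        ∑ (orders n) (λ π → χ (deficient? π)) + ∑ (orders n) (λ π → χ (wasted? π)) + ∑ (orders n) (λ π → χ (covered? π))
      + ∑ (orders n) (λ π → χ (low? π)) + ∑ (upTo (K + k)) (λ d → #late (suc d) c 0)
    failures-bound = begin
      failures n k builder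
        ≡⟨ length-filterᵇ (λ π → not (minDegAtLeast k (builderGraph k builder π))) (orders n) ⟩
      ∑ (orders n) (λ π → if not (minDegAtLeast k (builderGraph k builder π)) then 1 else 0)
        ≤⟨ ∑-mono (orders n) failure-caused ⟩
      ∑ (orders n) (λ π → χ (deficient? π) + χ (wasted? π) + χ (covered? π) + χ (low? π) + lateCauses π)
        ≡⟨ ∑-+⁵ (orders n) (λ π → χ (deficient? π)) (λ π → χ (wasted? π)) (λ π → χ (covered? π)) (λ π → χ (low? π)) lateCauses ⟩
      X + ∑ (orders n) lateCauses
        ≡⟨ cong (X +_) (∑-comm (orders n) (upTo (K + k)) (λ π d → ∑ V (λ v → χ (late? (suc d) c 0 π v)))) ⟩
      X + ∑ (upTo (K + k)) (λ d → #late (suc d) c 0) ∎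
      where
      open ≤-Reasoning
      X = ∑ (orders n) (λ π → χ (deficient? π)) + ∑ (orders n) (λ π → χ (wasted? π)) + ∑ (orders n) (λ π → χ (covered? π))
        + ∑ (orders n) (λ π → χ (low? π))

-- Powers

-- As 2 i / b <= 1, the product of 1 + 2 i / b and 1 + 1 / b is at most 1 + 2 (i + 1) / b.
suc-power≤double : ∀ b i → 2 * i ≤ b → suc b ^ i * b ≤ b ^ i * (b + 2 * i)
suc-power≤double b zero _ = ≤-reflexive (cong (1 *_) (sym (+-identityʳ b)))
suc-power≤double b (suc i) 2i≤b = begin
  suc b * suc b ^ i * b ≡⟨ *-assoc (suc b) (suc b ^ i) b ⟩
  suc b * (suc b ^ i * b) ≤⟨ *-monoʳ-≤ (suc b) (suc-power≤double b i 2i≤b′) ⟩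
  suc b * (b ^ i * (b + 2 * i)) ≡⟨ expand b (b ^ i) i ⟩
  b ^ i * (b * (b + 2 * i) + b + 2 * i) ≤⟨ *-monoʳ-≤ (b ^ i) (+-monoʳ-≤ (b * (b + 2 * i) + b) 2i≤b′) ⟩
  b ^ i * (b * (b + 2 * i) + b + b) ≡⟨ collect b (b ^ i) i ⟩
  b * b ^ i * (b + 2 * suc i) ∎
  where
  open ≤-Reasoning
  2i≤b′ : 2 * i ≤ b
  2i≤b′ = ≤-trans (*-monoʳ-≤ 2 (n≤1+n i)) 2i≤b
  expand : ∀ b e i → suc b * (e * (b + 2 * i)) ≡ e * (b * (b + 2 * i) + b + 2 * i)
  expand = solve-∀
  collect : ∀ b e i → e * (b * (b + 2 * i) + b + b) ≡ b * e * (b + 2 * suc i)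
  collect = solve-∀

suc-power≤block : ∀ b m → 1 ≤ b → 2 * m ≤ b → suc b ^ m ≤ 2 * b ^ m
suc-power≤block b m 1≤b 2m≤b = *-cancelʳ-≤ _ _ b {{>-nonZero 1≤b}} (begin
  suc b ^ m * b ≤⟨ suc-power≤double b m 2m≤b ⟩
  b ^ m * (b + 2 * m) ≤⟨ *-monoʳ-≤ (b ^ m) (+-monoʳ-≤ b 2m≤b) ⟩
  b ^ m * (b + b) ≡⟨ double (b ^ m) b ⟩
  2 * b ^ m * b ∎)
  where
  open ≤-Reasoning
  double : ∀ e b → e * (b + b) ≡ 2 * e * b
  double = solve-∀

-- The exponent is cut into at most `w` blocks of length at most `j`, each worth a factor 2.
suc-power≤blocks : ∀ j b w m → 1 ≤ b → 2 * j ≤ b → m ≤ w * j → suc b ^ m ≤ 2 ^ w * b ^ m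
suc-power≤blocks j b zero zero _ _ _ = ≤-refl
suc-power≤blocks j b (suc w) m 1≤b 2j≤b m≤ with ≤-total m j
... | inj₁ m≤j = ≤-trans (suc-power≤block b m 1≤b (≤-trans (*-monoʳ-≤ 2 m≤j) 2j≤b))
  (*-monoˡ-≤ (b ^ m) (subst (_≤ 2 ^ suc w) (*-identityʳ 2) (*-monoʳ-≤ 2 (m^n>0 2 w))))
... | inj₂ j≤m = subst (λ m → suc b ^ m ≤ 2 ^ suc w * b ^ m) (m+[n∸m]≡n j≤m) (begin
    suc b ^ (j + m′) ≡⟨ ^-distribˡ-+-* (suc b) j m′ ⟩
    suc b ^ j * suc b ^ m′ ≤⟨ *-mono-≤ (suc-power≤block b j 1≤b 2j≤b)
                                              (suc-power≤blocks j b w m′ 1≤b 2j≤b (m≤n+o⇒m∸n≤o m j m≤)) ⟩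
    2 * b ^ j * (2 ^ w * b ^ m′) ≡⟨ regroup (2 ^ w) (b ^ j) (b ^ m′) ⟩
    2 * 2 ^ w * (b ^ j * b ^ m′) ≡⟨ cong (2 * 2 ^ w *_) (^-distribˡ-+-* b j m′) ⟨
    2 * 2 ^ w * b ^ (j + m′) ∎)
  where
  open ≤-Reasoning
  m′ = m ∸ j
  regroup : ∀ u e f → 2 * e * (u * f) ≡ 2 * u * (e * f)
  regroup = solve-∀

bernoulli : ∀ y i → y ^ i * (y + i) ≤ suc y ^ i * y
bernoulli y zero = ≤-reflexive (cong (1 *_) (+-identityʳ y))
bernoulli y (suc i) = begin
  y * y ^ i * (y + suc i) ≡⟨ expand y (y ^ i) i ⟩
  y ^ i * (y * (y + i) + y) ≤⟨ *-monoʳ-≤ (y ^ i) (+-monoʳ-≤ (y * (y + i)) (m≤m+n y i)) ⟩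
  y ^ i * (y * (y + i) + (y + i)) ≡⟨ collect y (y ^ i) i ⟩
  suc y * (y ^ i * (y + i)) ≤⟨ *-monoʳ-≤ (suc y) (bernoulli y i) ⟩
  suc y * (suc y ^ i * y) ≡⟨ *-assoc (suc y) (suc y ^ i) y ⟨
  suc y * suc y ^ i * y ∎
  where
  open ≤-Reasoning
  expand : ∀ y e i → y * e * (y + suc i) ≡ e * (y * (y + i) + y)
  expand = solve-∀
  collect : ∀ y e i → e * (y * (y + i) + (y + i)) ≡ suc y * (e * (y + i))
  collect = solve-∀

-- The individual causes of failure for large n

scale : ∀ s b Y X tot → 1 ≤ b → s * b ≤ Y → Y * X ≤ b * tot → s * X ≤ tot
scale s b Y X tot 1≤b sb≤Y YX≤ = *-cancelˡ-≤ b {{>-nonZero 1≤b}} (begin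
  b * (s * X) ≡⟨ *-turn b s X ⟩
  s * b * X ≤⟨ *-monoˡ-≤ X sb≤Y ⟩
  Y * X ≤⟨ YX≤ ⟩
  b * tot ∎)
  where
  open ≤-Reasoning

waste-estimate : ∀ n T u X tot → 4 ≤ n → X * ((n * (n ∸ 2)) * (n * (n ∸ 2))) ≤ tot * (T * n * ((4 * n * u) * (4 * n * u))) →
  n * X ≤ 4 * (T * ((4 * u) * (4 * u))) * tot
waste-estimate n T u X tot 4≤n hyp = *-cancelˡ-≤ (n * n * n) {{>-nonZero (*-mono-≤ (*-mono-≤ 1≤n 1≤n) 1≤n)}} (begin
  n * n * n * (n * X) ≡⟨ expand n X ⟩
  X * ((n * n) * (n * n)) ≤⟨ *-monoʳ-≤ X (*-mono-≤ (*-monoʳ-≤ n n≤2e) (*-monoʳ-≤ n n≤2e)) ⟩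
  X * ((n * (2 * e)) * (n * (2 * e))) ≡⟨ pull-four n e X ⟩
  4 * (X * ((n * e) * (n * e))) ≤⟨ *-monoʳ-≤ 4 hyp ⟩
  4 * (tot * (T * n * ((4 * n * u) * (4 * n * u)))) ≡⟨ collect n T u tot ⟩
  n * n * n * (4 * (T * ((4 * u) * (4 * u))) * tot) ∎)
  where
  open ≤-Reasoning
  e = n ∸ 2
  1≤n : 1 ≤ n
  1≤n = ≤-trans (s≤s z≤n) 4≤n
  n≤2e : n ≤ 2 * e
  n≤2e = begin
    n ≡⟨ m+[n∸m]≡n (≤-trans (s≤s (s≤s z≤n)) 4≤n) ⟨
    2 + e ≤⟨ +-monoˡ-≤ e (∸-monoˡ-≤ 2 4≤n) ⟩
    e + e ≡⟨ cong (e +_) (sym (+-identityʳ e)) ⟩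
    2 * e ∎
  expand : ∀ n X → n * n * n * (n * X) ≡ X * ((n * n) * (n * n))
  expand = solve-∀
  pull-four : ∀ n e X → X * ((n * (2 * e)) * (n * (2 * e))) ≡ 4 * (X * ((n * e) * (n * e)))
  pull-four = solve-∀
  collect : ∀ n T u t → 4 * (t * (T * n * ((4 * n * u) * (4 * n * u)))) ≡ n * n * n * (4 * (T * ((4 * u) * (4 * u))) * t)
  collect = solve-∀

isolated-estimate : ∀ n j w m X tot → 1 ≤ j → m ≤ w * j → suc n * ((2 * j) ^ m * X) ≤ suc (2 * j) ^ m * tot →
  suc n * X ≤ 2 ^ w * tot
isolated-estimate n j w m X tot 1≤j m≤ hyp = *-cancelˡ-≤ e {{>-nonZero (m^n>0 (2 * j) {{>-nonZero 1≤2j}} m)}} (begin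
  e * (suc n * X) ≡⟨ *-left-comm e (suc n) X ⟩
  suc n * (e * X) ≤⟨ hyp ⟩
  suc (2 * j) ^ m * tot ≤⟨ *-monoˡ-≤ tot (suc-power≤blocks j (2 * j) w m 1≤2j ≤-refl m≤) ⟩
  2 ^ w * e * tot ≡⟨ *-swap-assoc (2 ^ w) e tot ⟩
  e * (2 ^ w * tot) ∎)
  where
  open ≤-Reasoning
  e = (2 * j) ^ m
  1≤2j : 1 ≤ 2 * j
  1≤2j = ≤-trans 1≤j (m≤m+n j _)

-- Bernoulli's inequality is applied to each half of the exponent. One half gains only order `j`,
-- which does not beat the initial weight `n * u` with `n` of order `j`; the square does.
low-estimate : ∀ n j w y u X tot → suc y ≡ 2 * n → 1 ≤ n → 1 ≤ j → n ≤ w * j →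
  (2 * n) ^ (n * j + n * j) * X ≤ y ^ (n * j + n * j) * (tot * (n * u)) → j * X ≤ 4 * (w * u) * tot
low-estimate n j w y u X tot y≡ 1≤n 1≤j n≤ hyp = *-cancelˡ-≤ (n * n * j) {{>-nonZero (*-mono-≤ (*-mono-≤ 1≤n 1≤n) 1≤j)}} (begin
  n * n * j * (j * X) ≡⟨ expand n j X ⟩
  (α * α) * X ≤⟨ *-monoˡ-≤ X (*-mono-≤ (m≤n+m α y) (m≤n+m α y)) ⟩
  ((y + α) * (y + α)) * X ≤⟨ *-cancelˡ-≤ (e * e) {{>-nonZero (*-mono-≤ 1≤e 1≤e)}} cancelled ⟩
  y * y * (tot * (n * u)) ≤⟨ *-monoˡ-≤ (tot * (n * u)) (*-mono-≤ y≤2n y≤2n) ⟩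
  (2 * n) * (2 * n) * (tot * (n * u)) ≤⟨ *-monoʳ-≤ ((2 * n) * (2 * n)) (*-monoʳ-≤ tot (*-monoˡ-≤ u n≤)) ⟩
  (2 * n) * (2 * n) * (tot * (w * j * u)) ≡⟨ collect n j w u tot ⟩
  n * n * j * (4 * (w * u) * tot) ∎)
  where
  open ≤-Reasoning
  α = n * j
  e = y ^ α
  y≤2n : y ≤ 2 * n
  y≤2n = ≤-trans (n≤1+n y) (≤-reflexive y≡)
  1≤y : 1 ≤ y
  1≤y = ≤-pred (≤-trans (*-monoʳ-≤ 2 1≤n) (≤-reflexive (sym y≡)))
  1≤e : 1 ≤ e
  1≤e = m^n>0 y {{>-nonZero 1≤y}} α
  b : e * (y + α) ≤ (2 * n) ^ α * y
  b = ≤-trans (bernoulli y α) (≤-reflexive (cong (λ z → z ^ α * y) y≡))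
  expand : ∀ n j X → n * n * j * (j * X) ≡ (n * j * (n * j)) * X
  expand = solve-∀
  collect : ∀ n j w u t → (2 * n) * (2 * n) * (t * (w * j * u)) ≡ n * n * j * (4 * (w * u) * t)
  collect = solve-∀
  pair-up : ∀ e a X → (e * e) * ((a * a) * X) ≡ (e * a) * (e * a) * X
  pair-up = solve-∀
  split-off : ∀ f y X → (f * y) * (f * y) * X ≡ y * y * (f * f * X)
  split-off = solve-∀
  move : ∀ y e t → y * y * (e * e * t) ≡ (e * e) * (y * y * t)
  move = solve-∀
  cancelled : (e * e) * (((y + α) * (y + α)) * X) ≤ (e * e) * (y * y * (tot * (n * u)))
  cancelled = begin
    (e * e) * (((y + α) * (y + α)) * X) ≡⟨ pair-up e (y + α) X ⟩
    (e * (y + α)) * (e * (y + α)) * X ≤⟨ *-monoˡ-≤ X (*-mono-≤ b b) ⟩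
    ((2 * n) ^ α * y) * ((2 * n) ^ α * y) * X ≡⟨ split-off ((2 * n) ^ α) y X ⟩
    y * y * ((2 * n) ^ α * (2 * n) ^ α * X) ≡⟨ cong (λ z → y * y * (z * X)) (^-distribˡ-+-* (2 * n) α α) ⟨
    y * y * ((2 * n) ^ (α + α) * X) ≤⟨ *-monoʳ-≤ (y * y) hyp ⟩
    y * y * (y ^ (α + α) * (tot * (n * u))) ≡⟨ cong (λ z → y * y * (z * (tot * (n * u)))) (^-distribˡ-+-* y α α) ⟩
    y * y * (e * e * (tot * (n * u))) ≡⟨ move y e (tot * (n * u)) ⟩
    (e * e) * (y * y * (tot * (n * u))) ∎

^-distribʳ-* : ∀ a b d → (a * b) ^ d ≡ a ^ d * b ^ d
^-distribʳ-* a b zero = refl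
^-distribʳ-* a b (suc d) = trans (cong (a * b *_) (^-distribʳ-* a b d)) (regroup a b (a ^ d) (b ^ d))
  where
  regroup : ∀ a b e f → a * b * (e * f) ≡ a * e * (b * f)
  regroup = solve-∀

-- Each of the `d < L` outward switches costs a factor of at most `w`, and the inward one gains
-- `M′`.
late-estimate : ∀ n T c M′ G B w d L X tot → 1 ≤ n → 1 ≤ B → 1 ≤ w → d < L → M′ * n ≤ G → T * n * (n ∸ 1) ≤ w * B →
  G * (B ^ d * X) ≤ T * n * suc c * ((T * n * (n ∸ 1)) ^ d * (tot * suc d)) →
  M′ * X ≤ T * suc c * w ^ L * L * tot
late-estimate n T c M′ G B w d L X tot 1≤n 1≤B 1≤w d<L M′n≤G ≤wB hyp =
  *-cancelˡ-≤ (n * B ^ d) {{>-nonZero (*-mono-≤ 1≤n (m^n>0 B {{>-nonZero 1≤B}} d))}} (begin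
    n * B ^ d * (M′ * X) ≡⟨ reorder n (B ^ d) M′ X ⟩
    M′ * n * (B ^ d * X) ≤⟨ *-monoˡ-≤ (B ^ d * X) M′n≤G ⟩
    G * (B ^ d * X) ≤⟨ hyp ⟩
    T * n * suc c * ((T * n * (n ∸ 1)) ^ d * (tot * suc d))
      ≤⟨ *-monoʳ-≤ (T * n * suc c) (*-mono-≤ (^-monoˡ-≤ d ≤wB) (*-monoʳ-≤ tot d<L)) ⟩
    T * n * suc c * ((w * B) ^ d * (tot * L)) ≡⟨ cong (λ z → T * n * suc c * (z * (tot * L))) (^-distribʳ-* w B d) ⟩
    T * n * suc c * (w ^ d * B ^ d * (tot * L))
      ≤⟨ *-monoʳ-≤ (T * n * suc c) (*-monoˡ-≤ (tot * L) (*-monoˡ-≤ (B ^ d) (^-monoʳ-≤ w {{>-nonZero 1≤w}} (<⇒≤ d<L)))) ⟩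
    T * n * suc c * (w ^ L * B ^ d * (tot * L)) ≡⟨ reorder′ T n (suc c) (w ^ L) (B ^ d) tot L ⟩
    n * B ^ d * (T * suc c * w ^ L * L * tot) ∎)
  where
  open ≤-Reasoning
  reorder : ∀ n b m x → n * b * (m * x) ≡ m * n * (b * x)
  reorder = solve-∀
  reorder′ : ∀ T n c w b t L → T * n * c * (w * b * (t * L)) ≡ n * b * (T * c * w * L * t)
  reorder′ = solve-∀

-- Numerical conditions on n

module _ (n N : ℕ) (2N+n : 2 * N + n ≡ n * n) where

  private
    2N≡ : ∀ {n′} → n ≡ suc n′ → 2 * N ≡ n * n′
    2N≡ {n′} refl = +-cancelʳ-≡ (suc n′) _ _ (trans 2N+n (expand n′))
      where
      expand : ∀ a → suc a * suc a ≡ suc a * a + suc a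
      expand = solve-∀

  edges-isolated : ∀ j M → 16 * j ≤ n → suc (4 * M) ≤ n → 2 * (2 * j) * (n ∸ 1) + M * n ≤ N
  edges-isolated j M 16j≤n 4M<n = *-cancelˡ-≤ 4 (begin
    4 * (2 * (2 * j) * (n ∸ 1) + M * n) ≡⟨ expand j (n ∸ 1) M n ⟩
    16 * j * (n ∸ 1) + 4 * M * n ≤⟨ +-mono-≤ (*-monoˡ-≤ (n ∸ 1) 16j≤n) (*-monoˡ-≤ n (∸-monoˡ-≤ 1 4M<n)) ⟩
    n * (n ∸ 1) + (n ∸ 1) * n ≡⟨ collect n (n ∸ 1) ⟩
    2 * (n * (n ∸ 1)) ≡⟨ cong (2 *_) (2N≡ (sym (m+[n∸m]≡n 1≤n))) ⟨
    2 * (2 * N) ≡⟨ *-assoc 2 2 N ⟨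
    4 * N ∎)
    where
    open ≤-Reasoning
    1≤n : 1 ≤ n
    1≤n = ≤-trans (s≤s z≤n) 4M<n
    expand : ∀ j m M n → 4 * (2 * (2 * j) * m + M * n) ≡ 16 * j * m + 4 * M * n
    expand = solve-∀
    collect : ∀ n m → n * m + m * n ≡ 2 * (n * m)
    collect = solve-∀

  edges-low : ∀ k → 1 ≤ n → 2 * k ≤ n → N ≤ n * (n ∸ k)
  edges-low k 1≤n 2k≤n = *-cancelˡ-≤ 2 (begin
    2 * N ≡⟨ 2N≡ (sym (m+[n∸m]≡n 1≤n)) ⟩
    n * (n ∸ 1) ≤⟨ *-monoʳ-≤ n (m∸n≤m n 1) ⟩
    n * n ≤⟨ *-monoʳ-≤ n half ⟩
    n * (2 * (n ∸ k)) ≡⟨ reorder n (n ∸ k) ⟩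
    2 * (n * (n ∸ k)) ∎)
    where
    open ≤-Reasoning
    reorder : ∀ a b → a * (2 * b) ≡ 2 * (a * b)
    reorder = solve-∀
    k+k≤n : k + k ≤ n
    k+k≤n = ≤-trans (≤-reflexive (cong (k +_) (sym (+-identityʳ k)))) 2k≤n
    half : n ≤ 2 * (n ∸ k)
    half = begin
      n ≡⟨ m+[n∸m]≡n (m+n≤o⇒m≤o k k+k≤n) ⟨
      k + (n ∸ k) ≤⟨ +-monoˡ-≤ (n ∸ k) (m+n≤o⇒m≤o∸n k k+k≤n) ⟩
      (n ∸ k) + (n ∸ k) ≡⟨ cong ((n ∸ k) +_) (+-identityʳ (n ∸ k)) ⟨
      2 * (n ∸ k) ∎

  -- This keeps n^2 / 8 positions available for outward switches. By 16 j <= n it reduces to 2 n^2 +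
  -- 8 (n - 1) <= 4 n (n - 1), which fails at n = 5 and holds from 6 on.
  edges-remain : ∀ j → 16 * j ≤ n → 6 ≤ n → n * n + 8 * ((n * j + n * j) + (n ∸ 1)) ≤ 8 * N
  edges-remain j 16j≤n 6≤n = begin
    n * n + 8 * ((n * j + n * j) + n′) ≡⟨ expand n j n′ ⟩
    n * n + n * (16 * j) + 8 * n′ ≤⟨ +-monoˡ-≤ (8 * n′) (+-monoʳ-≤ (n * n) (*-monoʳ-≤ n 16j≤n)) ⟩
    n * n + n * n + 8 * n′ ≤⟨ polynomial (∸-monoˡ-≤ 1 6≤n) (m+[n∸m]≡n (≤-trans (s≤s z≤n) 6≤n)) ⟩
    4 * (n * n′) ≡⟨ cong (4 *_) (2N≡ (sym (m+[n∸m]≡n (≤-trans (s≤s z≤n) 6≤n)))) ⟨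
    4 * (2 * N) ≡⟨ *-assoc 4 2 N ⟨
    8 * N ∎
    where
    open ≤-Reasoning
    n′ = n ∸ 1
    expand : ∀ n j m → n * n + 8 * ((n * j + n * j) + m) ≡ n * n + n * (16 * j) + 8 * m
    expand = solve-∀
    shifted : ∀ e → ((6 + e) * (6 + e) + (6 + e) * (6 + e) + 8 * (5 + e)) + (8 + 12 * e + 2 * (e * e)) ≡ 4 * ((6 + e) * (5 + e))
    shifted = solve-∀
    polynomial : ∀ {a b} → 5 ≤ a → suc a ≡ b → b * b + b * b + 8 * a ≤ 4 * (b * a)
    polynomial {a} 5≤a refl = subst (λ a → suc a * suc a + suc a * suc a + 8 * a ≤ 4 * (suc a * a)) (m+[n∸m]≡n 5≤a)
      (≤-trans (m≤m+n _ (8 + 12 * (a ∸ 5) + 2 * ((a ∸ 5) * (a ∸ 5)))) (≤-reflexive (shifted (a ∸ 5))))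

-- The choice of parameters

module Parameters (c p q r : ℕ) (1≤p : 1 ≤ p) (1≤q : 1 ≤ q) where

  -- No constant depends on a later choice. `s` grants each of the five causes a fifth of 1 / (r +
  -- 1); `a` makes n / a deficient vertices affordable; `T` is dictated by `deficient-rare`; `L`
  -- bounds the early degree; `C` collects the bounded factors of the switches, and `M′` exceeds it
  -- by `s * L`, as there are `L` values of the early degree. `suc T` in `M` leaves room for
  -- `t + c`.
  k u a s T K L C M M′ : ℕ
  k = 2 + c
  u = 2 ^ k
  a = 2 * k * q
  s = 5 * suc r
  T = s * (a * a * k)
  K = a * T
  L = K + k
  C = T * suc c * (8 * T) ^ L * L
  M′ = s * C * L
  M = suc T + M′

  wasteBound lowBound : ℕ
  wasteBound = 4 * (T * ((4 * u) * (4 * u)))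
  lowBound = 4 * (31 * u)

  requirements : List ℕ
  requirements = 2 * (a * suc k) ∷ s * wasteBound ∷ s * 2 ^ (31 * M) ∷ s * lowBound ∷ suc (4 * M) ∷ 2 * k ∷ 6 ∷ []

  threshold : ℕ
  threshold = 16 * ∑ requirements id

  1≤a : 1 ≤ a
  1≤a = *-mono-≤ {1} {2 * k} {1} {q} (s≤s z≤n) 1≤q

  1≤s : 1 ≤ s
  1≤s = s≤s z≤n

  1≤T : 1 ≤ T
  1≤T = *-mono-≤ {1} {s} {1} {a * a * k} 1≤s (*-mono-≤ {1} {a * a} {1} {k} (*-mono-≤ 1≤a 1≤a) (s≤s z≤n))

  private
    1≤L : 1 ≤ L
    1≤L = ≤-trans (s≤s z≤n) (m≤n+m k K)

    1≤8T : 1 ≤ 8 * T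
    1≤8T = ≤-trans 1≤T (m≤m+n T (7 * T))

    1≤u : 1 ≤ u
    1≤u = m^n>0 2 k

    1≤C : 1 ≤ C
    1≤C = *-mono-≤ {1} {T * suc c * (8 * T) ^ L} {1} {L} (*-mono-≤ {1} {T * suc c} {1} {(8 * T) ^ L}
      (*-mono-≤ {1} {T} {1} {suc c} 1≤T (s≤s z≤n)) (m^n>0 (8 * T) {{>-nonZero 1≤8T}} L)) 1≤L

    1≤waste : 1 ≤ wasteBound
    1≤waste = *-mono-≤ {1} {4} {1} {T * ((4 * u) * (4 * u))} (s≤s z≤n) (*-mono-≤ 1≤T (*-mono-≤ 1≤4u 1≤4u))
      where
      1≤4u : 1 ≤ 4 * u
      1≤4u = ≤-trans 1≤u (m≤m+n u (3 * u))

    1≤low : 1 ≤ lowBound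
    1≤low = *-mono-≤ {1} {4} {1} {31 * u} (s≤s z≤n) (≤-trans 1≤u (m≤m+n u (30 * u)))

  module _ (n : ℕ) where

    open Play c p q T n 1≤p 1≤T

    module Estimates (j : ℕ) (16j≤n : 16 * j ≤ n) (n≤31j : n ≤ 31 * j) (required : ∀ {b} → b ∈ requirements → b ≤ j) where

      private
        N = length (allEdges n)
        t = T * n
        m₀ = M * n
        -- `m₁` is quadratic, so that crude estimates show the hitting time to come earlier, yet at
        -- most n^2 / 8, so that a positive fraction of the edges comes later.
        m₁ = n * j + n * j

        j≤n : j ≤ n
        j≤n = ≤-trans (m≤m+n j (15 * j)) 16j≤n

        6≤j : 6 ≤ j
        6≤j = required (there (there (there (there (there (there (here refl)))))))

        6≤n : 6 ≤ n
        6≤n = ≤-trans 6≤j j≤n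

        1≤j : 1 ≤ j
        1≤j = ≤-trans (s≤s z≤n) 6≤j

        1≤n : 1 ≤ n
        1≤n = ≤-trans 1≤j j≤n

        4M<j : suc (4 * M) ≤ j
        4M<j = required (there (there (there (there (here refl)))))

        2k≤n : 2 * k ≤ n
        2k≤n = ≤-trans (required (there (there (there (there (there (here refl))))))) j≤n

        t≤m₀ : t ≤ m₀
        t≤m₀ = *-monoˡ-≤ n (≤-trans (n≤1+n T) (m≤m+n (suc T) M′))

        m₀≤m₁ : m₀ ≤ m₁
        m₀≤m₁ = ≤-trans (≤-reflexive (*-comm M n)) (≤-trans (*-monoʳ-≤ n
          (≤-trans (m≤m+n M (3 * M)) (≤-trans (n≤1+n (4 * M)) 4M<j))) (m≤m+n (n * j) (n * j)))

        remain : n * n + 8 * (m₁ + (n ∸ 1)) ≤ 8 * N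
        remain = edges-remain n N (length-allEdges n) j 16j≤n 6≤n

        m₁≤N : m₁ ≤ N
        m₁≤N = *-cancelˡ-≤ 8 (≤-trans (*-monoʳ-≤ 8 (m≤m+n m₁ (n ∸ 1))) (≤-trans (m≤n+m _ (n * n)) remain))

        open Typical m₀ m₁ t≤m₀ m₀≤m₁ m₁≤N

        tot : ℕ
        tot = totalOrders n

        deficient-bound : s * ∑ (orders n) (λ π → χ (deficient? π)) ≤ tot
        deficient-bound = scale s (a * a * (n * k)) t _ tot
          (*-mono-≤ {1} {a * a} {1} {n * k} (*-mono-≤ 1≤a 1≤a) (*-mono-≤ {1} {n} {1} {k} 1≤n (s≤s z≤n)))
          (≤-reflexive (regroup s a n k))
          (≤-trans (deficient-rare a (≤-trans (required (here refl)) j≤n) (≤-trans t≤m₀ (≤-trans m₀≤m₁ m₁≤N)))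
            (≤-reflexive (*-comm tot _)))
          where
          regroup : ∀ s a n k → s * (a * a * (n * k)) ≡ s * (a * a * k) * n
          regroup = solve-∀

        waste-bound : s * ∑ (orders n) (λ π → χ (wasted? π)) ≤ tot
        waste-bound = scale s wasteBound n _ tot 1≤waste (≤-trans (required (there (here refl))) j≤n)
          (waste-estimate n T u _ tot (≤-trans (s≤s (s≤s (s≤s (s≤s z≤n)))) 6≤n)
            (waste-rare n k t (≤-trans t≤m₀ (≤-trans m₀≤m₁ m₁≤N))))

        isolated-bound : s * ∑ (orders n) (λ π → χ (covered? π)) ≤ tot
        isolated-bound = scale s (2 ^ (31 * M)) (suc n) _ tot (m^n>0 2 (31 * M))
          (≤-trans (required (there (there (here refl)))) (≤-trans j≤n (n≤1+n n)))
          (isolated-estimate n j (31 * M) m₀ _ tot 1≤j m₀≤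
            (no-isolated-rare n (2 * j) m₀ (edges-isolated n N (length-allEdges n) j M 16j≤n (≤-trans 4M<j j≤n))))
          where
          m₀≤ : m₀ ≤ 31 * M * j
          m₀≤ = ≤-trans (*-monoʳ-≤ M n≤31j) (≤-reflexive (*-turn M 31 j))

        low-bound : s * ∑ (orders n) (λ π → χ (low? π)) ≤ tot
        low-bound = scale s lowBound j _ tot 1≤low (required (there (there (there (here refl)))))
          (low-estimate n j 31 (2 * n ∸ 1) u _ tot y≡ 1≤n 1≤j n≤31j
            (low-degree-rare n k m₁ (2 * n ∸ 1) y≡ (edges-low n N (length-allEdges n) k 1≤n 2k≤n) m₁≤N))
          where
          y≡ : suc (2 * n ∸ 1) ≡ 2 * n
          y≡ = m+[n∸m]≡n (≤-trans 1≤n (m≤m+n n (n + 0)))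

        outside : ℕ
        outside = N ∸ (m₁ + (n ∸ 1))

        n²≤8·outside : n * n ≤ 8 * outside
        n²≤8·outside = ≤-trans (m+n≤o⇒m≤o∸n (n * n) remain) (≤-reflexive (sym (*-distribˡ-∸ 8 N (m₁ + (n ∸ 1)))))

        late-bound : ∀ d → d < L → s * L * #late (suc d) c 0 ≤ tot
        late-bound d d<L = scale (s * L) C M′ _ tot 1≤C (≤-reflexive (regroup s L C))
          (late-estimate n T c M′ (m₀ ∸ (t + c)) outside (8 * T) d L _ tot 1≤n 1≤outside 1≤8T d<L
            (m+n≤o⇒m≤o∸n (M′ * n) window) enough (late-rare d c ≤-refl))
          where
          open ≤-Reasoning
          regroup : ∀ s l c → s * l * c ≡ s * c * l
          regroup = solve-∀
          1≤outside : 1 ≤ outside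
          1≤outside = n≢0⇒n>0 (λ outside≡0 → <⇒≱ (*-mono-≤ 1≤n 1≤n) (≤-trans n²≤8·outside (≤-reflexive (cong (8 *_) outside≡0))))
          window : M′ * n + (t + c) ≤ m₀
          window = begin
            M′ * n + (T * n + c) ≤⟨ +-monoʳ-≤ (M′ * n) (+-monoʳ-≤ (T * n) (≤-trans (≤-trans (m≤n+m c 2) (m≤m+n k _)) 2k≤n)) ⟩
            M′ * n + (T * n + n) ≡⟨ collect M′ T n ⟩
            (suc T + M′) * n ∎
            where
            collect : ∀ M T n → M * n + (T * n + n) ≡ (suc T + M) * n
            collect = solve-∀
          enough : T * n * (n ∸ 1) ≤ 8 * T * outside
          enough = begin
            T * n * (n ∸ 1) ≤⟨ *-monoʳ-≤ (T * n) (m∸n≤m n 1) ⟩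
            T * n * n ≡⟨ *-assoc T n n ⟩
            T * (n * n) ≤⟨ *-monoʳ-≤ T n²≤8·outside ⟩
            T * (8 * outside) ≡⟨ *-turn T 8 outside ⟩
            8 * T * outside ∎

        late-sum : s * ∑ (upTo L) (λ d → #late (suc d) c 0) ≤ tot
        late-sum = *-cancelˡ-≤ L {{>-nonZero 1≤L}} (begin
          L * (s * ∑ (upTo L) (λ d → #late (suc d) c 0)) ≡⟨ *-turn L s _ ⟩
          s * L * ∑ (upTo L) (λ d → #late (suc d) c 0) ≡⟨ ∑-*ˡ (upTo L) (s * L) _ ⟨
          ∑ (upTo L) (λ d → s * L * #late (suc d) c 0) ≤⟨ ∑-≤-const (upTo L) tot (λ d d∈ → late-bound d (∈-upTo⁻ d∈)) ⟩
          length (upTo L) * tot ≡⟨ cong (_* tot) (length-upTo L) ⟩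
          L * tot ∎)
          where
          open ≤-Reasoning

      failures-rare : suc r * failures n k builder ≤ tot
      failures-rare = *-cancelˡ-≤ 5 (begin
        5 * (suc r * failures n k builder) ≡⟨ *-assoc 5 (suc r) (failures n k builder) ⟨
        s * failures n k builder ≤⟨ *-monoʳ-≤ s failures-bound ⟩
        s * (x₁ + x₂ + x₃ + x₄ + x₅) ≡⟨ distribute s x₁ x₂ x₃ x₄ x₅ ⟩
        s * x₁ + s * x₂ + s * x₃ + s * x₄ + s * x₅
          ≤⟨ +-mono-≤ (+-mono-≤ (+-mono-≤ (+-mono-≤ deficient-bound waste-bound) isolated-bound) low-bound) late-sum ⟩
        tot + tot + tot + tot + tot ≡⟨ five tot ⟩
        5 * tot ∎)
        where
        open ≤-Reasoning
        x₁ = ∑ (orders n) (λ π → χ (deficient? π))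
        x₂ = ∑ (orders n) (λ π → χ (wasted? π))
        x₃ = ∑ (orders n) (λ π → χ (covered? π))
        x₄ = ∑ (orders n) (λ π → χ (low? π))
        x₅ = ∑ (upTo L) (λ d → #late (suc d) c 0)
        distribute : ∀ s a b c d e → s * (a + b + c + d + e) ≡ s * a + s * b + s * c + s * d + s * e
        distribute = solve-∀
        five : ∀ t → t + t + t + t + t ≡ 5 * t
        five = solve-∀

    eventually-rare : n ≥ threshold → suc r * failures n k builder ≤ totalOrders n
    eventually-rare n≥ = Estimates.failures-rare j 16j≤n n≤31j required
      where
      open ≤-Reasoning
      -- From n <= 16 j + 15 and 1 <= j the ratio of `n` to `j` lies between 16 and 31.
      j = n / 16
      n≡ : n ≡ n % 16 + j * 16
      n≡ = m≡m%n+[m/n]*n n 16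
      J≤j : ∑ requirements id ≤ j
      J≤j = ≤-pred (*-cancelˡ-< 16 _ _ (begin-strict
        16 * ∑ requirements id ≤⟨ n≥ ⟩
        n ≡⟨ n≡ ⟩
        n % 16 + j * 16 <⟨ +-monoˡ-< (j * 16) (m%n<n n 16) ⟩
        16 + j * 16 ≡⟨ *-comm (suc j) 16 ⟩
        16 * suc j ∎))
      required : ∀ {b} → b ∈ requirements → b ≤ j
      required b∈ = ≤-trans (∑-∈ id b∈) J≤j
      16j≤n : 16 * j ≤ n
      16j≤n = begin
        16 * j ≡⟨ *-comm 16 j ⟩
        j * 16 ≤⟨ m≤n+m (j * 16) (n % 16) ⟩
        n % 16 + j * 16 ≡⟨ n≡ ⟨
        n ∎
      n≤31j : n ≤ 31 * j
      n≤31j = begin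
        n ≡⟨ n≡ ⟩
        n % 16 + j * 16 ≤⟨ +-monoˡ-≤ (j * 16) (≤-pred (m%n<n n 16)) ⟩
        15 + j * 16 ≤⟨ +-monoˡ-≤ (j * 16) (*-monoʳ-≤ 15 1≤j) ⟩
        15 * j + j * 16 ≡⟨ collect j ⟩
        31 * j ∎
        where
        collect : ∀ j → 15 * j + j * 16 ≡ 31 * j
        collect = solve-∀
        1≤j : 1 ≤ j
        1≤j = ≤-trans (s≤s z≤n) (required (there (there (there (there (there (there (here refl))))))))

  approximation : Σ (∀ n → Strategy n) (λ S →
    (∀ n π → WithinBudget k p q n (length (builderGraph k (S n) π))) ×
    Σ ℕ (λ n₀ → ∀ n → n ≥ n₀ → suc r * failures n k (S n) ≤ totalOrders n))
  approximation = (λ n → Play.builder c p q T n 1≤p 1≤T) , (λ n → Play.builder-budget c p q T n 1≤p 1≤T) ,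
    threshold , eventually-rare

-- Diagonal choice of the accuracy

module Diagonal (n₀ : ℕ → ℕ) where

  -- The search runs downwards because the thresholds need not increase with the accuracy; the
  -- default 0 is legitimate once `n₀ 0 ≤ n`.
  accuracy : ℕ → ℕ → ℕ
  accuracy n zero = zero
  accuracy n (suc b) with n₀ (suc b) ≤? n
  ... | yes _ = suc b
  ... | no _ = accuracy n b

  accuracy-allowed : ∀ n b → n₀ 0 ≤ n → n₀ (accuracy n b) ≤ n
  accuracy-allowed n zero n₀≤ = n₀≤
  accuracy-allowed n (suc b) n₀≤ with n₀ (suc b) ≤? n
  ... | yes ok = ok
  ... | no _ = accuracy-allowed n b n₀≤

  accuracy-≥ : ∀ n b {r} → r ≤ b → n₀ r ≤ n → r ≤ accuracy n b
  accuracy-≥ n zero r≤0 _ = r≤0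
  accuracy-≥ n (suc b) {r} r≤ n₀r≤ with n₀ (suc b) ≤? n
  ... | yes _ = r≤
  ... | no not = accuracy-≥ n b (≤-pred (≤∧≢⇒< r≤ (λ r≡ → not (subst (λ r → n₀ r ≤ n) r≡ n₀r≤)))) n₀r≤

diagonal : ∀ k p q →
  (∀ r → Σ (∀ n → Strategy n) (λ S →
    (∀ n π → WithinBudget k p q n (length (builderGraph k (S n) π))) ×
    Σ ℕ (λ n₀ → ∀ n → n ≥ n₀ → suc r * failures n k (S n) ≤ totalOrders n))) →
  Σ (∀ n → Strategy n) (λ S →
    (∀ n π → WithinBudget k p q n (length (builderGraph k (S n) π))) ×
    (∀ r → Σ ℕ (λ n₀ → ∀ n → n ≥ n₀ → suc r * failures n k (S n) ≤ totalOrders n)))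
diagonal k p q family = S , (λ n → proj₁ (proj₂ (family (accuracy n n))) n) , rare
  where
  n₀ : ℕ → ℕ
  n₀ r = proj₁ (proj₂ (proj₂ (family r)))
  open Diagonal n₀
  S : ∀ n → Strategy n
  S n = proj₁ (family (accuracy n n)) n
  rare : ∀ r → Σ ℕ (λ n₁ → ∀ n → n ≥ n₁ → suc r * failures n k (S n) ≤ totalOrders n)
  -- `n₀ 0` justifies the default accuracy; `n₀ r` and `r` make `r` a successful candidate in the
  -- search up to `n`.
  rare r = n₀ 0 + n₀ r + r , λ n n≥ →
    ≤-trans (*-monoˡ-≤ (failures n k (S n))
        (s≤s (accuracy-≥ n n (≤-trans (m≤n+m r (n₀ 0 + n₀ r)) n≥) (≤-trans (≤-trans (m≤n+m (n₀ r) (n₀ 0)) (m≤m+n _ r)) n≥))))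
      (proj₂ (proj₂ (proj₂ (family (accuracy n n)))) n
        (accuracy-allowed n n (≤-trans (≤-trans (m≤m+n (n₀ 0) (n₀ r)) (m≤m+n _ r)) n≥)))

theorem1p1 : (k : ℕ) → 2 ≤ k → (p q : ℕ) → 1 ≤ p → 1 ≤ q →
    Σ ((n : ℕ) → Strategy n) (λ S →
    ((n : ℕ) → (π : List (Edge n)) →
    WithinBudget k p q n (length (builderGraph k (S n) π)))
    × ((r : ℕ) → Σ ℕ (λ n₀ → (n : ℕ) → n ≥ n₀ →
    suc r * failures n k (S n) ≤ totalOrders n)))
theorem1p1 (suc (suc c)) (s≤s (s≤s z≤n)) p q 1≤p 1≤q =
  diagonal (2 + c) p q (λ r → Parameters.approximation c p q r 1≤p 1≤q)
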